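{- There exists a function $f$ with $f(n)=o(n)$ such that for all integers $m\ge1$, $0\le n\le m$ and every $S\subseteq[m]$ with $|S|=n$, there is a representation of $S$ using at most $\mathcal{B}(n,m)+f(n)$ bits from which $\mathrm{rank}(x,S)$ ($x\in[m]$) and $\mathrm{select}(i,S)$ ($1\le i\le n$) can each be answered with $O(1)$ cell probes in the cell probe model with word size $\Theta(\lg m)$.
   Context: $[m]=\{0,\dots,m-1\}$, $\lg=\log_2$, $\mathcal{B}(n,m)=\lceil\lg\binom{m}{n}\rceil$. $\mathrm{rank}(x,S)$ returns $-1$ if $x\notin S$ and $|\{y\in S:y<x\}|$ otherwise; $\mathrm{select}(i,S)$ returns the $i$-th smallest element of $S$. In the cell probe model, memory consists of cells (words) of a given size, and the cost of a query is only the number of cells read; all other computation is free. $O(1)$ means a bound independent of $n,m,S$. -}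

module Defs where

open import Data.Nat using (ℕ; zero; suc; _+_; _*_; _∸_; _≤_; _<_)
open import Data.Nat.Logarithm using (⌈log₂_⌉)
open import Data.Nat.Combinatorics using (_C_)
open import Data.Bool using (Bool; true; false; if_then_else_)
open import Data.Fin using (Fin; toℕ)
open import Data.Fin.Subset using (Subset)
open import Data.Vec using (lookup)
open import Data.List using (List; []; _∷_; filterᵇ; length)
open import Data.List.Base using (allFin)
open import Data.Integer using (ℤ; +_; -[1+_])
open import Data.Maybe using (Maybe; just; nothing)
open import Data.Product using (Σ; ∃; _×_; _,_)

𝓑 : ℕ → ℕ → ℕ
𝓑 n m = ⌈log₂ (m C n) ⌉

-- f(n) = o(n):  for every k, eventually k * f(n) ≤ n
-- (equivalently f(n)/n → 0, stated over ℕ)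
LittleO : (ℕ → ℕ) → Set
LittleO f = ∀ (k : ℕ) → ∃ λ (N : ℕ) → ∀ (n : ℕ) → N ≤ n → k * f n ≤ n

elemsAsc : ∀ {m} → Subset m → List (Fin m)
elemsAsc {m} S = filterᵇ (λ y → lookup S y) (allFin m)

rank : ∀ {m} → Fin m → Subset m → ℤ
rank {m} x S =
  if lookup S x
  then + length (filterᵇ (λ y → Data.Nat._<ᵇ_ (toℕ y) (toℕ x)) (elemsAsc S))
  else -[1+ 0 ]

nth : ∀ {A : Set} → ℕ → List A → Maybe A
nth _ [] = nothing
nth zero (x ∷ xs) = just x
nth (suc k) (x ∷ xs) = nth k xs

select : ∀ {m} → ℕ → Subset m → Maybe (Fin m)
select i S = nth (i ∸ 1) (elemsAsc S)

-- Cell probe model with word size w.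
-- Memory is a bit string; cell j consists of the bits j*w, …, j*w + w - 1.
-- A memory of "size ℓ bits" is one whose bits at positions ≥ ℓ are all 0
-- (i.e. the last cell is zero-padded).

Memory : Set
Memory = ℕ → Bool

UsesAtMostBits : ℕ → Memory → Set
UsesAtMostBits ℓ mem = ∀ (i : ℕ) → ℓ ≤ i → mem i ≡ false
  where open import Relation.Binary.PropositionalEquality using (_≡_)

cell : (w : ℕ) → Memory → ℕ → (Fin w → Bool)
cell w mem j b = mem (j * w + toℕ b)

-- An adaptive query algorithm: a decision tree that reads cells; all
-- computation between probes is free (arbitrary continuation).
data Probe (w : ℕ) (A : Set) : Set where
  answer : A → Probe w A
  probe  : ℕ → ((Fin w → Bool) → Probe w A) → Probe w A

data ProbesAtMost {w : ℕ} {A : Set} : ℕ → Probe w A → Set where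
  ans-ok   : ∀ {t} (a : A) → ProbesAtMost t (answer a)
  probe-ok : ∀ {t} j k → (∀ c → ProbesAtMost t (k c)) → ProbesAtMost (suc t) (probe j k)

run : ∀ {w A} → Memory → Probe w A → A
run mem (answer a) = a
run {w} mem (probe j k) = run mem (k (cell w mem j))

{-# OPTIONS --safe #-}
-- Let l = ⌈lg (m + 1)⌉ and let β be a power of two with β⁴ ≤ l < 16 β⁴. On a universe of at most n β^O(1) positions a
-- dictionary with rank and select has redundancy O(1 + n / β): tries of constant depth and fan-out β, whose leaves hold at
-- most β³ elements in an optimal code, on blocks of β^O(1) positions, with an explicit table over the blocks.
-- A sparser set is split into the high parts of its elements (cells, from a universe of about n β^D) and r low bits stored
-- verbatim. Stored are the set of occupied cells and the set of indices at which a new cell starts. For an element that is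
-- not the first in its cell, the index is recovered by a monotone perfect hash function of O(lg l) bits; every
-- such element lowers lg (cells choose occupied cells) by more than that, so only o(n) bits are paid in excess of 𝓑(n, m).
-- The hash functions themselves are part of the query algorithm and cost nothing but their index in a family.
module Submission where

open import Defs
open import Data.Nat
open import Data.Nat.Properties
open import Data.Nat.DivMod using (_/_; _%_; _mod_; m≡m%n+[m/n]*n; m%n<n; m/n*n≤m; m<n*o⇒m/o<n; m/n≤m; /-monoˡ-≤; /-monoʳ-≤; m*n/n≡m; m<n⇒m/n≡0; m<n⇒m%n≡m; [m+kn]%n≡m%n; +-distrib-/-∣ʳ)
open import Data.Nat.Divisibility using (divides)
open import Data.Nat.Logarithm
open import Data.Nat.Combinatorics using (_C_; nCk≡nC[n∸k]; nCn≡1; nCk+nC[k+1]≡[n+1]C[k+1])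
open import Data.Nat.Induction using (<-rec)
open import Data.Nat.Tactic.RingSolver using (solve-∀)
open import Data.Bool using (Bool; true; false; if_then_else_; _∧_; not; T)
open import Data.Bool.Properties using (T-≡; ∧-zeroʳ)
open import Data.Fin using (Fin; toℕ; fromℕ<)
import Data.Fin as Fin
open import Data.Fin.Properties using (toℕ<n; toℕ-fromℕ<; toℕ-injective)
open import Data.Fin.Subset using (Subset; ∣_∣)
import Data.Integer as ℤ
open import Data.Integer using (ℤ)
open import Data.Maybe using (Maybe; just; nothing; _<∣>_)
open import Data.Vec using (lookup; []; _∷_)
open import Data.List using (List; []; _∷_; length; _++_; replicate; map; filterᵇ; tabulate)
open import Data.List.Properties using (length-++; length-replicate; length-map)
open import Data.List.Membership.Propositional using (_∈_)
open import Data.List.Membership.Propositional.Properties using (∈-++⁺ˡ; ∈-++⁺ʳ; ∈-++⁻; ∈-map⁺; ∈-map⁻)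
open import Data.List.Relation.Unary.Any using (here; there)
open import Data.Product using (Σ; ∃; _×_; _,_; proj₁; proj₂)
open import Data.Sum using (_⊎_; inj₁; inj₂)
open import Data.Unit using (⊤; tt)
open import Data.Empty using (⊥; ⊥-elim)
open import Function using (_∘_; Equivalence)
open import Relation.Nullary using (¬_; Dec; yes; no; contradiction)
open import Relation.Binary.Definitions using (tri<; tri≈; tri>)
open import Relation.Binary.PropositionalEquality

-- Arithmetic

-- The obstacle is that a pointer or a group number takes about l bits, unboundedly more than one
-- element may cost, while the o(n) term must not depend on m. Words of that length are therefore
-- paid once per about β^7 elements; as l ≤ β^5, a factor β remains after the constants are
-- absorbed. A larger m only makes β larger, so the loss of order n / β can be bounded in terms of
-- n. Bits of order lg l per element are affordable only if something else shrinks. An element that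
-- shares its cell leaves one occupied cell fewer to be chosen, which divides the binomial
-- coefficient by at least β^58: of these factors 57 pay for the hint and its retrieval, and one for
-- the position of the element among the starts. The growth estimate needs slightly more than β^58
-- cells per element, hence D = 59. The hash functions come from an averaging argument over all
-- functions. They may depend on m and n but not on S, which is why a whole family must be fixed
-- beforehand and an index into it stored.

<ᵇ-true : ∀ {x y} → x < y → (x <ᵇ y) ≡ true
<ᵇ-true p = Equivalence.to T-≡ (<⇒<ᵇ p)

<ᵇ-false : ∀ {x y} → y ≤ x → (x <ᵇ y) ≡ false
<ᵇ-false {x} {y} p with x <ᵇ y in eq
... | false = refl
... | true  = contradiction (<ᵇ⇒< x y (subst T (sym eq) tt)) (≤⇒≯ p)

<ᵇ-true⁻¹ : ∀ {x y} → (x <ᵇ y) ≡ true → x < y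
<ᵇ-true⁻¹ {x} {y} e = <ᵇ⇒< x y (subst T (sym e) tt)

≡ᵇ-true : ∀ {x y} → x ≡ y → (x ≡ᵇ y) ≡ true
≡ᵇ-true {x} {y} p = Equivalence.to T-≡ (≡⇒≡ᵇ x y p)

≡ᵇ-false : ∀ {x y} → x ≢ y → (x ≡ᵇ y) ≡ false
≡ᵇ-false {x} {y} p with x ≡ᵇ y in eq
... | false = refl
... | true  = contradiction (≡ᵇ⇒≡ x y (subst T (sym eq) tt)) p

≡ᵇ-true⁻¹ : ∀ {x y} → (x ≡ᵇ y) ≡ true → x ≡ y
≡ᵇ-true⁻¹ {x} {y} e = ≡ᵇ⇒≡ x y (subst T (sym e) tt)

∧-true⁻¹ : ∀ {x y} → (x ∧ y) ≡ true → x ≡ true × y ≡ true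
∧-true⁻¹ {true} e = refl , e

2^-pos : ∀ n → 1 ≤ 2 ^ n
2^-pos n = m^n>0 2 n

m<2^m : ∀ m → m < 2 ^ m
m<2^m zero = s≤s z≤n
m<2^m (suc m) = begin
  2 + m           ≡⟨ +-comm 1 (suc m) ⟩
  suc m + 1       ≤⟨ +-mono-≤ (m<2^m m) (2^-pos m) ⟩
  2 ^ m + 2 ^ m   ≡⟨ cong (_+_ (2 ^ m)) (sym (+-identityʳ (2 ^ m))) ⟩
  2 ^ suc m       ∎
  where open ≤-Reasoning

2^-cancel-≤ : ∀ {x y} → 2 ^ x ≤ 2 ^ y → x ≤ y
2^-cancel-≤ {x} {y} p with x ≤? y
... | yes q = q
... | no q = contradiction p (<⇒≱ (^-monoʳ-< 2 (s≤s (s≤s z≤n)) (≰⇒> q)))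

^-distribʳ-* : ∀ k m n → (m * n) ^ k ≡ m ^ k * n ^ k
^-distribʳ-* zero m n = refl
^-distribʳ-* (suc k) m n rewrite ^-distribʳ-* k m n = lem m n (m ^ k) (n ^ k)
  where
  lem : ∀ a b c d → a * b * (c * d) ≡ a * c * (b * d)
  lem = solve-∀

n≤2^⌈log₂n⌉ : ∀ n → n ≤ 2 ^ ⌈log₂ n ⌉
n≤2^⌈log₂n⌉ = <-rec _ go
  where
  go : ∀ n → (∀ {k} → k < n → k ≤ 2 ^ ⌈log₂ k ⌉) → n ≤ 2 ^ ⌈log₂ n ⌉
  go 0 _ = z≤n
  go 1 _ = s≤s z≤n
  go (suc (suc n)) ih = begin
    suc (suc n)                        ≡⟨ sym (⌊n/2⌋+⌈n/2⌉≡n (suc (suc n))) ⟩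
    ⌊ suc (suc n) /2⌋ + h              ≤⟨ +-monoˡ-≤ h (⌊n/2⌋≤⌈n/2⌉ (suc (suc n))) ⟩
    h + h                              ≤⟨ +-mono-≤ i i ⟩
    2 ^ ⌈log₂ h ⌉ + 2 ^ ⌈log₂ h ⌉      ≡⟨ cong (_+_ (2 ^ ⌈log₂ h ⌉)) (sym (+-identityʳ (2 ^ ⌈log₂ h ⌉))) ⟩
    2 ^ suc ⌈log₂ h ⌉                  ≡⟨ cong (λ z → 2 ^ suc z) (⌈log₂⌈n/2⌉⌉≡⌈log₂n⌉∸1 (suc (suc n))) ⟩
    2 ^ suc (⌈log₂ suc (suc n) ⌉ ∸ 1)  ≡⟨ cong (2 ^_) (m+[n∸m]≡n (⌈log₂⌉-mono-≤ {2} {suc (suc n)} (s≤s (s≤s z≤n)))) ⟩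
    2 ^ ⌈log₂ suc (suc n) ⌉            ∎
    where
    open ≤-Reasoning
    h = ⌈ suc (suc n) /2⌉
    i = ih (⌈n/2⌉<n n)

⌈log₂⌉-least : ∀ {n} k → n ≤ 2 ^ k → ⌈log₂ n ⌉ ≤ k
⌈log₂⌉-least {n} k p = subst (⌈log₂ n ⌉ ≤_) (⌈log₂2^n⌉≡n k) (⌈log₂⌉-mono-≤ p)

2^⌈log₂n⌉≤2n : ∀ n → 1 ≤ n → 2 ^ ⌈log₂ n ⌉ ≤ 2 * n
2^⌈log₂n⌉≤2n n p with ⌈log₂ n ⌉ in eq
... | zero = ≤-trans p (m≤m+n n _)
... | suc k with n ≤? 2 ^ k
...   | yes q = contradiction (⌈log₂⌉-least k q) (<⇒≱ (subst (k <_) (sym eq) ≤-refl))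
...   | no q  = *-monoʳ-≤ 2 (<⇒≤ (≰⇒> q))

-- (1 + j/q)^s ≤ 1 + 2sj/q, cleared of denominators.
bernoulli : ∀ q j s → 2 * (s * j) ≤ q → q * (q + j) ^ s ≤ (q + 2 * (s * j)) * q ^ s
bernoulli q j zero _ = ≤-reflexive (cong (_* 1) (sym (+-identityʳ q)))
bernoulli q j (suc s) p = begin
  q * ((q + j) * (q + j) ^ s)             ≡⟨ e₁ q j ((q + j) ^ s) ⟩
  (q + j) * (q * (q + j) ^ s)             ≤⟨ *-monoʳ-≤ (q + j) (bernoulli q j s p') ⟩
  (q + j) * ((q + 2 * (s * j)) * q ^ s)   ≡⟨ e₂ q j s (q ^ s) ⟩
  (q * q + q * (2 * (s * j)) + q * j + j * (2 * (s * j))) * q ^ s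
    ≤⟨ *-monoˡ-≤ (q ^ s) (+-monoʳ-≤ (q * q + q * (2 * (s * j)) + q * j) (*-monoʳ-≤ j p')) ⟩
  (q * q + q * (2 * (s * j)) + q * j + j * q) * q ^ s
    ≡⟨ e₃ q j s (q ^ s) ⟩
  (q + 2 * (suc s * j)) * (q * q ^ s)     ∎
  where
  open ≤-Reasoning
  p' : 2 * (s * j) ≤ q
  p' = ≤-trans (*-monoʳ-≤ 2 (m≤n+m (s * j) j)) p
  e₁ : ∀ q j x → q * ((q + j) * x) ≡ (q + j) * (q * x)
  e₁ = solve-∀
  e₂ : ∀ q j s x → (q + j) * ((q + 2 * (s * j)) * x) ≡ (q * q + q * (2 * (s * j)) + q * j + j * (2 * (s * j))) * x
  e₂ = solve-∀
  e₃ : ∀ q j s x → (q * q + q * (2 * (s * j)) + q * j + j * q) * x ≡ (q + 2 * ((1 + s) * j)) * (q * x)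
  e₃ = solve-∀

-- Plays the role of `(1 + j/q)^s ≤ exp (s j / q)`, both for the mean of the hash potential and in
-- the estimates `bin-slots` and `bin-near`.
[q+j]^s≤2q^s : ∀ q j s → 1 ≤ q → 2 * (s * j) ≤ q → (q + j) ^ s ≤ 2 * q ^ s
[q+j]^s≤2q^s q@(suc _) j s _ p = *-cancelˡ-≤ q (begin
  q * (q + j) ^ s                ≤⟨ bernoulli q j s p ⟩
  (q + 2 * (s * j)) * q ^ s      ≤⟨ *-monoˡ-≤ (q ^ s) (+-monoʳ-≤ q p) ⟩
  (q + q) * q ^ s                ≡⟨ e q (q ^ s) ⟩
  q * (2 * q ^ s)                ∎)
  where
  open ≤-Reasoning
  e : ∀ q x → (q + q) * x ≡ q * (2 * x)
  e = solve-∀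

-- Binomial coefficients

-- Pascal's recursion holds by computation here, which carries the inductions below; `bin≡C`
-- translates to `_C_` only in the final theorem.
bin : ℕ → ℕ → ℕ
bin _ zero = 1
bin zero (suc k) = 0
bin (suc n) (suc k) = bin n k + bin n (suc k)

bin≡C : ∀ n k → bin n k ≡ n C k
bin≡C n zero = sym (nC0 n)
  where
  nC0 : ∀ n → n C 0 ≡ 1
  nC0 n = trans (nCk≡nC[n∸k] {0} {n} z≤n) (nCn≡1 n)
bin≡C zero (suc k) = refl
bin≡C (suc n) (suc k) = trans (cong₂ _+_ (bin≡C n k) (bin≡C n (suc k))) (nCk+nC[k+1]≡[n+1]C[k+1] n k)

bin-pos : ∀ {n k} → k ≤ n → 1 ≤ bin n k
bin-pos {n} {zero} _ = ≤-refl
bin-pos {suc n} {suc k} (s≤s p) = ≤-trans (bin-pos p) (m≤m+n _ _)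

bin-zero : ∀ {n k} → n < k → bin n k ≡ 0
bin-zero {zero} {suc k} _ = refl
bin-zero {suc n} {suc k} (s≤s p) = cong₂ _+_ (bin-zero p) (bin-zero (m≤n⇒m≤1+n p))

bin-monoˡ : ∀ {n n'} k → n ≤ n' → bin n k ≤ bin n' k
bin-monoˡ zero _ = ≤-refl
bin-monoˡ {zero} (suc k) _ = z≤n
bin-monoˡ {suc n} {suc n'} (suc k) (s≤s p) = +-mono-≤ (bin-monoˡ k p) (bin-monoˡ (suc k) p)

bin≤2^n : ∀ n k → bin n k ≤ 2 ^ n
bin≤2^n n zero = 2^-pos n
bin≤2^n zero (suc k) = z≤n
bin≤2^n (suc n) (suc k) = subst (bin n k + bin n (suc k) ≤_) (cong (_+_ (2 ^ n)) (sym (+-identityʳ (2 ^ n)))) (+-mono-≤ (bin≤2^n n k) (bin≤2^n n (suc k)))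

bin≤n^k : ∀ n k → bin n k ≤ n ^ k
bin≤n^k n zero = ≤-refl
bin≤n^k zero (suc k) = z≤n
bin≤n^k (suc n) (suc k) = begin
  bin n k + bin n (suc k)         ≤⟨ +-mono-≤ (bin≤n^k n k) (bin≤n^k n (suc k)) ⟩
  n ^ k + n * n ^ k               ≤⟨ *-monoʳ-≤ (suc n) (^-monoˡ-≤ k (n≤1+n n)) ⟩
  suc n ^ suc k                   ∎
  where open ≤-Reasoning

-- One term of Vandermonde's convolution. It allows codes of disjoint pieces to be concatenated: the
-- logarithms of the pieces add up to at most the logarithm of the whole.
bin-vandermonde : ∀ u s v t → bin u s * bin v t ≤ bin (u + v) (s + t)
bin-vandermonde zero zero v t = ≤-reflexive (+-identityʳ _)
bin-vandermonde zero (suc s) v t = z≤n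
bin-vandermonde (suc u) zero v t = begin
  bin v t + 0           ≡⟨ +-identityʳ _ ⟩
  bin v t               ≤⟨ bin-monoˡ t (m≤n+m v (suc u)) ⟩
  bin (suc u + v) t     ∎
  where open ≤-Reasoning
bin-vandermonde (suc u) (suc s) v t = begin
  (bin u s + bin u (suc s)) * bin v t             ≡⟨ *-distribʳ-+ (bin v t) (bin u s) _ ⟩
  bin u s * bin v t + bin u (suc s) * bin v t     ≤⟨ +-mono-≤ (bin-vandermonde u s v t) (bin-vandermonde u (suc s) v t) ⟩
  bin (u + v) (s + t) + bin (u + v) (suc s + t)   ∎
  where open ≤-Reasoning

-- A single term of the binomial expansion of (x + 1)ⁿ, multiplied by xᵉ.
bin*x^n≤[1+x]^n*x^e : ∀ n e x → bin n e * x ^ n ≤ (1 + x) ^ n * x ^ e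
bin*x^n≤[1+x]^n*x^e n zero x = begin
  1 * x ^ n            ≡⟨ *-comm 1 (x ^ n) ⟩
  x ^ n * 1            ≤⟨ *-monoˡ-≤ 1 (^-monoˡ-≤ n (n≤1+n x)) ⟩
  (1 + x) ^ n * 1      ∎
  where open ≤-Reasoning
bin*x^n≤[1+x]^n*x^e zero (suc e) x = z≤n
bin*x^n≤[1+x]^n*x^e (suc n) (suc e) x = begin
  (bin n e + bin n (suc e)) * (x * x ^ n)         ≡⟨ e₁ (bin n e) (bin n (suc e)) x (x ^ n) ⟩
  x * (bin n e * x ^ n) + x * (bin n (suc e) * x ^ n)
    ≤⟨ +-mono-≤ (*-monoʳ-≤ x (bin*x^n≤[1+x]^n*x^e n e x)) (*-monoʳ-≤ x (bin*x^n≤[1+x]^n*x^e n (suc e) x)) ⟩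
  x * ((1 + x) ^ n * x ^ e) + x * ((1 + x) ^ n * (x * x ^ e))
    ≡⟨ e₂ x ((1 + x) ^ n) (x ^ e) ⟩
  (1 + x) * (1 + x) ^ n * (x * x ^ e)             ∎
  where
  open ≤-Reasoning
  e₁ : ∀ a b x y → (a + b) * (x * y) ≡ x * (a * y) + x * (b * y)
  e₁ = solve-∀
  e₂ : ∀ x y z → x * (y * z) + x * (y * (x * z)) ≡ (1 + x) * y * (x * z)
  e₂ = solve-∀

-- The absorption identity `(k + 1) C(n, k + 1) = (n - k) C(n, k)`, with the subtracted term moved
-- to the left.
bin-absorb : ∀ n k → suc k * bin n (suc k) + k * bin n k ≡ n * bin n k
bin-absorb zero zero = refl
bin-absorb zero (suc k) rewrite *-zeroʳ k = refl
bin-absorb (suc n) zero = begin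
  1 * (1 + bin n 1) + 0 ≡⟨ e (bin n 1) ⟩
  1 + (1 * bin n 1 + 0)   ≡⟨ cong suc (bin-absorb n 0) ⟩
  1 + n * 1             ≡⟨⟩
  suc n * 1             ∎
  where
  open ≡-Reasoning
  e : ∀ x → 1 * (1 + x) + 0 ≡ 1 + (1 * x + 0)
  e = solve-∀
bin-absorb (suc n) (suc k) = begin
  suc (suc k) * (b + c) + suc k * (a + b)                     ≡⟨ e₁ k a b c ⟩
  (suc (suc k) * c + suc k * b) + (suc k * b + k * a) + (b + a) ≡⟨ cong₂ (λ x y → x + y + (b + a)) (bin-absorb n (suc k)) (bin-absorb n k) ⟩
  n * b + n * a + (b + a)                                     ≡⟨ e₂ n a b ⟩
  suc n * (a + b)                                             ∎
  where
  open ≡-Reasoning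
  a = bin n k
  b = bin n (suc k)
  c = bin n (suc (suc k))
  e₁ : ∀ k a b c → (2 + k) * (b + c) + (1 + k) * (a + b) ≡ ((2 + k) * c + (1 + k) * b) + ((1 + k) * b + k * a) + (b + a)
  e₁ = solve-∀
  e₂ : ∀ n a b → n * b + n * a + (b + a) ≡ (1 + n) * (a + b)
  e₂ = solve-∀

-- By absorption the quotient of consecutive coefficients at `t` is `(N - t) / (t + 1)`, at least
-- `Y` while `(Y + 1)(t + 1) ≤ N`. In the sparse case `k` counts the elements that are not first in
-- their cell, and `Y` is what each of them may cost.
bin-grow : ∀ N Y s k → suc Y * (s + k) ≤ N → bin N s * Y ^ k ≤ bin N (s + k)
bin-grow N Y s zero _ = ≤-reflexive (trans (*-identityʳ _) (cong (bin N) (sym (+-identityʳ s))))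
bin-grow N Y s (suc k) p = begin
  bin N s * (Y * Y ^ k)        ≡⟨ e (bin N s) Y (Y ^ k) ⟩
  Y * (bin N s * Y ^ k)        ≤⟨ *-monoʳ-≤ Y (bin-grow N Y s k (≤-trans (*-monoʳ-≤ (suc Y) (+-monoʳ-≤ s (n≤1+n k))) p)) ⟩
  Y * bin N t                  ≤⟨ *-cancelˡ-≤ (suc t) step ⟩
  bin N (suc t)                ≡⟨ cong (bin N) (sym (+-suc s k)) ⟩
  bin N (s + suc k)            ∎
  where
  open ≤-Reasoning
  t = s + k
  e : ∀ a b c → a * (b * c) ≡ b * (a * c)
  e = solve-∀
  p' : suc Y * suc t ≤ N
  p' = subst (λ z → suc Y * z ≤ N) (+-suc s k) p
  e₂ : ∀ t Y B → (1 + t) * (Y * B) + t * B + B ≡ ((1 + Y) * (1 + t)) * B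
  e₂ = solve-∀
  step : suc t * (Y * bin N t) ≤ suc t * bin N (suc t)
  step = +-cancelʳ-≤ (t * bin N t) _ _ (begin
    suc t * (Y * bin N t) + t * bin N t               ≤⟨ m≤m+n _ (bin N t) ⟩
    suc t * (Y * bin N t) + t * bin N t + bin N t     ≡⟨ e₂ t Y (bin N t) ⟩
    (suc Y * suc t) * bin N t                         ≤⟨ *-monoˡ-≤ (bin N t) p' ⟩
    N * bin N t                                       ≡⟨ sym (bin-absorb N t) ⟩
    suc t * bin N (suc t) + t * bin N t               ∎)

-- Up to the middle the coefficients increase, so the first summand of Pascal's rule is at most the
-- second. Used to drop the last, possibly incomplete cell at the price of one bit.
bin-suc≤ : ∀ M n → 2 * n ≤ suc M → bin (suc M) n ≤ 2 * bin M n
bin-suc≤ M zero _ = s≤s z≤n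
bin-suc≤ M (suc n) p = begin
  bin M n + bin M (suc n)          ≤⟨ +-monoˡ-≤ (bin M (suc n)) le ⟩
  bin M (suc n) + bin M (suc n)    ≡⟨ cong (_+_ (bin M (suc n))) (sym (+-identityʳ _)) ⟩
  2 * bin M (suc n)                ∎
  where
  open ≤-Reasoning
  p' : suc n + n ≤ M
  p' = ≤-trans (≤-reflexive (trans (+-comm (suc n) n) (cong (n +_) (sym (+-identityʳ (suc n)))))) (s≤s⁻¹ p)
  le : bin M n ≤ bin M (suc n)
  le = *-cancelˡ-≤ (suc n) (+-cancelʳ-≤ (n * bin M n) _ _ (begin
    suc n * bin M n + n * bin M n         ≡⟨ sym (*-distribʳ-+ (bin M n) (suc n) n) ⟩
    (suc n + n) * bin M n                 ≤⟨ *-monoˡ-≤ (bin M n) p' ⟩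
    M * bin M n                           ≡⟨ sym (bin-absorb M n) ⟩
    suc n * bin M (suc n) + n * bin M n   ∎))

-- Choosing `n` of `M` blocks and one of `q` points in each gives distinct `n`-subsets. With
-- `q = 2 ^ r` this charges the low bits stored verbatim to the binomial coefficient.
bin-blocks : ∀ M q n → bin M n * q ^ n ≤ bin (M * q) n
bin-blocks M q zero = s≤s z≤n
bin-blocks zero q (suc n) = z≤n
bin-blocks (suc M) q (suc n) = begin
  (bin M n + bin M (suc n)) * (q * q ^ n)            ≡⟨ e (bin M n) (bin M (suc n)) q (q ^ n) ⟩
  q * (bin M n * q ^ n) + bin M (suc n) * (q * q ^ n)
    ≤⟨ +-mono-≤ (*-monoʳ-≤ q (bin-blocks M q n)) (bin-blocks M q (suc n)) ⟩
  q * bin (M * q) n + bin (M * q) (suc n)            ≤⟨ grow q ⟩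
  bin (q + M * q) (suc n)                            ∎
  where
  open ≤-Reasoning
  e : ∀ a b q y → (a + b) * (q * y) ≡ q * (a * y) + b * (q * y)
  e = solve-∀
  grow : ∀ j → j * bin (M * q) n + bin (M * q) (suc n) ≤ bin (j + M * q) (suc n)
  grow zero = ≤-refl
  grow (suc j) = begin
    bin (M * q) n + j * bin (M * q) n + bin (M * q) (suc n)   ≡⟨ +-assoc (bin (M * q) n) _ _ ⟩
    bin (M * q) n + (j * bin (M * q) n + bin (M * q) (suc n)) ≤⟨ +-mono-≤ (bin-monoˡ n (m≤n+m (M * q) j)) (grow j) ⟩
    bin (j + M * q) n + bin (j + M * q) (suc n)               ∎

bin-diag : ∀ n → bin n n ≡ 1
bin-diag zero = refl
bin-diag (suc n) = trans (cong₂ _+_ (bin-diag n) (bin-zero {n} ≤-refl)) refl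

bin-sym : ∀ a b → bin (a + b) a ≡ bin (a + b) b
bin-sym zero zero = refl
bin-sym zero (suc b) = sym (bin-diag (suc b))
bin-sym (suc a) zero rewrite +-identityʳ a = bin-diag (suc a)
bin-sym (suc a) (suc b) = begin
  bin (a + suc b) a + bin (a + suc b) (suc a)   ≡⟨ cong₂ _+_ (bin-sym a (suc b)) e ⟩
  bin (a + suc b) (suc b) + bin (a + suc b) b   ≡⟨ +-comm (bin (a + suc b) (suc b)) _ ⟩
  bin (a + suc b) b + bin (a + suc b) (suc b)   ∎
  where
  open ≡-Reasoning
  e : bin (a + suc b) (suc a) ≡ bin (a + suc b) b
  e = subst (λ z → bin z (suc a) ≡ bin z b) (sym (+-suc a b)) (bin-sym (suc a) b)

-- Sets of naturals: counting and selection

b2n : Bool → ℕ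
b2n true = 1
b2n false = 0

b2n≤1 : ∀ b → b2n b ≤ 1
b2n≤1 true = ≤-refl
b2n≤1 false = z≤n

cnt : (ℕ → Bool) → ℕ → ℕ
cnt p zero = 0
cnt p (suc x) = b2n (p x) + cnt p x

cnt-≤ : ∀ p x → cnt p x ≤ x
cnt-≤ p zero = z≤n
cnt-≤ p (suc x) = +-mono-≤ (b2n≤1 (p x)) (cnt-≤ p x)

cnt-+ : ∀ p o x → cnt p (o + x) ≡ cnt p o + cnt (λ y → p (o + y)) x
cnt-+ p o zero rewrite +-identityʳ o = sym (+-identityʳ _)
cnt-+ p o (suc x) rewrite +-suc o x | cnt-+ p o x = e (b2n (p (o + x))) (cnt p o) _
  where
  e : ∀ a b c → a + (b + c) ≡ b + (a + c)
  e = solve-∀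

cnt-mono : ∀ p {x y} → x ≤ y → cnt p x ≤ cnt p y
cnt-mono p {x} {y} le = subst (λ z → cnt p x ≤ cnt p z) (m+[n∸m]≡n le)
  (subst (cnt p x ≤_) (sym (cnt-+ p x (y ∸ x))) (m≤m+n _ _))

cnt-cong : ∀ p q x → (∀ y → y < x → p y ≡ q y) → cnt p x ≡ cnt q x
cnt-cong p q zero h = refl
cnt-cong p q (suc x) h = cong₂ (λ b c → b2n b + c) (h x ≤-refl) (cnt-cong p q x (λ y l → h y (m≤n⇒m≤1+n l)))

cnt-suc-true : ∀ p {x} → p x ≡ true → cnt p (suc x) ≡ suc (cnt p x)
cnt-suc-true p e rewrite e = refl

cnt-suc-false : ∀ p {x} → p x ≡ false → cnt p (suc x) ≡ cnt p x
cnt-suc-false p e rewrite e = refl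

cnt-< : ∀ p {x u} → p x ≡ true → x < u → cnt p x < cnt p u
cnt-< p {x} {u} e l = subst (_≤ cnt p u) (cnt-suc-true p e) (cnt-mono p l)

cnt-injective : ∀ p {x y} → p x ≡ true → p y ≡ true → cnt p x ≡ cnt p y → x ≡ y
cnt-injective p {x} {y} ex ey e with <-cmp x y
... | tri< l _ _ = contradiction e (<⇒≢ (cnt-< p ex l))
... | tri≈ _ q _ = q
... | tri> _ _ l = contradiction (sym e) (<⇒≢ (cnt-< p ey l))

sel : (ℕ → Bool) → ℕ → ℕ → ℕ
sel p zero i = 0
sel p (suc u) i = if i <ᵇ cnt p u then sel p u i else u

sel-spec : ∀ p u i → i < cnt p u → sel p u i < u × p (sel p u i) ≡ true × cnt p (sel p u i) ≡ i
sel-spec p (suc u) i l with i <? cnt p u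
... | yes q rewrite <ᵇ-true q = let (a , b) = sel-spec p u i q in m≤n⇒m≤1+n a , b
... | no q rewrite <ᵇ-false (≮⇒≥ q) with p u in eq
...   | true  = ≤-refl , refl , ≤-antisym (≮⇒≥ q) (s≤s⁻¹ l)
...   | false = contradiction l q

sel-< : ∀ p u i → i < cnt p u → sel p u i < u
sel-< p u i l = proj₁ (sel-spec p u i l)

sel-∈ : ∀ p u i → i < cnt p u → p (sel p u i) ≡ true
sel-∈ p u i l = proj₁ (proj₂ (sel-spec p u i l))

cnt-sel : ∀ p u i → i < cnt p u → cnt p (sel p u i) ≡ i
cnt-sel p u i l = proj₂ (proj₂ (sel-spec p u i l))

sel-cnt : ∀ p u x → p x ≡ true → x < u → sel p u (cnt p x) ≡ x
sel-cnt p u x e l = cnt-injective p (sel-∈ p u _ l') e (cnt-sel p u _ l')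
  where l' = cnt-< p e l

-- Bit strings and memory contents

bits : ℕ → ℕ → List Bool
bits zero x = []
bits (suc n) x = (x % 2 ≡ᵇ 1) ∷ bits n (x / 2)

val : List Bool → ℕ
val [] = 0
val (b ∷ bs) = b2n b + val bs * 2

length-bits : ∀ n x → length (bits n x) ≡ n
length-bits zero x = refl
length-bits (suc n) x = cong suc (length-bits n (x / 2))

val-bits : ∀ n x → x < 2 ^ n → val (bits n x) ≡ x
val-bits zero zero l = refl
val-bits zero (suc x) (s≤s ())
val-bits (suc n) x l = begin
  b2n (x % 2 ≡ᵇ 1) + val (bits n (x / 2)) * 2
    ≡⟨ cong₂ (λ a b → a + b * 2) (b2n-%2 (x % 2) (m%n<n x 2)) (val-bits n (x / 2) (m<n*o⇒m/o<n (subst (x <_) (*-comm 2 (2 ^ n)) l))) ⟩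
  x % 2 + x / 2 * 2   ≡⟨ sym (m≡m%n+[m/n]*n x 2) ⟩
  x                   ∎
  where
  open ≡-Reasoning
  b2n-%2 : ∀ y → y < 2 → b2n (y ≡ᵇ 1) ≡ y
  b2n-%2 0 _ = refl
  b2n-%2 1 _ = refl
  b2n-%2 (suc (suc _)) (s≤s (s≤s ()))

At : Memory → ℕ → List Bool → Set
At mem o [] = ⊤
At mem o (b ∷ bs) = mem o ≡ b × At mem (suc o) bs

At-++ˡ : ∀ {mem o} xs {ys} → At mem o (xs ++ ys) → At mem o xs
At-++ˡ [] _ = tt
At-++ˡ (x ∷ xs) (e , h) = e , At-++ˡ xs h

At-++ʳ : ∀ {mem o} xs {ys} → At mem o (xs ++ ys) → At mem (o + length xs) ys
At-++ʳ {mem} {o} [] {ys} h = subst (λ z → At mem z ys) (sym (+-identityʳ o)) h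
At-++ʳ {mem} {o} (x ∷ xs) {ys} (_ , h) = subst (λ z → At mem z ys) (sym (+-suc o (length xs))) (At-++ʳ xs h)

slice : Memory → ℕ → ℕ → List Bool
slice mem o zero = []
slice mem o (suc n) = mem o ∷ slice mem (suc o) n

At-slice : ∀ {mem} o bs → At mem o bs → slice mem o (length bs) ≡ bs
At-slice o [] _ = refl
At-slice o (b ∷ bs) (e , h) = cong₂ _∷_ e (At-slice (suc o) bs h)

slice-cong : ∀ {g mem : Memory} o n → (∀ i → o ≤ i → i < o + n → g i ≡ mem i) → slice g o n ≡ slice mem o n
slice-cong o zero h = refl
slice-cong o (suc n) h = cong₂ _∷_ (h o ≤-refl (m<m+n o (s≤s z≤n)))
  (slice-cong (suc o) n (λ i a b → h i (<⇒≤ a) (subst (i <_) (sym (+-suc o n)) b)))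

look : List Bool → Memory
look [] i = false
look (b ∷ bs) zero = b
look (b ∷ bs) (suc i) = look bs i

look-≥ : ∀ bs i → length bs ≤ i → look bs i ≡ false
look-≥ [] i _ = refl
look-≥ (b ∷ bs) (suc i) (s≤s l) = look-≥ bs i l

At-look : ∀ bs → At (look bs) 0 bs
At-look bs = go (look bs) 0 bs (λ _ → refl)
  where
  go : ∀ mem o bs → (∀ i → mem (o + i) ≡ look bs i) → At mem o bs
  go mem o [] h = tt
  go mem o (b ∷ bs) h = trans (cong mem (sym (+-identityʳ o))) (h 0) ,
    go mem (suc o) bs (λ i → trans (cong mem (sym (+-suc o i))) (h (suc i)))

sumF : (ℕ → ℕ) → ℕ → ℕ
sumF f zero = 0
sumF f (suc k) = sumF f k + f k

sumF-const : ∀ c k → sumF (λ _ → c) k ≡ k * c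
sumF-const c zero = refl
sumF-const c (suc k) = trans (cong (_+ c) (sumF-const c k)) (+-comm (k * c) c)

sumF-cong : ∀ {f g : ℕ → ℕ} k → (∀ i → i < k → f i ≡ g i) → sumF f k ≡ sumF g k
sumF-cong zero h = refl
sumF-cong (suc k) h = cong₂ _+_ (sumF-cong k (λ i l → h i (m≤n⇒m≤1+n l))) (h k ≤-refl)

sumF-mono : ∀ {f g : ℕ → ℕ} k → (∀ i → i < k → f i ≤ g i) → sumF f k ≤ sumF g k
sumF-mono zero h = z≤n
sumF-mono (suc k) h = +-mono-≤ (sumF-mono k (λ i l → h i (m≤n⇒m≤1+n l))) (h k ≤-refl)

sumF-≤ : ∀ f {j k} → j ≤ k → sumF f j ≤ sumF f k
sumF-≤ f {zero} _ = z≤n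
sumF-≤ f {suc j} {suc k} (s≤s l) with m≤n⇒m<n∨m≡n l
... | inj₁ q = ≤-trans (sumF-≤ f q) (m≤m+n _ (f k))
... | inj₂ refl = ≤-refl

catF : (ℕ → List Bool) → ℕ → List Bool
catF f zero = []
catF f (suc k) = catF f k ++ f k

length-catF : ∀ f k → length (catF f k) ≡ sumF (length ∘ f) k
length-catF f zero = refl
length-catF f (suc k) = trans (length-++ (catF f k)) (cong (_+ length (f k)) (length-catF f k))

At-catF : ∀ {mem o} f k c → At mem o (catF f k) → c < k → At mem (o + sumF (length ∘ f) c) (f c)
At-catF {mem} {o} f (suc k) c h (s≤s l) with m≤n⇒m<n∨m≡n l
... | inj₁ q = At-catF f k c (At-++ˡ (catF f k) h) q
... | inj₂ refl = subst (λ z → At mem (o + z) (f c)) (length-catF f c) (At-++ʳ (catF f c) h)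

arr : ℕ → (ℕ → ℕ) → ℕ → List Bool
arr κ f k = catF (λ i → bits κ (f i)) k

sumF-length-bits : ∀ κ (f : ℕ → ℕ) k → sumF (λ i → length (bits κ (f i))) k ≡ k * κ
sumF-length-bits κ f k = trans (sumF-cong k (λ i _ → length-bits κ (f i))) (sumF-const κ k)

length-arr : ∀ κ f k → length (arr κ f k) ≡ k * κ
length-arr κ f k = trans (length-catF _ k) (sumF-length-bits κ f k)

At-arr : ∀ {mem o} κ f k c → At mem o (arr κ f k) → c < k → At mem (o + c * κ) (bits κ (f c))
At-arr {mem} {o} κ f k c h l = subst (λ z → At mem (o + z) (bits κ (f c))) (sumF-length-bits κ f c) (At-catF _ k c h l)

padTo : ℕ → List Bool → List Bool
padTo L bs = bs ++ replicate (L ∸ length bs) false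

length-padTo : ∀ L bs → length bs ≤ L → length (padTo L bs) ≡ L
length-padTo L bs h = trans (length-++ bs) (trans (cong (length bs +_) (length-replicate (L ∸ length bs))) (m+[n∸m]≡n h))

-- Query programs

-- Prog W A t: at most t reads, each of at most W consecutive bits at an arbitrary bit offset;
-- longer requests are truncated.
data Prog (W : ℕ) (A : Set) : ℕ → Set where
  ret : ∀ {t} → A → Prog W A t
  rd  : ∀ {t} → ℕ → ℕ → (List Bool → Prog W A t) → Prog W A (suc t)

exec : ∀ {W A t} → Memory → Prog W A t → A
exec mem (ret a) = a
exec {W} mem (rd o n k) = exec mem (k (slice mem o (n ⊓ W)))

weaken : ∀ {W A t t'} → t ≤ t' → Prog W A t → Prog W A t'
weaken _ (ret a) = ret a
weaken (s≤s l) (rd o n k) = rd o n (λ b → weaken l (k b))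

exec-weaken : ∀ {W A t t'} mem (l : t ≤ t') (p : Prog W A t) → exec mem (weaken l p) ≡ exec mem p
exec-weaken mem l (ret a) = refl
exec-weaken mem (s≤s l) (rd o n k) = exec-weaken mem l (k _)

abstract
  t≤s+t : ∀ s t → t ≤ s + t
  t≤s+t s t = m≤n+m t s

_>>=_ : ∀ {W A B s t} → Prog W A s → (A → Prog W B t) → Prog W B (s + t)
_>>=_ {s = s} {t} (ret a) f = weaken (t≤s+t s t) (f a)
rd o n k >>= f = rd o n (λ b → k b >>= f)

exec->>= : ∀ {W A B s t} mem (p : Prog W A s) (f : A → Prog W B t) → exec mem (p >>= f) ≡ exec mem (f (exec mem p))
exec->>= {s = s} {t} mem (ret a) f = exec-weaken mem (t≤s+t s t) (f a)
exec->>= mem (rd o n k) f = exec->>= mem (k _) f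

exec-bind : ∀ {W A B s t} mem (p : Prog W A s) (f : A → Prog W B t) {a b} → exec mem p ≡ a → exec mem (f a) ≡ b → exec mem (p >>= f) ≡ b
exec-bind mem p f refl e = trans (exec->>= mem p f) e

rdN : ∀ {W} → ℕ → ℕ → Prog W ℕ 1
rdN o n = rd o n (λ b → ret (val b))

slice-bits : ∀ {mem W} o n x → At mem o (bits n x) → x < 2 ^ n → n ≤ W → val (slice mem o (n ⊓ W)) ≡ x
slice-bits {mem} {W} o n x h l w = trans (cong val (trans (cong (slice mem o) (trans (m≤n⇒m⊓n≡m w) (sym (length-bits n x)))) (At-slice o (bits n x) h))) (val-bits n x l)

exec-rdN : ∀ {W mem} o n x → At mem o (bits n x) → x < 2 ^ n → n ≤ W → exec mem (rdN {W} o n) ≡ x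
exec-rdN = slice-bits

-- The continuation receives a memory that is correct on the cells read and has a default value
-- elsewhere, so `slice` applies to it at any bit offset.
gather : ∀ {w A} .{{_ : NonZero w}} → ℕ → ℕ → (Memory → Probe w A) → Probe w A
gather zero j k = k (λ _ → false)
gather {w} (suc P) j k = probe j (λ c → gather P (suc j) (λ g → k (λ i → if i / w ≡ᵇ j then c (i mod w) else g i)))

gather-cost : ∀ {w A} .{{_ : NonZero w}} P j (k : Memory → Probe w A) {t} → (∀ g → ProbesAtMost t (k g)) → ProbesAtMost (P + t) (gather P j k)
gather-cost zero j k h = h _
gather-cost (suc P) j k h = probe-ok j _ (λ c → gather-cost P (suc j) _ (λ g → h _))

run-gather : ∀ {w A} .{{_ : NonZero w}} mem P j (k : Memory → Probe w A) →
  ∃ λ g → run mem (gather P j k) ≡ run mem (k g) × (∀ i → j ≤ i / w → i / w < j + P → g i ≡ mem i)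
run-gather mem zero j k = _ , refl , λ i a b → contradiction (subst (i / _ <_) (+-identityʳ j) b) (≤⇒≯ a)
run-gather {w} mem (suc P) j k with run-gather mem P (suc j) (λ g → k (λ i → if i / w ≡ᵇ j then cell w mem j (i mod w) else g i))
... | g , e , h = _ , e , good
  where
  good : ∀ i → j ≤ i / w → i / w < j + suc P → (if i / w ≡ᵇ j then cell w mem j (i mod w) else g i) ≡ mem i
  good i a b with i / w ≟ j
  ... | yes q rewrite ≡ᵇ-true q = cong mem (trans (+-comm (j * w) _) (trans (cong₂ _+_ (toℕ-fromℕ< (m%n<n i w)) (cong (_* w) (sym q))) (sym (m≡m%n+[m/n]*n i w))))
  ... | no q rewrite ≡ᵇ-false q = h i (≤∧≢⇒< a (q ∘ sym)) (subst (i / w <_) (+-suc j P) b)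

-- A window of W ≤ Q w bits meets at most Q + 2 cells.
compile : ∀ {W w A t} .{{_ : NonZero w}} → ℕ → Prog W A t → Probe w A
compile Q (ret a) = answer a
compile {W} {w} Q (rd o n k) = gather (2 + Q) (o / w) (λ g → compile Q (k (slice g o (n ⊓ W))))

compile-cost : ∀ {W w A t} .{{_ : NonZero w}} Q (p : Prog W A t) → ProbesAtMost (t * (2 + Q)) (compile Q p)
compile-cost Q (ret a) = ans-ok a
compile-cost {W} {w} Q (rd o n k) = gather-cost (2 + Q) (o / w) _ (λ g → compile-cost Q (k (slice g o (n ⊓ W))))

run-compile : ∀ {W w A t} .{{_ : NonZero w}} Q mem (p : Prog W A t) → W ≤ Q * w → run mem (compile Q p) ≡ exec mem p
run-compile Q mem (ret a) h = refl
run-compile {W} {w} Q mem (rd o n k) h with run-gather mem (2 + Q) (o / w) (λ g → compile Q (k (slice g o (n ⊓ W))))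
... | g , e , ok = trans e (trans (run-compile Q mem (k (slice g o (n ⊓ W))) h) (cong (exec mem ∘ k) (slice-cong o (n ⊓ W) good)))
  where
  good : ∀ i → o ≤ i → i < o + (n ⊓ W) → g i ≡ mem i
  good i a b = ok i (/-monoˡ-≤ w a) (m<n*o⇒m/o<n (begin-strict
    i                              <⟨ b ⟩
    o + (n ⊓ W)                    ≤⟨ +-monoʳ-≤ o (≤-trans (m⊓n≤n n W) h) ⟩
    o + Q * w                      ≡⟨ cong (_+ Q * w) (m≡m%n+[m/n]*n o w) ⟩
    o % w + o / w * w + Q * w      ≤⟨ +-monoˡ-≤ (Q * w) (+-monoˡ-≤ (o / w * w) (<⇒≤ (m%n<n o w))) ⟩
    w + o / w * w + Q * w          ≤⟨ m≤n+m _ w ⟩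
    w + (w + o / w * w + Q * w)    ≡⟨ lem w (o / w) Q ⟩
    (o / w + (2 + Q)) * w          ∎))
    where
    open ≤-Reasoning
    lem : ∀ w q Q → w + (w + q * w + Q * w) ≡ (q + (2 + Q)) * w
    lem = solve-∀

-- Enumerative code of a subset of [0, u)

-- The colexicographic rank among sets of equal size: the sets that avoid the top element `u`
-- precede those that contain it, and `bin u` counts the former.
code : (ℕ → Bool) → ℕ → ℕ
code p zero = 0
code p (suc u) = if p u then bin u (cnt p (suc u)) + code p u else code p u

code-< : ∀ p u → code p u < bin u (cnt p u)
code-< p zero = s≤s z≤n
code-< p (suc u) with p u
... | true  = subst (bin u (suc (cnt p u)) + code p u <_) (+-comm (bin u (suc (cnt p u))) _) (+-monoʳ-< (bin u (suc (cnt p u))) (code-< p u))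
... | false = <-≤-trans (code-< p u) (bin-monoˡ (cnt p u) (n≤1+n u))

decode : ℕ → ℕ → ℕ → ℕ → Bool
decode zero s c x = false
decode (suc u) s c x =
  if c <ᵇ bin u s then (if x ≡ᵇ u then false else decode u s c x)
  else (if x ≡ᵇ u then true else decode u (s ∸ 1) (c ∸ bin u s) x)

decode-code : ∀ p u x → x < u → decode u (cnt p u) (code p u) x ≡ p x
decode-code p (suc u) x l with p u in eq
... | true rewrite <ᵇ-false (m≤m+n (bin u (suc (cnt p u))) (code p u)) with x ≟ u
...   | yes refl rewrite ≡ᵇ-true {x} refl = sym eq
...   | no q rewrite ≡ᵇ-false q | m+n∸m≡n (bin u (suc (cnt p u))) (code p u) = decode-code p u x (≤∧≢⇒< (s≤s⁻¹ l) q)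
decode-code p (suc u) x l | false rewrite <ᵇ-true (code-< p u) with x ≟ u
...   | yes refl rewrite ≡ᵇ-true {x} refl = sym eq
...   | no q rewrite ≡ᵇ-false q = decode-code p u x (≤∧≢⇒< (s≤s⁻¹ l) q)

sel-cong : ∀ p q u i → (∀ y → y < u → p y ≡ q y) → sel p u i ≡ sel q u i
sel-cong p q zero i h = refl
sel-cong p q (suc u) i h rewrite cnt-cong p q u (λ y l → h y (m≤n⇒m≤1+n l)) | sel-cong p q u i (λ y l → h y (m≤n⇒m≤1+n l)) = refl

leaf : ℕ → (ℕ → Bool) → List Bool
leaf u p = bits ⌈log₂ bin u (cnt p u) ⌉ (code p u)

leafQ : ∀ {W A t} → ℕ → ℕ → ℕ → ((ℕ → Bool) → A) → Prog W A (suc t)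
leafQ u s o f = rd o ⌈log₂ bin u s ⌉ (λ b → ret (f (decode u s (val b))))

exec-leafQ : ∀ {W A t mem} u p o (f : (ℕ → Bool) → A) {r} → ⌈log₂ bin u (cnt p u) ⌉ ≤ W → At mem o (leaf u p) →
  (∀ q → (∀ y → y < u → q y ≡ p y) → f q ≡ r) → exec mem (leafQ {W} {A} {t} u (cnt p u) o f) ≡ r
exec-leafQ u p o f w at h = h _ (λ y l → trans (cong (λ z → decode u (cnt p u) z y)
  (slice-bits o _ (code p u) at (<-≤-trans (code-< p u) (n≤2^⌈log₂n⌉ _)) w)) (decode-code p u y l))

-- Rounding the logarithm up costs one bit. Sizes are kept in this multiplicative form so that the
-- binomial coefficients of several leaves can be merged before any further rounding.
leaf-size : ∀ u p → 2 ^ length (leaf u p) ≤ bin u (cnt p u) * 2 ^ 1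
leaf-size u p rewrite length-bits ⌈log₂ bin u (cnt p u) ⌉ (code p u) =
  subst (2 ^ ⌈log₂ bin u (cnt p u) ⌉ ≤_) (*-comm 2 (bin u (cnt p u))) (2^⌈log₂n⌉≤2n _ (≤-trans (s≤s z≤n) (code-< p u)))

-- Nodes

-- Predecessor search: the greatest `c` below `k` with `f c ≤ i`, if there is one. Monotonicity of
-- `f` is not assumed. It serves for positions and for counts, and also to pick parameters from
-- sequences of powers.
blk : (ℕ → ℕ) → ℕ → ℕ → ℕ
blk f zero i = 0
blk f (suc k) i = if i <ᵇ f k then blk f k i else k

blk-spec : ∀ f k i → f 0 ≤ i → i < f k → blk f k i < k × f (blk f k i) ≤ i × i < f (suc (blk f k i))
blk-spec f zero i a b = contradiction b (≤⇒≯ a)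
blk-spec f (suc k) i a b with i <? f k
... | yes q rewrite <ᵇ-true q = let (x , y) = blk-spec f k i a q in m≤n⇒m≤1+n x , y
... | no q rewrite <ᵇ-false (≮⇒≥ q) = ≤-refl , ≮⇒≥ q , b

blk-cong : ∀ f g k i → (∀ j → j < k → f j ≡ g j) → blk f k i ≡ blk g k i
blk-cong f g zero i h = refl
blk-cong f g (suc k) i h rewrite h k ≤-refl | blk-cong f g k i (λ j l → h j (m≤n⇒m≤1+n l)) = refl

cut : ℕ → ℕ → ℕ → ℕ
cut v u c = c * v ⊓ u

cut-mono : ∀ v u c → cut v u c ≤ cut v u (suc c)
cut-mono v u c = ⊓-monoˡ-≤ u (m≤n+m (c * v) v)

cut-end : ∀ v u k → u ≤ k * v → cut v u k ≡ u
cut-end v u k = m≥n⇒m⊓n≡n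

piece : ℕ → ℕ → ℕ → ℕ
piece v u c = cut v u (suc c) ∸ cut v u c

cut+piece : ∀ v u c → cut v u c + piece v u c ≡ cut v u (suc c)
cut+piece v u c = m+[n∸m]≡n (cut-mono v u c)

piece≤v : ∀ v u c → piece v u c ≤ v
piece≤v v u c = m≤n+o⇒m∸n≤o (cut v u (suc c)) (cut v u c) (begin
  (v + c * v) ⊓ u         ≤⟨ ⊓-monoʳ-≤ (v + c * v) (m≤n+m u v) ⟩
  (v + c * v) ⊓ (v + u)   ≡⟨ sym (+-distribˡ-⊓ v (c * v) u) ⟩
  v + (c * v ⊓ u)         ≡⟨ +-comm v _ ⟩
  (c * v ⊓ u) + v         ∎)
  where open ≤-Reasoning

shift : (ℕ → Bool) → ℕ → ℕ → Bool
shift p o y = p (o + y)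

cnt-piece : ∀ p v u c → cnt p (cut v u (suc c)) ≡ cnt p (cut v u c) + cnt (shift p (cut v u c)) (piece v u c)
cnt-piece p v u c = trans (cong (cnt p) (sym (cut+piece v u c))) (cnt-+ p (cut v u c) (piece v u c))

cnt-cut≤ : ∀ p v u c → cnt p (cut v u c) ≤ cnt p u
cnt-cut≤ p v u c = cnt-mono p (m⊓n≤n (c * v) u)

-- A node is a table of `suc k` prefix counts, a table of `k` child offsets measured from the end of
-- both tables, and the children. Two adjacent counts give the cardinality of a child, without which
-- its code cannot be decoded.
module Node (v u k κ : ℕ) (enc : ℕ → (ℕ → Bool) → List Bool) where

  child : (ℕ → Bool) → ℕ → List Bool
  child p c = enc (piece v u c) (shift p (cut v u c))

  childrenLen : (ℕ → Bool) → ℕ → ℕ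
  childrenLen p = sumF (λ c → length (child p c))

  node : (ℕ → Bool) → List Bool
  node p = arr κ (λ c → cnt p (cut v u c)) (suc k) ++ arr κ (childrenLen p) k ++ catF (child p) k

  length-node : ∀ p → length (node p) ≡ suc k * κ + (k * κ + childrenLen p k)
  length-node p = trans (length-++ (arr κ (λ c → cnt p (cut v u c)) (suc k)))
    (cong₂ _+_ (length-arr κ _ (suc k)) (trans (length-++ (arr κ (childrenLen p) k)) (cong₂ _+_ (length-arr κ _ k) (length-catF _ k))))

  nodeAt : ∀ {W A t} → ℕ → ℕ → (ℕ → ℕ → ℕ → Prog W A t) → Prog W A (3 + t)
  nodeAt o c f =
    rdN (o + c * κ) κ >>= λ t₀ →
    rdN (o + suc c * κ) κ >>= λ t₁ →
    rdN (o + suc k * κ + c * κ) κ >>= λ q →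
    f t₀ (t₁ ∸ t₀) (o + suc k * κ + k * κ + q)

  At-counts : ∀ {mem o} p → At mem o (node p) → At mem o (arr κ (λ c → cnt p (cut v u c)) (suc k))
  At-counts p at = At-++ˡ (arr κ (λ c → cnt p (cut v u c)) (suc k)) at

  exec-nodeAt : ∀ {W A t mem o} p c (f : ℕ → ℕ → ℕ → Prog W A t) {r} →
    cnt p u < 2 ^ κ → childrenLen p k < 2 ^ κ → κ ≤ W → At mem o (node p) → c < k →
    (∀ o' → At mem o' (child p c) → exec mem (f (cnt p (cut v u c)) (cnt (shift p (cut v u c)) (piece v u c)) o') ≡ r) →
    exec mem (nodeAt o c f) ≡ r
  exec-nodeAt {W} {mem = mem} {o} p c f {r} hs hl hw at l h =
    exec-bind mem (rdN (o + c * κ) κ) g₁ (exec-rdN _ κ (Tc c) (At-arr κ Tc (suc k) c at₁ (m≤n⇒m≤1+n l)) (Tc< c) hw)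
    (exec-bind mem (rdN (o + suc c * κ) κ) (g₂ (Tc c)) (exec-rdN _ κ (Tc (suc c)) (At-arr κ Tc (suc k) (suc c) at₁ (s≤s l)) (Tc< (suc c)) hw)
    (exec-bind mem (rdN (o + suc k * κ + c * κ) κ) (g₃ (Tc c) (Tc (suc c)))
      (exec-rdN _ κ (childrenLen p c) (At-arr κ (childrenLen p) k c (At-++ˡ (arr κ (childrenLen p) k) at₂) l) (≤-<-trans (sumF-≤ _ (<⇒≤ l)) hl) hw)
      (trans (cong (λ z → exec mem (f (Tc c) z (o + suc k * κ + k * κ + childrenLen p c))) (trans (cong (_∸ Tc c) (cnt-piece p v u c)) (m+n∸m≡n (Tc c) _)))
        (h _ (At-catF (child p) k c at₃ l)))))
    where
    g₃ : ℕ → ℕ → ℕ → Prog W _ _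
    g₃ t₀ t₁ q = f t₀ (t₁ ∸ t₀) (o + suc k * κ + k * κ + q)
    g₂ : ℕ → ℕ → Prog W _ _
    g₂ t₀ t₁ = rdN (o + suc k * κ + c * κ) κ >>= g₃ t₀ t₁
    g₁ : ℕ → Prog W _ _
    g₁ t₀ = rdN (o + suc c * κ) κ >>= g₂ t₀
    Tc : ℕ → ℕ
    Tc c = cnt p (cut v u c)
    Tc< : ∀ c → Tc c < 2 ^ κ
    Tc< c = ≤-<-trans (cnt-cut≤ p v u c) hs
    at₁ = At-counts p at
    at₂ : At mem (o + suc k * κ) (arr κ (childrenLen p) k ++ catF (child p) k)
    at₂ = subst (λ z → At mem (o + z) (arr κ (childrenLen p) k ++ catF (child p) k)) (length-arr κ Tc (suc k)) (At-++ʳ (arr κ Tc (suc k)) at)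
    at₃ : At mem (o + suc k * κ + k * κ) (catF (child p) k)
    at₃ = subst (λ z → At mem (o + suc k * κ + z) (catF (child p) k)) (length-arr κ (childrenLen p) k) (At-++ʳ (arr κ (childrenLen p) k) at₂)

  -- By Vandermonde the product of the children's coefficients stays below that of the parent, so
  -- only the overheads `ov` accumulate.
  children-size : ∀ p (ov : ℕ → ℕ) j →
    (∀ c → 2 ^ length (child p c) ≤ bin (piece v u c) (cnt (shift p (cut v u c)) (piece v u c)) * 2 ^ ov c) →
    2 ^ childrenLen p j ≤ bin (cut v u j) (cnt p (cut v u j)) * 2 ^ sumF ov j
  children-size p ov zero h = s≤s z≤n
  children-size p ov (suc j) h = begin
    2 ^ (childrenLen p j + length (child p j))            ≡⟨ ^-distribˡ-+-* 2 (childrenLen p j) _ ⟩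
    2 ^ childrenLen p j * 2 ^ length (child p j)          ≤⟨ *-mono-≤ (children-size p ov j h) (h j) ⟩
    (A * 2 ^ sumF ov j) * (B * 2 ^ ov j)                  ≡⟨ e A (2 ^ sumF ov j) B (2 ^ ov j) ⟩
    (A * B) * (2 ^ sumF ov j * 2 ^ ov j)                  ≤⟨ *-monoˡ-≤ _ (bin-vandermonde (cut v u j) (cnt p (cut v u j)) (piece v u j) _) ⟩
    bin (cut v u j + piece v u j) (cnt p (cut v u j) + cnt (shift p (cut v u j)) (piece v u j)) * (2 ^ sumF ov j * 2 ^ ov j)
      ≡⟨ cong₂ _*_ (cong₂ bin (cut+piece v u j) (sym (cnt-piece p v u j))) (sym (^-distribˡ-+-* 2 (sumF ov j) (ov j))) ⟩
    bin (cut v u (suc j)) (cnt p (cut v u (suc j))) * 2 ^ (sumF ov j + ov j) ∎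
    where
    open ≤-Reasoning
    A = bin (cut v u j) (cnt p (cut v u j))
    B = bin (piece v u j) (cnt (shift p (cut v u j)) (piece v u j))
    e : ∀ a b c d → (a * b) * (c * d) ≡ (a * c) * (b * d)
    e = solve-∀

  sumF-cnt-pieces : ∀ p j → sumF (λ c → cnt (shift p (cut v u c)) (piece v u c)) j ≡ cnt p (cut v u j)
  sumF-cnt-pieces p zero = refl
  sumF-cnt-pieces p (suc j) = trans (cong (_+ cnt (shift p (cut v u j)) (piece v u j)) (sumF-cnt-pieces p j)) (sym (cnt-piece p v u j))

  rank-piece : ∀ p c x → cut v u c ≤ x → cnt p x ≡ cnt p (cut v u c) + cnt (shift p (cut v u c)) (x ∸ cut v u c)
  rank-piece p c x l = trans (cong (cnt p) (sym (m+[n∸m]≡n l))) (cnt-+ p (cut v u c) _)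

  sel-piece : ∀ p c i → cnt p (cut v u c) ≤ i → i < cnt p (cut v u (suc c)) →
    cut v u c + sel (shift p (cut v u c)) (piece v u c) (i ∸ cnt p (cut v u c)) ≡ sel p u i
  sel-piece p c i a b = trans (sym (sel-cnt p u y y∈ y<)) (cong (sel p u) (trans (cnt-+ p (cut v u c) _)
      (trans (cong (cnt p (cut v u c) +_) (cnt-sel q (piece v u c) i' i'<)) (m+[n∸m]≡n a))))
    where
    q = shift p (cut v u c)
    i' = i ∸ cnt p (cut v u c)
    i'< : i' < cnt q (piece v u c)
    i'< = +-cancelˡ-< (cnt p (cut v u c)) _ _ (subst₂ _<_ (sym (m+[n∸m]≡n a)) (cnt-piece p v u c) b)
    y = cut v u c + sel q (piece v u c) i'
    y∈ : p y ≡ true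
    y∈ = sel-∈ q (piece v u c) i' i'<
    y< : y < u
    y< = <-≤-trans (+-monoʳ-< (cut v u c) (sel-< q (piece v u c) i' i'<)) (≤-trans (≤-reflexive (cut+piece v u c)) (m⊓n≤n _ u))

-- Tries of constant depth

trieRankCost : ℕ → ℕ
trieRankCost zero = 1
trieRankCost (suc d) = 3 + (trieRankCost d + 0)

-- One read more per level than for ranks: the child of a position is computed, whereas the child of
-- an index is found by reading the whole table of counts.
trieSelCost : ℕ → ℕ
trieSelCost zero = 1
trieSelCost (suc d) = 4 + (trieSelCost d + 0)

-- `table≤W` and `leaf≤W` make a table of counts and a leaf readable at once. `fits` bounds
-- everything stored in a table, since a trie has at most `β ^ Δ` positions.
module Trie (W β θ κ Δ : ℕ) (1≤β : 1 ≤ β) (1≤θ : 1 ≤ θ) (table≤W : suc β * κ ≤ W)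
  (leaf≤W : ∀ u s → u ≤ β ^ Δ → s ≤ θ → ⌈log₂ bin u s ⌉ ≤ W)
  (fits : β ^ Δ + (θ + β ^ Δ * (Δ * (suc β * κ + β * κ + β))) < 2 ^ κ) where

  κ' : ℕ
  κ' = suc β * κ + β * κ + β

  κ≤W : κ ≤ W
  κ≤W = ≤-trans (m≤m+n κ (β * κ)) table≤W

  trie : ℕ → ℕ → (ℕ → Bool) → List Bool
  trie zero u p = leaf u p
  trie (suc d) u p = if θ <ᵇ cnt p u then Node.node (β ^ d) u β κ (trie d) p else leaf u p

  rankT : ∀ d → ℕ → ℕ → ℕ → ℕ → Prog W ℕ (trieRankCost d)
  rankT zero u s o x = leafQ u s o (λ q → cnt q x)
  rankT (suc d) u s o x =
    if θ <ᵇ s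
    then (let c = blk (cut (β ^ d) u) β x in
      Node.nodeAt (β ^ d) u β κ (trie d) o c (λ t₀ s' o' →
        rankT d (piece (β ^ d) u c) s' o' (x ∸ cut (β ^ d) u c) >>= λ r → ret (t₀ + r)))
    else leafQ u s o (λ q → cnt q x)

  countsIn : List Bool → ℕ → ℕ
  countsIn b c = val (slice (look b) (c * κ) κ)

  selT : ∀ d → ℕ → ℕ → ℕ → ℕ → Prog W ℕ (trieSelCost d)
  selT zero u s o i = leafQ u s o (λ q → sel q u i)
  selT (suc d) u s o i =
    if θ <ᵇ s
    then rd o (suc β * κ) (λ b → let c = blk (countsIn b) β i in
      Node.nodeAt (β ^ d) u β κ (trie d) o c (λ t₀ s' o' →
        selT d (piece (β ^ d) u c) s' o' (i ∸ t₀) >>= λ r → ret (cut (β ^ d) u c + r)))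
    else leafQ u s o (λ q → sel q u i)

  ovT : ℕ → ℕ → (ℕ → Bool) → ℕ
  ovT zero u p = 1
  ovT (suc d) u p = if θ <ᵇ cnt p u
    then suc β * κ + β * κ + sumF (λ c → ovT d (piece (β ^ d) u c) (shift p (cut (β ^ d) u c))) β
    else 1

  trie-size : ∀ d u p → u ≤ β ^ d → 2 ^ length (trie d u p) ≤ bin u (cnt p u) * 2 ^ ovT d u p
  trie-size zero u p _ = leaf-size u p
  trie-size (suc d) u p ul with θ <? cnt p u
  ... | no q rewrite <ᵇ-false (≮⇒≥ q) = leaf-size u p
  ... | yes q rewrite <ᵇ-true q = begin
    2 ^ length (node p)                      ≡⟨ cong (2 ^_) (trans (length-node p) (sym (+-assoc (suc β * κ) (β * κ) _))) ⟩
    2 ^ (K + childrenLen p β)                ≡⟨ ^-distribˡ-+-* 2 K _ ⟩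
    2 ^ K * 2 ^ childrenLen p β              ≤⟨ *-monoʳ-≤ (2 ^ K) (children-size p _ β (λ c → trie-size d _ _ (piece≤v (β ^ d) u c))) ⟩
    2 ^ K * (bin (cut (β ^ d) u β) (cnt p (cut (β ^ d) u β)) * 2 ^ O)   ≡⟨ cong (λ z → 2 ^ K * (bin z (cnt p z) * 2 ^ O)) (cut-end (β ^ d) u β ul) ⟩
    2 ^ K * (bin u (cnt p u) * 2 ^ O)        ≡⟨ e (2 ^ K) (bin u (cnt p u)) (2 ^ O) ⟩
    bin u (cnt p u) * (2 ^ K * 2 ^ O)        ≡⟨ cong (bin u (cnt p u) *_) (sym (^-distribˡ-+-* 2 K O)) ⟩
    bin u (cnt p u) * 2 ^ (K + O)            ∎
    where
    open ≤-Reasoning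
    open Node (β ^ d) u β κ (trie d)
    K = suc β * κ + β * κ
    O = sumF (λ c → ovT d (piece (β ^ d) u c) (shift p (cut (β ^ d) u c))) β
    e : ∀ a b c → a * (b * c) ≡ b * (a * c)
    e = solve-∀

  -- An inner node has more than θ elements, among which its κ' bits are shared.
  ovT≤ : ∀ d u p → u ≤ β ^ d → θ * ovT d u p ≤ θ + cnt p u * (d * κ')
  ovT≤ zero u p _ = ≤-trans (≤-reflexive (*-identityʳ θ)) (m≤m+n θ _)
  ovT≤ (suc d) u p ul with θ <? cnt p u
  ... | no q rewrite <ᵇ-false (≮⇒≥ q) = ≤-trans (≤-reflexive (*-identityʳ θ)) (m≤m+n θ _)
  ... | yes q rewrite <ᵇ-true q = begin
    θ * (suc β * κ + β * κ + sumF ov β)                     ≡⟨ *-distribˡ-+ θ (suc β * κ + β * κ) _ ⟩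
    θ * (suc β * κ + β * κ) + θ * sumF ov β                 ≤⟨ +-monoʳ-≤ (θ * (suc β * κ + β * κ)) (sums β) ⟩
    θ * (suc β * κ + β * κ) + (β * θ + sumF sc β * (d * κ')) ≡⟨ cong (λ z → θ * (suc β * κ + β * κ) + (β * θ + z * (d * κ'))) (trans (sumF-cnt-pieces p β) (cong (cnt p) (cut-end (β ^ d) u β ul))) ⟩
    θ * (suc β * κ + β * κ) + (β * θ + cnt p u * (d * κ'))  ≡⟨ e θ (suc β * κ + β * κ) β (cnt p u * (d * κ')) ⟩
    θ * κ' + cnt p u * (d * κ')                             ≤⟨ +-monoˡ-≤ _ (*-monoˡ-≤ κ' (<⇒≤ q)) ⟩
    cnt p u * κ' + cnt p u * (d * κ')                       ≡⟨ sym (*-distribˡ-+ (cnt p u) κ' (d * κ')) ⟩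
    cnt p u * (suc d * κ')                                  ≤⟨ m≤n+m _ θ ⟩
    θ + cnt p u * (suc d * κ')                              ∎
    where
    open ≤-Reasoning
    open Node (β ^ d) u β κ (trie d)
    sc : ℕ → ℕ
    sc c = cnt (shift p (cut (β ^ d) u c)) (piece (β ^ d) u c)
    ov : ℕ → ℕ
    ov c = ovT d (piece (β ^ d) u c) (shift p (cut (β ^ d) u c))
    e : ∀ t k b x → t * k + (b * t + x) ≡ t * (k + b) + x
    e = solve-∀
    e₂ : ∀ b t x y w → (b * t + x * w) + (t + y * w) ≡ (1 + b) * t + (x + y) * w
    e₂ = solve-∀
    sums : ∀ j → θ * sumF ov j ≤ j * θ + sumF sc j * (d * κ')
    sums zero = ≤-trans (≤-reflexive (*-zeroʳ θ)) z≤n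
    sums (suc j) = begin
      θ * (sumF ov j + ov j)                                   ≡⟨ *-distribˡ-+ θ (sumF ov j) (ov j) ⟩
      θ * sumF ov j + θ * ov j                                 ≤⟨ +-mono-≤ (sums j) (ovT≤ d _ _ (piece≤v (β ^ d) u j)) ⟩
      (j * θ + sumF sc j * (d * κ')) + (θ + sc j * (d * κ'))   ≡⟨ e₂ j θ (sumF sc j) (sc j) (d * κ') ⟩
      suc j * θ + sumF sc (suc j) * (d * κ')                   ∎

  -- A crude estimate, needed only to see that child offsets fit in `κ` bits.
  length-trie≤ : ∀ d u p → u ≤ β ^ d → length (trie d u p) ≤ u + ovT d u p
  length-trie≤ d u p ul = 2^-cancel-≤ (begin
    2 ^ length (trie d u p)          ≤⟨ trie-size d u p ul ⟩
    bin u (cnt p u) * 2 ^ ovT d u p  ≤⟨ *-monoˡ-≤ _ (bin≤2^n u (cnt p u)) ⟩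
    2 ^ u * 2 ^ ovT d u p            ≡⟨ sym (^-distribˡ-+-* 2 u _) ⟩
    2 ^ (u + ovT d u p)              ∎)
    where open ≤-Reasoning

  childrenLen-fits : ∀ d u p → suc d ≤ Δ → u ≤ β ^ suc d → θ < cnt p u → Node.childrenLen (β ^ d) u β κ (trie d) p β < 2 ^ κ
  childrenLen-fits d u p dl ul q = ≤-<-trans (begin
    childrenLen p β                               ≤⟨ ≤-trans (m≤n+m _ (β * κ)) (m≤n+m _ (suc β * κ)) ⟩
    suc β * κ + (β * κ + childrenLen p β)         ≡⟨ sym (length-node p) ⟩
    length (node p)                               ≡⟨ cong (λ b → length (if b then node p else leaf u p)) (sym (<ᵇ-true q)) ⟩
    length (trie (suc d) u p)                     ≤⟨ length-trie≤ (suc d) u p ul ⟩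
    u + ovT (suc d) u p                           ≤⟨ +-mono-≤ u≤V (≤-trans (m≤n*m (ovT (suc d) u p) θ {{>-nonZero 1≤θ}}) (ovT≤ (suc d) u p ul)) ⟩
    β ^ Δ + (θ + cnt p u * (suc d * κ'))          ≤⟨ +-monoʳ-≤ (β ^ Δ) (+-monoʳ-≤ θ (*-mono-≤ (≤-trans (cnt-≤ p u) u≤V) (*-monoˡ-≤ κ' dl))) ⟩
    β ^ Δ + (θ + β ^ Δ * (Δ * κ'))                ∎) fits
    where
    open ≤-Reasoning
    open Node (β ^ d) u β κ (trie d)
    u≤V : u ≤ β ^ Δ
    u≤V = ≤-trans ul (^-monoʳ-≤ β {{>-nonZero 1≤β}} dl)

  u<2^κ : ∀ {u} → u ≤ β ^ Δ → u < 2 ^ κ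
  u<2^κ l = ≤-<-trans (≤-trans l (m≤m+n (β ^ Δ) _)) fits

  β^d≤β^Δ : ∀ {d} → d ≤ Δ → β ^ d ≤ β ^ Δ
  β^d≤β^Δ l = ^-monoʳ-≤ β {{>-nonZero 1≤β}} l

  exec-rankT : ∀ {mem} d u p o x → d ≤ Δ → u ≤ β ^ d → x < u → At mem o (trie d u p) → exec mem (rankT d u (cnt p u) o x) ≡ cnt p x
  exec-rankT zero u p o x dl ul xl at = exec-leafQ {t = 0} u p o (λ q → cnt q x) (leaf≤W u _ (≤-trans ul (β^d≤β^Δ dl)) (≤-trans (cnt-≤ p u) (≤-trans ul 1≤θ))) at
    (λ q h → cnt-cong q p x (λ y l → h y (<-trans l xl)))
  exec-rankT {mem} (suc d) u p o x dl ul xl at with θ <? cnt p u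
  ... | no q rewrite <ᵇ-false (≮⇒≥ q) = exec-leafQ {t = 0} u p o (λ q → cnt q x) (leaf≤W u _ (≤-trans ul (β^d≤β^Δ dl)) (≮⇒≥ q)) at
    (λ q h → cnt-cong q p x (λ y l → h y (<-trans l xl)))
  ... | yes q rewrite <ᵇ-true q = exec-nodeAt p c (λ t₀ s' o' → rankT d (piece (β ^ d) u c) s' o' (x ∸ cut (β ^ d) u c) >>= λ r → ret (t₀ + r)) (≤-<-trans (cnt-≤ p u) (u<2^κ (≤-trans ul (β^d≤β^Δ dl)))) (childrenLen-fits d u p dl ul q) κ≤W at (proj₁ spec)
    (λ o' at' → exec-bind mem (rankT d _ _ o' _) (λ r → ret (cnt p (cut (β ^ d) u c) + r))
      (exec-rankT d (piece (β ^ d) u c) _ o' _ (<⇒≤ dl) (piece≤v (β ^ d) u c) inside at')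
      (sym (rank-piece p c x (proj₁ (proj₂ spec)))))
    where
    open Node (β ^ d) u β κ (trie d)
    c = blk (cut (β ^ d) u) β x
    spec = blk-spec (cut (β ^ d) u) β x z≤n (subst (x <_) (sym (cut-end (β ^ d) u β ul)) xl)
    inside : x ∸ cut (β ^ d) u c < piece (β ^ d) u c
    inside = ∸-monoˡ-< (proj₂ (proj₂ spec)) (proj₁ (proj₂ spec))

  countsIn-correct : ∀ {mem o} f c → At mem o (arr κ f (suc β)) → (∀ c → f c < 2 ^ κ) → c < β →
    countsIn (slice mem o (suc β * κ ⊓ W)) c ≡ f c
  countsIn-correct {mem} {o} f c at f< l = trans (cong (λ b → countsIn b c) whole)
    (trans (cong (λ n → val (slice (look (arr κ f (suc β))) (c * κ) n)) (sym (m≤n⇒m⊓n≡m {κ} {κ} ≤-refl)))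
      (slice-bits (c * κ) κ (f c) (At-arr κ f (suc β) c (At-look (arr κ f (suc β))) (m≤n⇒m≤1+n l)) (f< c) ≤-refl))
    where
    whole : slice mem o (suc β * κ ⊓ W) ≡ arr κ f (suc β)
    whole = trans (cong (slice mem o) (trans (m≤n⇒m⊓n≡m table≤W) (sym (length-arr κ f (suc β))))) (At-slice o _ at)

  exec-selT : ∀ {mem} d u p o i → d ≤ Δ → u ≤ β ^ d → i < cnt p u → At mem o (trie d u p) → exec mem (selT d u (cnt p u) o i) ≡ sel p u i
  exec-selT zero u p o i dl ul il at = exec-leafQ {t = 0} u p o (λ q → sel q u i) (leaf≤W u _ (≤-trans ul (β^d≤β^Δ dl)) (≤-trans (cnt-≤ p u) (≤-trans ul 1≤θ))) at
    (λ q h → sel-cong q p u i h)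
  exec-selT {mem} (suc d) u p o i dl ul il at with θ <? cnt p u
  ... | no q rewrite <ᵇ-false (≮⇒≥ q) = exec-leafQ {t = 0} u p o (λ q → sel q u i) (leaf≤W u _ (≤-trans ul (β^d≤β^Δ dl)) (≮⇒≥ q)) at
    (λ q h → sel-cong q p u i h)
  ... | yes q rewrite <ᵇ-true q = trans (cong (λ c → exec mem (prog c)) found) (exec-nodeAt p c (cont c) s< (childrenLen-fits d u p dl ul q) κ≤W at (proj₁ spec)
    (λ o' at' → exec-bind mem (selT d _ _ o' _) (λ r → ret (cut (β ^ d) u c + r))
      (exec-selT d (piece (β ^ d) u c) _ o' _ (<⇒≤ dl) (piece≤v (β ^ d) u c) inside at')
      (sel-piece p c i (proj₁ (proj₂ spec)) (proj₂ (proj₂ spec)))))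
    where
    open Node (β ^ d) u β κ (trie d)
    f : ℕ → ℕ
    f c = cnt p (cut (β ^ d) u c)
    c = blk f β i
    cont : ℕ → ℕ → ℕ → ℕ → Prog W ℕ (trieSelCost d + 0)
    cont c = λ t₀ s' o' → selT d (piece (β ^ d) u c) s' o' (i ∸ t₀) >>= λ r → ret (cut (β ^ d) u c + r)
    prog : ℕ → Prog W ℕ (3 + (trieSelCost d + 0))
    prog c = nodeAt o c (cont c)
    s< : cnt p u < 2 ^ κ
    s< = ≤-<-trans (cnt-≤ p u) (u<2^κ (≤-trans ul (β^d≤β^Δ dl)))
    found : blk (countsIn (slice mem o (suc β * κ ⊓ W))) β i ≡ c
    found = blk-cong _ f β i (λ j l → countsIn-correct f j (At-counts p at) (λ c → ≤-<-trans (cnt-cut≤ p (β ^ d) u c) s<) l)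
    spec = blk-spec f β i z≤n (subst (λ z → i < cnt p z) (sym (cut-end (β ^ d) u β ul)) il)
    inside : i ∸ f c < cnt (shift p (cut (β ^ d) u c)) (piece (β ^ d) u c)
    inside = +-cancelˡ-< (f c) _ _ (subst₂ _<_ (sym (m+[n∸m]≡n (proj₁ (proj₂ spec)))) (cnt-piece p (β ^ d) u c) (proj₂ (proj₂ spec)))

-- Runs of elements in a common cell

-- Cells are intervals of `v` positions. The `starts` are the indices, counted among the elements of
-- `p`, of the first element of each nonempty cell; together with `occupied` they translate between
-- indices and cells by rank and selection alone.
module Runs (v u k : ℕ) (u≤kv : u ≤ k * v) (p : ℕ → Bool) where

  before : ℕ → ℕ
  before c = cnt p (cut v u c)

  occupied : ℕ → Bool
  occupied c = before c <ᵇ before (suc c)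

  cellOf : ℕ → ℕ
  cellOf i = blk before k i

  starts : ℕ → Bool
  starts i = before (cellOf i) ≡ᵇ i

  before-step : ∀ c → before c ≤ before (suc c)
  before-step c = cnt-mono p (cut-mono v u c)

  before-mono : ∀ {c d} → c ≤ d → before c ≤ before d
  before-mono {c} {d} l = cnt-mono p (⊓-monoˡ-≤ u (*-monoˡ-≤ v l))

  before-end : before k ≡ cnt p u
  before-end = cong (cnt p) (cut-end v u k u≤kv)

  cell-unique : ∀ {i c d} → before c ≤ i → i < before (suc c) → before d ≤ i → i < before (suc d) → c ≡ d
  cell-unique {i} {c} {d} a b a' b' with <-cmp c d
  ... | tri< l _ _ = contradiction (<-≤-trans b (≤-trans (before-mono l) a')) (<-irrefl refl)
  ... | tri≈ _ e _ = e
  ... | tri> _ _ l = contradiction (<-≤-trans b' (≤-trans (before-mono l) a)) (<-irrefl refl)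

  cellOf-spec : ∀ i → i < cnt p u → cellOf i < k × before (cellOf i) ≤ i × i < before (suc (cellOf i))
  cellOf-spec i l = blk-spec before k i z≤n (subst (i <_) (sym before-end) l)

  before≤n : ∀ c → before c ≤ cnt p u
  before≤n c = cnt-cut≤ p v u c

  cellOf-≡ : ∀ i c → before c ≤ i → i < before (suc c) → cellOf i ≡ c
  cellOf-≡ i c a b = let (_ , x , y) = cellOf-spec i (<-≤-trans b (before≤n (suc c))) in cell-unique x y a b

  starts-within : ∀ c w → before c + w < before (suc c) → cnt starts (before c) ≡ cnt occupied c →
    cnt starts (suc (before c + w)) ≡ suc (cnt occupied c)
  starts-within c zero l e rewrite +-identityʳ (before c) | cellOf-≡ (before c) c ≤-refl l | ≡ᵇ-true {before c} refl = cong suc e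
  starts-within c (suc w) l e rewrite cellOf-≡ (before c + suc w) c (m≤m+n _ _) l | ≡ᵇ-false (<⇒≢ (m<m+n (before c) {suc w} (s≤s z≤n))) | +-suc (before c) w =
    starts-within c w (<-trans (n<1+n _) l) e

  -- Every occupied cell contributes exactly one start and an empty cell none. Both translations
  -- below rest on this bijection.
  cnt-starts-before : ∀ c → cnt starts (before c) ≡ cnt occupied c
  cnt-starts-before zero = refl
  cnt-starts-before (suc c) with before c <? before (suc c)
  ... | no q rewrite <ᵇ-false (≮⇒≥ q) = trans (cong (cnt starts) (≤-antisym (≮⇒≥ q) (before-step c))) (cnt-starts-before c)
  ... | yes q rewrite <ᵇ-true q = trans (cong (cnt starts) (sym e)) (starts-within c w (≤-reflexive e) (cnt-starts-before c))
    where
    w = before (suc c) ∸ suc (before c)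
    e : suc (before c + w) ≡ before (suc c)
    e = m+[n∸m]≡n q

  cnt-starts-suc : ∀ i → i < cnt p u → cnt starts (suc i) ≡ suc (cnt occupied (cellOf i))
  cnt-starts-suc i l = let (_ , x , y) = cellOf-spec i l in
    trans (cong (λ z → cnt starts (suc z)) (sym (m+[n∸m]≡n x)))
      (starts-within (cellOf i) (i ∸ before (cellOf i)) (subst (_< before (suc (cellOf i))) (sym (m+[n∸m]≡n x)) y) (cnt-starts-before (cellOf i)))

  cellOf-occupied : ∀ i → i < cnt p u → occupied (cellOf i) ≡ true
  cellOf-occupied i l = let (_ , x , y) = cellOf-spec i l in <ᵇ-true (≤-<-trans x y)

  -- The rank at `suc i` already includes the start of the run containing `i`, hence the subtraction
  -- of 1.
  sel-occupied : ∀ i → i < cnt p u → sel occupied k (cnt starts (suc i) ∸ 1) ≡ cellOf i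
  sel-occupied i l = trans (cong (λ z → sel occupied k (z ∸ 1)) (cnt-starts-suc i l))
    (sel-cnt occupied k (cellOf i) (cellOf-occupied i l) (proj₁ (cellOf-spec i l)))

  cnt-starts : cnt starts (cnt p u) ≡ cnt occupied k
  cnt-starts = trans (cong (cnt starts) (sym before-end)) (cnt-starts-before k)

  sel-starts : ∀ c → occupied c ≡ true → sel starts (cnt p u) (cnt occupied c) ≡ before c
  sel-starts c e = trans (cong (sel starts (cnt p u)) (sym (cnt-starts-before c)))
    (sel-cnt starts (cnt p u) (before c) (≡ᵇ-true (cong before (cellOf-≡ (before c) c ≤-refl l))) (<-≤-trans l (before≤n (suc c))))
    where l = <ᵇ-true⁻¹ e

-- Dictionaries

x≤j+y/θ : ∀ θ x j y .{{_ : NonZero θ}} → θ * x ≤ j * θ + y → x ≤ j + y / θ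
x≤j+y/θ θ x j y h = ≤-trans (m≤n+m∸n x j) (+-monoʳ-≤ j (begin
  x ∸ j                ≡⟨ sym (m*n/n≡m (x ∸ j) θ) ⟩
  (x ∸ j) * θ / θ      ≤⟨ /-monoˡ-≤ θ (begin
    (x ∸ j) * θ        ≡⟨ *-distribʳ-∸ θ x j ⟩
    x * θ ∸ j * θ      ≤⟨ m≤n+o⇒m∸n≤o (x * θ) (j * θ) (subst (_≤ j * θ + y) (*-comm θ x) h) ⟩
    y                  ∎) ⟩
  y / θ                ∎))
  where open ≤-Reasoning

module Dict (W β θ κ Δ : ℕ) (1≤β : 1 ≤ β) (1≤θ : 1 ≤ θ) (table≤W : suc β * κ ≤ W)
  (leaf≤W : ∀ u s → u ≤ β ^ Δ → s ≤ θ → ⌈log₂ bin u s ⌉ ≤ W)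
  (fits : β ^ Δ + (θ + β ^ Δ * (Δ * (suc β * κ + β * κ + β))) < 2 ^ κ)
  (λt : ℕ) (λt≤W : λt ≤ W) where

  open Trie W β θ κ Δ 1≤β 1≤θ table≤W leaf≤W fits

  instance
    θ-nonZero : NonZero θ
    θ-nonZero = >-nonZero 1≤θ

  V : ℕ
  V = β ^ Δ

  instance
    V-nonZero : NonZero V
    V-nonZero = >-nonZero (≤-trans (≤-reflexive (sym (^-zeroˡ Δ))) (^-monoˡ-≤ Δ 1≤β))

  blocks : ℕ → ℕ
  blocks U = suc (U / V)

  U≤blocks*V : ∀ U → U ≤ blocks U * V
  U≤blocks*V U = subst (_≤ V + U / V * V) (sym (m≡m%n+[m/n]*n U V)) (+-monoˡ-≤ (U / V * V) (<⇒≤ (m%n<n U V)))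

  -- The share of all inner trie nodes: on each of `Δ` levels, `κ'` bits per more than `θ` elements.
  spread : ℕ → ℕ
  spread s = s * (Δ * κ') / θ

  spread-mono : ∀ {s t} → s ≤ t → spread s ≤ spread t
  spread-mono l = /-monoˡ-≤ θ (*-monoˡ-≤ (Δ * κ') l)

  topOv : ℕ → ℕ → ℕ
  topOv k s = (suc k * λt + k * λt) + (k + spread s)

  rkOv : ℕ → ℕ → ℕ
  rkOv U s = if V <ᵇ U then topOv (blocks U) s else 1 + spread s

  rkLen : ℕ → ℕ → ℕ
  rkLen U s = ⌈log₂ bin U s ⌉ + rkOv U s

  -- The three summands bound the enumerative codes, one bit for each block, and the tables inside
  -- the tries. Hence every count and offset over `U` positions has `λt` bits.
  Fits : ℕ → Set
  Fits U = U + (suc U + U * (Δ * κ')) < 2 ^ λt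

  top : ℕ → (ℕ → Bool) → List Bool
  top U = Node.node V U (blocks U) λt (trie Δ)

  rkRaw : ℕ → (ℕ → Bool) → List Bool
  rkRaw U p = if V <ᵇ U then top U p else trie Δ U p

  -- Padding makes the length a function of `U` and the cardinality, so that a query computes the
  -- offset of whatever follows without a read.
  rk : ℕ → (ℕ → Bool) → List Bool
  rk U p = padTo (rkLen U (cnt p U)) (rkRaw U p)

  sumOv : ℕ → (ℕ → Bool) → ℕ → ℕ
  sumOv U p = sumF (λ c → ovT Δ (piece V U c) (shift p (cut V U c)))

  sumOv≤ : ∀ U p → sumOv U p (blocks U) ≤ blocks U + spread (cnt p U)
  sumOv≤ U p = x≤j+y/θ θ _ (blocks U) _ (subst (λ z → θ * sumOv U p (blocks U) ≤ blocks U * θ + z * (Δ * κ'))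
      (trans (sumF-cnt-pieces p (blocks U)) (cong (cnt p) (cut-end V U (blocks U) (U≤blocks*V U)))) (go (blocks U)))
    where
    open Node V U (blocks U) λt (trie Δ)
    sc : ℕ → ℕ
    sc c = cnt (shift p (cut V U c)) (piece V U c)
    e₂ : ∀ b t x y w → (b * t + x * w) + (t + y * w) ≡ (1 + b) * t + (x + y) * w
    e₂ = solve-∀
    go : ∀ j → θ * sumOv U p j ≤ j * θ + sumF sc j * (Δ * κ')
    go zero = ≤-trans (≤-reflexive (*-zeroʳ θ)) z≤n
    go (suc j) = ≤-trans (≤-reflexive (*-distribˡ-+ θ (sumOv U p j) _)) (≤-trans (+-mono-≤ (go j) (ovT≤ Δ _ _ (piece≤v V U j)))
      (≤-reflexive (e₂ j θ (sumF sc j) (sc j) (Δ * κ'))))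

  children≤ : ∀ U p → 2 ^ Node.childrenLen V U (blocks U) λt (trie Δ) p (blocks U) ≤ bin U (cnt p U) * 2 ^ (blocks U + spread (cnt p U))
  children≤ U p = begin
    2 ^ childrenLen p k                                              ≤⟨ children-size p _ k (λ c → trie-size Δ _ _ (piece≤v V U c)) ⟩
    bin (cut V U k) (cnt p (cut V U k)) * 2 ^ sumOv U p k            ≡⟨ cong (λ z → bin z (cnt p z) * 2 ^ sumOv U p k) (cut-end V U k (U≤blocks*V U)) ⟩
    bin U (cnt p U) * 2 ^ sumOv U p k                                ≤⟨ *-monoʳ-≤ (bin U (cnt p U)) (^-monoʳ-≤ 2 (sumOv≤ U p)) ⟩
    bin U (cnt p U) * 2 ^ (k + spread (cnt p U))                     ∎
    where
    open ≤-Reasoning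
    k = blocks U
    open Node V U (blocks U) λt (trie Δ)

  ≤⌈log₂⌉+ : ∀ {len} b ov → 2 ^ len ≤ b * 2 ^ ov → len ≤ ⌈log₂ b ⌉ + ov
  ≤⌈log₂⌉+ {len} b ov h = 2^-cancel-≤ (≤-trans h (≤-trans (*-monoˡ-≤ (2 ^ ov) (n≤2^⌈log₂n⌉ b)) (≤-reflexive (sym (^-distribˡ-+-* 2 ⌈log₂ b ⌉ ov)))))

  rkRaw-length : ∀ U p → length (rkRaw U p) ≤ rkLen U (cnt p U)
  rkRaw-length U p with V <? U
  ... | yes q rewrite <ᵇ-true q = begin
    length (node p)                                        ≡⟨ length-node p ⟩
    suc k * λt + (k * λt + childrenLen p k)                ≤⟨ +-monoʳ-≤ (suc k * λt) (+-monoʳ-≤ (k * λt) (≤⌈log₂⌉+ (bin U (cnt p U)) (k + spread (cnt p U)) (children≤ U p))) ⟩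
    suc k * λt + (k * λt + (⌈log₂ bin U (cnt p U) ⌉ + (k + spread (cnt p U)))) ≡⟨ e (suc k * λt) (k * λt) ⌈log₂ bin U (cnt p U) ⌉ (k + spread (cnt p U)) ⟩
    ⌈log₂ bin U (cnt p U) ⌉ + topOv k (cnt p U)            ∎
    where
    open ≤-Reasoning
    k = blocks U
    open Node V U (blocks U) λt (trie Δ)
    e : ∀ a b c d → a + (b + (c + d)) ≡ c + ((a + b) + d)
    e = solve-∀
  ... | no q rewrite <ᵇ-false (≮⇒≥ q) = ≤-trans (≤⌈log₂⌉+ (bin U (cnt p U)) (ovT Δ U p) (trie-size Δ U p (≮⇒≥ q)))
    (+-monoʳ-≤ ⌈log₂ bin U (cnt p U) ⌉ (x≤j+y/θ θ (ovT Δ U p) 1 _ (subst (λ z → θ * ovT Δ U p ≤ z + cnt p U * (Δ * κ')) (sym (+-identityʳ θ)) (ovT≤ Δ U p (≮⇒≥ q)))))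

  length-rk : ∀ U p → length (rk U p) ≡ rkLen U (cnt p U)
  length-rk U p = length-padTo _ (rkRaw U p) (rkRaw-length U p)

  rankCostR : ℕ
  rankCostR = 3 + (trieRankCost Δ + 0)

  rankR : ℕ → ℕ → ℕ → ℕ → Prog W ℕ rankCostR
  rankR U s o x = if x <ᵇ U
    then (if V <ᵇ U
      then (let c = blk (cut V U) (blocks U) x in
        Node.nodeAt V U (blocks U) λt (trie Δ) o c (λ t₀ s' o' → rankT Δ (piece V U c) s' o' (x ∸ cut V U c) >>= λ r → ret (t₀ + r)))
      else weaken (≤-trans (m≤m+n _ 0) (m≤n+m _ 3)) (rankT Δ U s o x))
    -- `x = U` is a legitimate argument: ranks are asked at `suc i` with `i` the last position.
    else ret s

  children-fit : ∀ U p → Fits U → Node.childrenLen V U (blocks U) λt (trie Δ) p (blocks U) < 2 ^ λt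
  children-fit U p h = ≤-<-trans (2^-cancel-≤ (begin
    2 ^ Node.childrenLen V U (blocks U) λt (trie Δ) p (blocks U)      ≤⟨ children≤ U p ⟩
    bin U (cnt p U) * 2 ^ (blocks U + spread (cnt p U))  ≤⟨ *-mono-≤ (bin≤2^n U (cnt p U)) (^-monoʳ-≤ 2 (+-mono-≤ (s≤s (m/n≤m U V)) (≤-trans (m/n≤m _ θ) (*-monoˡ-≤ (Δ * κ') (cnt-≤ p U))))) ⟩
    2 ^ U * 2 ^ (suc U + U * (Δ * κ'))                   ≡⟨ sym (^-distribˡ-+-* 2 U _) ⟩
    2 ^ (U + (suc U + U * (Δ * κ')))                     ∎)) h
    where
    open ≤-Reasoning

  cnt-fits : ∀ U p → Fits U → cnt p U < 2 ^ λt
  cnt-fits U p h = ≤-<-trans (≤-trans (cnt-≤ p U) (m≤m+n U _)) h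

  exec-rankR : ∀ {mem} U p o x → Fits U → x ≤ U → At mem o (rk U p) → exec mem (rankR U (cnt p U) o x) ≡ cnt p x
  exec-rankR {mem} U p o x fitsU x≤U at with x <? U
  ... | no q rewrite <ᵇ-false (≮⇒≥ q) = cong (cnt p) (≤-antisym (≮⇒≥ q) x≤U)
  ... | yes xl rewrite <ᵇ-true xl with V <? U
  ...   | no q rewrite <ᵇ-false (≮⇒≥ q) = trans (exec-weaken mem _ (rankT Δ U (cnt p U) o x)) (exec-rankT Δ U p o x ≤-refl (≮⇒≥ q) xl (At-++ˡ (trie Δ U p) at))
  ...   | yes q rewrite <ᵇ-true q = exec-nodeAt p c (λ t₀ s' o' → rankT Δ (piece V U c) s' o' (x ∸ cut V U c) >>= λ r → ret (t₀ + r))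
      (cnt-fits U p fitsU) (children-fit U p fitsU) λt≤W (At-++ˡ (node p) at) (proj₁ spec)
      (λ o' at' → exec-bind mem (rankT Δ _ _ o' _) (λ r → ret (cnt p (cut V U c) + r))
        (exec-rankT Δ (piece V U c) _ o' _ ≤-refl (piece≤v V U c) (∸-monoˡ-< (proj₂ (proj₂ spec)) (proj₁ (proj₂ spec))) at')
        (sym (rank-piece p c x (proj₁ (proj₂ spec)))))
    where
    open Node V U (blocks U) λt (trie Δ)
    c = blk (cut V U) (blocks U) x
    spec = blk-spec (cut V U) (blocks U) x z≤n (subst (x <_) (sym (cut-end V U (blocks U) (U≤blocks*V U))) xl)

  module R (U : ℕ) (p : ℕ → Bool) = Runs V U (blocks U) (U≤blocks*V U) p

  auxLen : ℕ → ℕ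
  auxLen U = blocks U * λt + topOv (blocks U) (blocks U)

  -- Selection has to find the block of an index, and the table of block counts is too long for one
  -- read. The rank of the index among the `starts` gives the number of the nonempty block, and an
  -- explicit array gives its name. On `starts` only ranks are needed, so `rk` suffices and nothing
  -- is circular.
  aux : ℕ → (ℕ → Bool) → List Bool
  aux U p = bits λt (cnt (R.starts U p) (cnt p U)) ++ arr λt (sel (R.occupied U p) (blocks U)) (blocks U) ++ rk U p ++ rk (cnt p U) (R.starts U p)

  bigLen : ℕ → ℕ → ℕ
  bigLen U s = λt + (blocks U * λt + (rkLen U s + auxLen U))

  fidLen : ℕ → ℕ → ℕ
  fidLen U s = if V <ᵇ U then bigLen U s else rkLen U s

  fid : ℕ → (ℕ → Bool) → List Bool
  fid U p = if V <ᵇ U then padTo (bigLen U (cnt p U)) (aux U p) else rk U p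

  if-big : ∀ {A : Set} {U} {x y : A} → V < U → (if V <ᵇ U then x else y) ≡ x
  if-big {x = x} {y} q = cong (λ b → if b then x else y) (<ᵇ-true q)

  if-small : ∀ {A : Set} {U} {x y : A} → ¬ V < U → (if V <ᵇ U then x else y) ≡ y
  if-small {x = x} {y} q = cong (λ b → if b then x else y) (<ᵇ-false (≮⇒≥ q))

  rankF : ℕ → ℕ → ℕ → ℕ → Prog W ℕ rankCostR
  rankF U s o x = rankR U s (if V <ᵇ U then o + λt + blocks U * λt else o) x

  selCostF : ℕ
  selCostF = 1 + (rankCostR + (1 + (3 + (trieSelCost Δ + 0))))

  selBig : ℕ → ℕ → ℕ → ℕ → Prog W ℕ selCostF
  selBig U s o i =
    rdN o λt >>= λ g →
    rankR s g (o + λt + blocks U * λt + rkLen U s) (suc i) >>= λ j →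
    rdN (o + λt + (j ∸ 1) * λt) λt >>= λ c →
    Node.nodeAt V U (blocks U) λt (trie Δ) (o + λt + blocks U * λt) c (λ t₀ s' o' → selT Δ (piece V U c) s' o' (i ∸ t₀) >>= λ r → ret (cut V U c + r))

  selF : ℕ → ℕ → ℕ → ℕ → Prog W ℕ selCostF
  selF U s o i = if V <ᵇ U then selBig U s o i
    else weaken (≤-trans (m≤m+n _ 0) (≤-trans (m≤n+m _ 4) (≤-trans (m≤n+m _ rankCostR) (n≤1+n _)))) (selT Δ U s o i)

  cnt-starts≤ : ∀ U p → cnt (R.starts U p) (cnt p U) ≤ blocks U
  cnt-starts≤ U p = ≤-trans (≤-reflexive (R.cnt-starts U p)) (cnt-≤ _ (blocks U))

  -- The number of nonempty blocks varies with the set. Bounding it by the number of blocks, at `λt`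
  -- bits per start, leaves a length that depends on `U` only.
  rkLen-starts : ∀ U p → Fits U → V < U → rkLen (cnt p U) (cnt (R.starts U p) (cnt p U)) ≤ auxLen U
  rkLen-starts U p h vu = +-mono-≤ (⌈log₂⌉-least (k * λt) (begin
      bin s g              ≤⟨ bin≤n^k s g ⟩
      s ^ g                ≤⟨ ^-monoˡ-≤ g (<⇒≤ (cnt-fits U p h)) ⟩
      (2 ^ λt) ^ g         ≡⟨ ^-*-assoc 2 λt g ⟩
      2 ^ (λt * g)         ≤⟨ ^-monoʳ-≤ 2 (≤-trans (*-monoʳ-≤ λt (cnt-starts≤ U p)) (≤-reflexive (*-comm λt k))) ⟩
      2 ^ (k * λt)         ∎)) ov
    where
    open ≤-Reasoning
    k = blocks U
    s = cnt p U
    g = cnt (R.starts U p) s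
    ov : rkOv s g ≤ topOv k k
    ov with V <? s
    ... | yes q rewrite <ᵇ-true q = +-mono-≤ (+-mono-≤ (*-monoˡ-≤ λt (s≤s kk)) (*-monoˡ-≤ λt kk)) (+-mono-≤ kk (spread-mono (cnt-starts≤ U p)))
      where
      kk : blocks s ≤ k
      kk = s≤s (/-monoˡ-≤ V (cnt-≤ p U))
    ... | no q rewrite <ᵇ-false (≮⇒≥ q) = ≤-trans (+-mono-≤ (s≤s z≤n) (spread-mono (cnt-starts≤ U p))) (m≤n+m _ (suc k * λt + k * λt))

  length-aux : ∀ U p → length (aux U p) ≡ λt + (blocks U * λt + (rkLen U (cnt p U) + rkLen (cnt p U) (cnt (R.starts U p) (cnt p U))))
  length-aux U p = trans (length-++ (bits λt (cnt (R.starts U p) (cnt p U)))) (cong₂ _+_ (length-bits λt _)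
    (trans (length-++ (arr λt (sel (R.occupied U p) (blocks U)) (blocks U))) (cong₂ _+_ (length-arr λt _ (blocks U))
      (trans (length-++ (rk U p)) (cong₂ _+_ (length-rk U p) (length-rk (cnt p U) _))))))

  length-fid : ∀ U p → Fits U → length (fid U p) ≡ fidLen U (cnt p U)
  length-fid U p h with V <? U
  ... | no q = trans (cong length (if-small q)) (trans (length-rk U p) (sym (if-small q)))
  ... | yes q = trans (cong length (if-big q)) (trans (length-padTo _ (aux U p) (≤-trans (≤-reflexive (length-aux U p))
    (+-monoʳ-≤ λt (+-monoʳ-≤ (blocks U * λt) (+-monoʳ-≤ (rkLen U (cnt p U)) (rkLen-starts U p h q)))))) (sym (if-big q)))

  At-aux-rk : ∀ {mem o} U p → At mem o (aux U p) → At mem (o + λt + blocks U * λt) (rk U p ++ rk (cnt p U) (R.starts U p))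
  At-aux-rk {mem} {o} U p at = subst₂ (λ a b → At mem (o + a + b) rest) (length-bits λt g) (length-arr λt _ (blocks U)) (At-++ʳ A₂ (At-++ʳ A₁ at))
    where
    g = cnt (R.starts U p) (cnt p U)
    rest = rk U p ++ rk (cnt p U) (R.starts U p)
    A₁ = bits λt g
    A₂ = arr λt (sel (R.occupied U p) (blocks U)) (blocks U)

  exec-rankF : ∀ {mem} U p o x → Fits U → x ≤ U → At mem o (fid U p) → exec mem (rankF U (cnt p U) o x) ≡ cnt p x
  exec-rankF {mem} U p o x fitsU x≤U at with V <? U
  ... | no q = trans (cong (λ z → exec mem (rankR U (cnt p U) z x)) (if-small q)) (exec-rankR U p o x fitsU x≤U (subst (At mem o) (if-small q) at))
  ... | yes q = trans (cong (λ z → exec mem (rankR U (cnt p U) z x)) (if-big q))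
    (exec-rankR U p _ x fitsU x≤U (At-++ˡ (rk U p) (At-aux-rk U p (At-++ˡ (aux U p) (subst (At mem o) (if-big q) at)))))

  Fits-≤ : ∀ {s U} → s ≤ U → Fits U → Fits s
  Fits-≤ l h = ≤-<-trans (+-mono-≤ l (+-mono-≤ (s≤s l) (*-monoˡ-≤ (Δ * κ') l))) h

  exec-selF : ∀ {mem} U p o i → Fits U → i < cnt p U → At mem o (fid U p) → exec mem (selF U (cnt p U) o i) ≡ sel p U i
  exec-selF {mem} U p o i fitsU il at with V <? U
  ... | no q = trans (cong (exec mem) (if-small q)) (trans (exec-weaken mem _ (selT Δ U (cnt p U) o i))
    (exec-selT Δ U p o i ≤-refl (≮⇒≥ q) il (At-++ˡ (trie Δ U p) (subst (At mem o) (trans (if-small q) (cong (padTo (rkLen U (cnt p U))) (if-small q))) at))))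
  ... | yes q = trans (cong (exec mem) (if-big q)) (
    exec-bind mem (rdN o λt) g₁ (exec-rdN o λt g (At-++ˡ (bits λt g) at₀) (≤-<-trans (cnt-≤ (R.starts U p) s) (cnt-fits U p fitsU)) λt≤W)
    (exec-bind mem (rankR s g (o + λt + blocks U * λt + rkLen U s) (suc i)) g₂ (exec-rankR s (R.starts U p) _ (suc i) (Fits-≤ (cnt-≤ p U) fitsU) il atG)
    (exec-bind mem (rdN (o + λt + (j ∸ 1) * λt) λt) g₃
      (trans (exec-rdN _ λt (sel occ k (j ∸ 1)) (At-arr λt (sel occ k) k (j ∸ 1) atN j<k) c<2^λt λt≤W) (R.sel-occupied U p i il))
      (exec-nodeAt p c (g₄ c) (cnt-fits U p fitsU) (children-fit U p fitsU) λt≤W (At-++ˡ (node p) (subst (At mem _) rk≡ (At-++ˡ (rk U p) atR))) (proj₁ spec)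
        (λ o' at' → exec-bind mem (selT Δ _ _ o' _) (λ r → ret (cut V U c + r))
          (exec-selT Δ (piece V U c) _ o' _ ≤-refl (piece≤v V U c) inside at')
          (sel-piece p c i (proj₁ (proj₂ spec)) (proj₂ (proj₂ spec))))))))
    where
    s = cnt p U
    k = blocks U
    g = cnt (R.starts U p) s
    occ = R.occupied U p
    c = R.cellOf U p i
    j = cnt (R.starts U p) (suc i)
    open Node V U (blocks U) λt (trie Δ)
    at₀ : At mem o (aux U p)
    at₀ = At-++ˡ (aux U p) (subst (At mem o) (if-big q) at)
    atN : At mem (o + λt) (arr λt (sel occ k) k)
    atN = At-++ˡ (arr λt (sel occ k) k) (subst (λ z → At mem (o + z) (arr λt (sel occ k) k ++ rk U p ++ rk s (R.starts U p))) (length-bits λt g) (At-++ʳ (bits λt g) at₀))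
    atR : At mem (o + λt + k * λt) (rk U p ++ rk s (R.starts U p))
    atR = At-aux-rk U p at₀
    rk≡ : rk U p ≡ padTo (rkLen U s) (node p)
    rk≡ = cong (padTo (rkLen U s)) (if-big q)
    atG : At mem (o + λt + k * λt + rkLen U s) (rk s (R.starts U p))
    atG = subst (λ z → At mem (o + λt + k * λt + z) (rk s (R.starts U p))) (length-rk U p) (At-++ʳ (rk U p) atR)
    spec = R.cellOf-spec U p i il
    j≡ : j ∸ 1 ≡ cnt occ c
    j≡ = cong (_∸ 1) (R.cnt-starts-suc U p i il)
    j<k : j ∸ 1 < k
    j<k = ≤-<-trans (≤-trans (≤-reflexive j≡) (cnt-≤ occ c)) (proj₁ spec)
    k<2^λt : k < 2 ^ λt
    k<2^λt = ≤-<-trans (≤-trans (s≤s (m/n≤m U V)) (≤-trans (m≤m+n (suc U) _) (m≤n+m _ U))) fitsU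
    c<2^λt : sel occ k (j ∸ 1) < 2 ^ λt
    c<2^λt = subst (_< 2 ^ λt) (sym (R.sel-occupied U p i il)) (<-trans (proj₁ spec) k<2^λt)
    inside : i ∸ cnt p (cut V U c) < cnt (shift p (cut V U c)) (piece V U c)
    inside = +-cancelˡ-< (cnt p (cut V U c)) _ _ (subst₂ _<_ (sym (m+[n∸m]≡n (proj₁ (proj₂ spec)))) (cnt-piece p V U c) (proj₂ (proj₂ spec)))
    g₄ : ℕ → ℕ → ℕ → ℕ → Prog W ℕ (trieSelCost Δ + 0)
    g₄ c t₀ s' o' = selT Δ (piece V U c) s' o' (i ∸ t₀) >>= λ r → ret (cut V U c + r)
    g₃ : ℕ → Prog W ℕ (3 + (trieSelCost Δ + 0))
    g₃ c = nodeAt (o + λt + k * λt) c (g₄ c)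
    g₂ : ℕ → Prog W ℕ (1 + (3 + (trieSelCost Δ + 0)))
    g₂ j = rdN (o + λt + (j ∸ 1) * λt) λt >>= g₃
    g₁ : ℕ → Prog W ℕ (rankCostR + (1 + (3 + (trieSelCost Δ + 0))))
    g₁ g = rankR s g (o + λt + k * λt + rkLen U s) (suc i) >>= g₂

-- Hash families

sumF-+ : ∀ f g k → sumF (λ i → f i + g i) k ≡ sumF f k + sumF g k
sumF-+ f g zero = refl
sumF-+ f g (suc k) = trans (cong (_+ (f k + g k)) (sumF-+ f g k)) (e (sumF f k) (sumF g k) (f k) (g k))
  where
  e : ∀ a b c d → (a + b) + (c + d) ≡ (a + c) + (b + d)
  e = solve-∀

sumF-*ʳ : ∀ f a k → sumF (λ i → f i * a) k ≡ sumF f k * a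
sumF-*ʳ f a zero = refl
sumF-*ʳ f a (suc k) = trans (cong (_+ f k * a) (sumF-*ʳ f a k)) (sym (*-distribʳ-+ a (sumF f k) (f k)))

term≤sumF : ∀ f {b k} → b < k → f b ≤ sumF f k
term≤sumF f {b} {suc k} (s≤s l) with m≤n⇒m<n∨m≡n l
... | inj₁ q = ≤-trans (term≤sumF f q) (m≤m+n _ (f k))
... | inj₂ refl = m≤n+m _ (sumF f k)

below-average : ∀ f k → ∃ λ c → c < suc k × suc k * f c ≤ sumF f (suc k)
below-average f zero = 0 , ≤-refl , ≤-reflexive (+-identityʳ (f 0))
below-average f (suc k) with below-average f k
... | c , c< , h with f (suc k) ≤? f c
...   | yes q = suc k , ≤-refl , ≤-trans (≤-reflexive (+-comm (f (suc k)) _)) (+-monoˡ-≤ (f (suc k)) (≤-trans (*-monoʳ-≤ (suc k) q) h))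
...   | no q = c , m≤n⇒m≤1+n c< , ≤-trans (≤-reflexive (+-comm (f c) _)) (+-mono-≤ h (<⇒≤ (≰⇒> q)))

-- A list of length M is read as a function on [0, M), the head being the value at M − 1.
get : List ℕ → ℕ → ℕ
get [] x = 0
get (c ∷ h) x = if x ≡ᵇ length h then c else get h x

-- The sum over all `q ^ M` functions from `[0, M)` to `[0, q)`, in place of the expectation over a
-- random function.
sumAll : ℕ → ℕ → (List ℕ → ℕ) → ℕ
sumAll q zero F = F []
sumAll q (suc M) F = sumF (λ c → sumAll q M (λ h → F (c ∷ h))) q

sumAll-cong : ∀ q M {F G : List ℕ → ℕ} → (∀ h → length h ≡ M → F h ≡ G h) → sumAll q M F ≡ sumAll q M G
sumAll-cong q zero e = e [] refl
sumAll-cong q (suc M) e = sumF-cong q (λ c _ → sumAll-cong q M (λ h l → e (c ∷ h) (cong suc l)))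

sumAll-+ : ∀ q M F G → sumAll q M (λ h → F h + G h) ≡ sumAll q M F + sumAll q M G
sumAll-+ q zero F G = refl
sumAll-+ q (suc M) F G = trans (sumF-cong q (λ c _ → sumAll-+ q M (λ h → F (c ∷ h)) (λ h → G (c ∷ h)))) (sumF-+ _ _ q)

sumAll-0 : ∀ q M → sumAll q M (λ _ → 0) ≡ 0
sumAll-0 q zero = refl
sumAll-0 q (suc M) = trans (sumF-cong q (λ c _ → sumAll-0 q M)) (trans (sumF-const 0 q) (*-zeroʳ q))

sumAll-sumF : ∀ q M (F : ℕ → List ℕ → ℕ) k → sumAll q M (λ h → sumF (λ b → F b h) k) ≡ sumF (λ b → sumAll q M (F b)) k
sumAll-sumF q M F zero = sumAll-0 q M
sumAll-sumF q M F (suc k) = trans (sumAll-+ q M (λ h → sumF (λ b → F b h) k) (F k)) (cong (_+ sumAll q M (F k)) (sumAll-sumF q M F k))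

sumAll-* : ∀ q M a F → sumAll q M (λ h → a * F h) ≡ a * sumAll q M F
sumAll-* q zero a F = refl
sumAll-* q (suc M) a F = begin
  sumF (λ c → sumAll q M (λ h → a * F (c ∷ h))) q   ≡⟨ sumF-cong q (λ c _ → trans (sumAll-* q M a (λ h → F (c ∷ h))) (*-comm a _)) ⟩
  sumF (λ c → sumAll q M (λ h → F (c ∷ h)) * a) q   ≡⟨ sumF-*ʳ _ a q ⟩
  sumAll q (suc M) F * a                            ≡⟨ *-comm _ a ⟩
  a * sumAll q (suc M) F                            ∎
  where open ≡-Reasoning

-- The method of conditional expectations: values are fixed one after the other, each by
-- `below-average`.
average : ∀ q M F → ∃ λ h → length h ≡ M × (∀ x → get h x < suc q) × suc q ^ M * F h ≤ sumAll (suc q) M F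
average q zero F = [] , refl , (λ _ → s≤s z≤n) , ≤-reflexive (+-identityʳ _)
average q (suc M) F with below-average (λ c → sumAll (suc q) M (λ h → F (c ∷ h))) q
... | c , c< , le with average q M (λ h → F (c ∷ h))
...   | h , len , vals , le' = c ∷ h , cong suc len , vals' , (begin
  suc q * suc q ^ M * F (c ∷ h)      ≡⟨ *-assoc (suc q) (suc q ^ M) _ ⟩
  suc q * (suc q ^ M * F (c ∷ h))    ≤⟨ *-monoʳ-≤ (suc q) le' ⟩
  suc q * sumAll (suc q) M (λ h → F (c ∷ h))   ≤⟨ le ⟩
  sumAll (suc q) (suc M) F           ∎)
  where
  open ≤-Reasoning
  vals' : ∀ x → get (c ∷ h) x < suc q
  vals' x with x ≡ᵇ length h
  ... | true = c<
  ... | false = vals x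

load : (ℕ → Bool) → ℕ → List ℕ → ℕ
load K b [] = 0
load K b (c ∷ h) = b2n (K (length h) ∧ (c ≡ᵇ b)) + load K b h

load≡cnt : ∀ K b h → load K b h ≡ cnt (λ x → K x ∧ (get h x ≡ᵇ b)) (length h)
load≡cnt K b [] = refl
load≡cnt K b (c ∷ h) rewrite ≡ᵇ-true {length h} refl = cong (b2n (K (length h) ∧ (c ≡ᵇ b)) +_)
  (trans (load≡cnt K b h) (cnt-cong _ _ (length h) (λ y l → cong (λ z → K y ∧ (z ≡ᵇ b)) (sym (eq y l)))))
  where
  eq : ∀ y → y < length h → (if y ≡ᵇ length h then c else get h y) ≡ get h y
  eq y l rewrite ≡ᵇ-false (<⇒≢ l) = refl

sumF-indicator : ∀ j b q → q ≤ b → sumF (λ c → suc j ^ b2n (c ≡ᵇ b)) q ≡ q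
sumF-indicator j b zero _ = refl
sumF-indicator j b (suc q) l rewrite ≡ᵇ-false (<⇒≢ l) | sumF-indicator j b q (<⇒≤ l) = +-comm q 1

sumF-indicator' : ∀ j b q → b < q → sumF (λ c → suc j ^ b2n (c ≡ᵇ b)) q ≡ q + j
sumF-indicator' j b (suc q) (s≤s l) with m≤n⇒m<n∨m≡n l
... | inj₁ r rewrite ≡ᵇ-false (>⇒≢ r) | sumF-indicator' j b q r = e q j
  where
  e : ∀ q j → (q + j) + 1 ≡ (1 + q) + j
  e = solve-∀
... | inj₂ refl rewrite ≡ᵇ-true {b} refl | sumF-indicator j b b ≤-refl = e b j
  where
  e : ∀ b j → b + (1 + j) * 1 ≡ (1 + b) + j
  e = solve-∀

-- The moment generating function of a load. Coordinates are independent: a key contributes `q + j`,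
-- namely weight `1 + j` at the value `b` and 1 at the others, and a non-key contributes `q`. The
-- factor `q ^ cnt K M` avoids a division.
sumAll-load : ∀ q j K b M → b < q → sumAll q M (λ h → suc j ^ load K b h) * q ^ cnt K M ≡ q ^ M * (q + j) ^ cnt K M
sumAll-load q j K b zero l = refl
sumAll-load q j K b (suc M) l = begin
  sumF (λ c → sumAll q M (λ h → suc j ^ (b2n (K (length h) ∧ (c ≡ᵇ b)) + load K b h))) q * q ^ cnt K (suc M)
    ≡⟨ cong (_* q ^ cnt K (suc M)) (sumF-cong q (λ c _ → trans (sumAll-cong q M (λ h e → trans (^-distribˡ-+-* (suc j) (b2n (K (length h) ∧ (c ≡ᵇ b))) (load K b h))
         (cong (λ z → suc j ^ b2n (K z ∧ (c ≡ᵇ b)) * suc j ^ load K b h) e))) (sumAll-* q M (suc j ^ b2n (K M ∧ (c ≡ᵇ b))) _))) ⟩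
  sumF (λ c → suc j ^ b2n (K M ∧ (c ≡ᵇ b)) * A) q * q ^ cnt K (suc M)
    ≡⟨ cong (_* q ^ cnt K (suc M)) (sumF-*ʳ (λ c → suc j ^ b2n (K M ∧ (c ≡ᵇ b))) A q) ⟩
  sumF (λ c → suc j ^ b2n (K M ∧ (c ≡ᵇ b))) q * A * q ^ cnt K (suc M)   ≡⟨ split ⟩
  q * q ^ M * (q + j) ^ cnt K (suc M)     ∎
  where
  open ≡-Reasoning
  A = sumAll q M (λ h → suc j ^ load K b h)
  ih = sumAll-load q j K b M l
  e₁ : ∀ a b c d → a * b * (d * c) ≡ d * a * (b * c)
  e₁ = solve-∀
  e₂ : ∀ a b c d → d * a * (b * c) ≡ d * b * (a * c)
  e₂ = solve-∀
  split : sumF (λ c → suc j ^ b2n (K M ∧ (c ≡ᵇ b))) q * A * q ^ cnt K (suc M) ≡ q * q ^ M * (q + j) ^ cnt K (suc M)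
  split with K M
  ... | true = begin
    sumF (λ c → suc j ^ b2n (c ≡ᵇ b)) q * A * (q * q ^ cnt K M)   ≡⟨ cong (λ z → z * A * (q * q ^ cnt K M)) (sumF-indicator' j b q l) ⟩
    (q + j) * A * (q * q ^ cnt K M)           ≡⟨ e₁ (q + j) A (q ^ cnt K M) q ⟩
    q * (q + j) * (A * q ^ cnt K M)           ≡⟨ cong (q * (q + j) *_) ih ⟩
    q * (q + j) * (q ^ M * (q + j) ^ cnt K M) ≡⟨ e₂ (q + j) (q ^ M) ((q + j) ^ cnt K M) q ⟩
    q * q ^ M * ((q + j) * (q + j) ^ cnt K M) ∎
  ... | false = begin
    sumF (λ c → 1) q * A * q ^ cnt K M        ≡⟨ cong (λ z → z * A * q ^ cnt K M) (trans (sumF-const 1 q) (*-identityʳ q)) ⟩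
    q * A * q ^ cnt K M                       ≡⟨ *-assoc q A _ ⟩
    q * (A * q ^ cnt K M)                     ≡⟨ cong (q *_) ih ⟩
    q * (q ^ M * (q + j) ^ cnt K M)           ≡⟨ sym (*-assoc q (q ^ M) _) ⟩
    q * q ^ M * (q + j) ^ cnt K M             ∎

setAt : ℕ → Bool → (ℕ → Bool) → ℕ → Bool
setAt M b K y = if y ≡ᵇ M then b else K y

smallSets : ℕ → ℕ → List (ℕ → Bool)
smallSets zero s = (λ _ → false) ∷ []
smallSets (suc M) zero = map (setAt M false) (smallSets M zero)
smallSets (suc M) (suc s) = map (setAt M false) (smallSets M (suc s)) ++ map (setAt M true) (smallSets M s)

length-smallSets : ∀ M s → length (smallSets M s) ≤ suc M ^ s
length-smallSets zero s = ≤-reflexive (sym (^-zeroˡ s))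
length-smallSets (suc M) zero = ≤-trans (≤-reflexive (length-map _ (smallSets M zero))) (length-smallSets M zero)
length-smallSets (suc M) (suc s) = begin
  length (map (setAt M false) (smallSets M (suc s)) ++ map (setAt M true) (smallSets M s))
    ≡⟨ trans (length-++ (map (setAt M false) (smallSets M (suc s)))) (cong₂ _+_ (length-map _ (smallSets M (suc s))) (length-map _ (smallSets M s))) ⟩
  length (smallSets M (suc s)) + length (smallSets M s)   ≤⟨ +-mono-≤ (length-smallSets M (suc s)) (length-smallSets M s) ⟩
  suc M * suc M ^ s + suc M ^ s     ≡⟨ +-comm (suc M * suc M ^ s) _ ⟩
  suc (suc M) * suc M ^ s           ≤⟨ *-monoʳ-≤ (suc (suc M)) (^-monoˡ-≤ s (n≤1+n (suc M))) ⟩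
  suc (suc M) ^ suc s               ∎
  where open ≤-Reasoning

setAt-agree : ∀ M b (K K' : ℕ → Bool) → K M ≡ b → (∀ y → y < M → K' y ≡ K y) → ∀ y → y < suc M → setAt M b K' y ≡ K y
setAt-agree M b K K' e h y (s≤s l) with m≤n⇒m<n∨m≡n l
... | inj₁ q rewrite ≡ᵇ-false (<⇒≢ q) = h y q
... | inj₂ refl rewrite ≡ᵇ-true {y} refl = sym e

-- There are infinitely many predicates on `ℕ`; a finite list can represent them only up to
-- agreement below `M`, which is all that loads depend on.
smallSets-complete : ∀ M s K → cnt K M ≤ s → ∃ λ K' → K' ∈ smallSets M s × (∀ y → y < M → K' y ≡ K y)
smallSets-complete zero s K _ = _ , here refl , λ _ ()
smallSets-complete (suc M) s K l with K M in eq
smallSets-complete (suc M) (suc s) K (s≤s l) | true with smallSets-complete M s K l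
... | K' , m , h = setAt M true K' , ∈-++⁺ʳ _ (∈-map⁺ _ m) , setAt-agree M true K K' eq h
smallSets-complete (suc M) zero K l | false with smallSets-complete M zero K l
... | K' , m , h = setAt M false K' , ∈-map⁺ _ m , setAt-agree M false K K' eq h
smallSets-complete (suc M) (suc s) K l | false with smallSets-complete M (suc s) K l
... | K' , m , h = setAt M false K' , ∈-++⁺ˡ (∈-map⁺ _ m) , setAt-agree M false K K' eq h

cnt-setAt : ∀ M b K → cnt (setAt M b K) (suc M) ≡ b2n b + cnt K M
cnt-setAt M b K rewrite ≡ᵇ-true {M} refl = cong (b2n b +_) (cnt-cong _ _ M agree)
  where
  agree : ∀ y → y < M → setAt M b K y ≡ K y
  agree y l rewrite ≡ᵇ-false (<⇒≢ l) = refl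

smallSets-small : ∀ M s {K} → K ∈ smallSets M s → cnt K M ≤ s
smallSets-small zero s _ = z≤n
smallSets-small (suc M) zero m with ∈-map⁻ _ m
... | K , m' , refl = ≤-trans (≤-reflexive (cnt-setAt M false K)) (smallSets-small M zero m')
smallSets-small (suc M) (suc s) m with ∈-++⁻ (map (setAt M false) (smallSets M (suc s))) m
... | inj₁ m₁ with ∈-map⁻ _ m₁
...   | K , m' , refl = ≤-trans (≤-reflexive (cnt-setAt M false K)) (smallSets-small M (suc s) m')
smallSets-small (suc M) (suc s) m | inj₂ m₂ with ∈-map⁻ _ m₂
...   | K , m' , refl = ≤-trans (≤-reflexive (cnt-setAt M true K)) (s≤s (smallSets-small M s m'))

-- The potential Σ_b (1 + j)^load(b) has mean at most 2q over all functions into [0, q); hence some function is good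
-- for at least half of any list of key sets, and T of them serve fewer than 2^T key sets.
module _ (q' M s j : ℕ) (small : 2 * (s * j) ≤ suc q') where
  private
    q = suc q'

  potential : (ℕ → Bool) → List ℕ → ℕ
  potential K h = sumF (λ b → suc j ^ load K b h) q

  total : List (ℕ → Bool) → List ℕ → ℕ
  total [] h = 0
  total (K ∷ Ks) h = potential K h + total Ks h

  sumAll-potential : ∀ K → cnt K M ≤ s → sumAll q M (potential K) ≤ q * (2 * q ^ M)
  sumAll-potential K l = begin
    sumAll q M (potential K)                                ≡⟨ sumAll-sumF q M (λ b h → suc j ^ load K b h) q ⟩
    sumF (λ b → sumAll q M (λ h → suc j ^ load K b h)) q    ≤⟨ sumF-mono q each ⟩
    sumF (λ _ → 2 * q ^ M) q                                ≡⟨ sumF-const (2 * q ^ M) q ⟩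
    q * (2 * q ^ M)                                         ∎
    where
    open ≤-Reasoning
    r = cnt K M
    e : ∀ a b → a * (2 * b) ≡ 2 * a * b
    e = solve-∀
    each : ∀ b → b < q → sumAll q M (λ h → suc j ^ load K b h) ≤ 2 * q ^ M
    each b b< = *-cancelʳ-≤ _ _ (q ^ r) {{m^n≢0 q r}} (begin
      sumAll q M (λ h → suc j ^ load K b h) * q ^ r   ≡⟨ sumAll-load q j K b M b< ⟩
      q ^ M * (q + j) ^ r                             ≤⟨ *-monoʳ-≤ (q ^ M) ([q+j]^s≤2q^s q j r (s≤s z≤n) (≤-trans (*-monoʳ-≤ 2 (*-monoˡ-≤ j l)) small)) ⟩
      q ^ M * (2 * q ^ r)                             ≡⟨ e (q ^ M) (q ^ r) ⟩
      2 * q ^ M * q ^ r                               ∎)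

  sumAll-total : ∀ Ks → (∀ K → K ∈ Ks → cnt K M ≤ s) → sumAll q M (total Ks) ≤ length Ks * (q * (2 * q ^ M))
  sumAll-total [] h = ≤-reflexive (sumAll-0 q M)
  sumAll-total (K ∷ Ks) h = ≤-trans (≤-reflexive (sumAll-+ q M (potential K) (total Ks)))
    (+-mono-≤ (sumAll-potential K (h K (here refl))) (sumAll-total Ks (λ K' m → h K' (there m))))

  bad : List ℕ → List (ℕ → Bool) → List (ℕ → Bool)
  bad h [] = []
  bad h (K ∷ Ks) = if 4 * q <ᵇ potential K h then K ∷ bad h Ks else bad h Ks

  bad-⊆ : ∀ h Ks {K} → K ∈ bad h Ks → K ∈ Ks
  bad-⊆ h (K ∷ Ks) m with 4 * q <ᵇ potential K h
  bad-⊆ h (K ∷ Ks) (here e) | true = here e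
  bad-⊆ h (K ∷ Ks) (there m) | true = there (bad-⊆ h Ks m)
  ... | false = there (bad-⊆ h Ks m)

  bad-or-good : ∀ h Ks {K} → K ∈ Ks → K ∈ bad h Ks ⊎ potential K h ≤ 4 * q
  bad-or-good h (K ∷ Ks) {K'} m with 4 * q <? potential K h
  bad-or-good h (K ∷ Ks) (here refl) | yes r rewrite <ᵇ-true r = inj₁ (here refl)
  bad-or-good h (K ∷ Ks) (here refl) | no r = inj₂ (≮⇒≥ r)
  bad-or-good h (K ∷ Ks) (there m) | yes r rewrite <ᵇ-true r with bad-or-good h Ks m
  ... | inj₁ x = inj₁ (there x)
  ... | inj₂ y = inj₂ y
  bad-or-good h (K ∷ Ks) (there m) | no r rewrite <ᵇ-false (≮⇒≥ r) = bad-or-good h Ks m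

  bad-total : ∀ h Ks → length (bad h Ks) * (4 * q) ≤ total Ks h
  bad-total h [] = z≤n
  bad-total h (K ∷ Ks) with 4 * q <? potential K h
  ... | yes r rewrite <ᵇ-true r = +-mono-≤ (<⇒≤ r) (bad-total h Ks)
  ... | no r rewrite <ᵇ-false (≮⇒≥ r) = ≤-trans (bad-total h Ks) (m≤n+m _ _)

  -- Markov's inequality: `bad` means a potential above `4 * q`, twice the bound on the mean.
  halve : ∀ Ks → (∀ K → K ∈ Ks → cnt K M ≤ s) → ∃ λ h → length h ≡ M × (∀ x → get h x < q) × 2 * length (bad h Ks) ≤ length Ks
  halve Ks hyp with average q' M (total Ks)
  ... | h , len , vals , le = h , len , vals , *-cancelʳ-≤ (2 * length (bad h Ks)) (length Ks) (2 * q) (begin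
      2 * length (bad h Ks) * (2 * q)     ≡⟨ e₁ (length (bad h Ks)) q ⟩
      length (bad h Ks) * (4 * q)         ≤⟨ bad-total h Ks ⟩
      total Ks h                          ≤⟨ *-cancelˡ-≤ (q ^ M) {{m^n≢0 q M}} (begin
        q ^ M * total Ks h                ≤⟨ le ⟩
        sumAll q M (total Ks)             ≤⟨ sumAll-total Ks hyp ⟩
        length Ks * (q * (2 * q ^ M))     ≡⟨ e₂ (length Ks) q (q ^ M) ⟩
        q ^ M * (length Ks * (2 * q))     ∎) ⟩
      length Ks * (2 * q)                 ∎)
    where
    open ≤-Reasoning
    e₁ : ∀ a q → 2 * a * (2 * q) ≡ a * (4 * q)
    e₁ = solve-∀
    e₂ : ∀ a q x → a * (q * (2 * x)) ≡ x * (a * (2 * q))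
    e₂ = solve-∀

  family : ∀ T Ks → (∀ K → K ∈ Ks → cnt K M ≤ s) → length Ks < 2 ^ T →
    Σ (ℕ → List ℕ) λ hs → (∀ t → length (hs t) ≡ M) × (∀ t x → get (hs t) x < q) × (∀ K → K ∈ Ks → ∃ λ t → t < T × potential K (hs t) ≤ 4 * q)
  family zero [] hyp _ with halve [] hyp
  ... | h , len , vals , _ = (λ _ → h) , (λ _ → len) , (λ _ → vals) , λ K ()
  family zero (K ∷ Ks) hyp (s≤s ())
  family (suc T) Ks hyp l with halve Ks hyp
  ... | h , len , vals , half with family T (bad h Ks) (λ K m → hyp K (bad-⊆ h Ks m)) (*-cancelˡ-< 2 _ _ (≤-<-trans half l))
  ...   | hs , lens , valss , ok = hs' , (λ { zero → len ; (suc t) → lens t }) , (λ { zero → vals ; (suc t) → valss t }) , ok'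
    where
    hs' : ℕ → List ℕ
    hs' zero = h
    hs' (suc t) = hs t
    ok' : ∀ K → K ∈ Ks → ∃ λ t → t < suc T × potential K (hs' t) ≤ 4 * q
    ok' K m with bad-or-good h Ks m
    ... | inj₂ g = zero , s≤s z≤n , g
    ... | inj₁ b with ok K b
    ...   | t , t< , g = suc t , s≤s t< , g

  -- A `T` slightly above `s lg (M + 1)` satisfies the hypothesis, so an index into the family takes
  -- only about `lg s + lg lg M` bits.
  hashFamily : ∀ T → suc M ^ s < 2 ^ T →
    Σ (ℕ → ℕ → ℕ) λ H → (∀ t x → H t x < q) ×
      (∀ K → cnt K M ≤ s → ∃ λ t → t < T × (∀ b → b < q → suc j ^ cnt (λ x → K x ∧ (H t x ≡ᵇ b)) M ≤ 4 * q))
  hashFamily T l with family T (smallSets M s) (λ K → smallSets-small M s) (≤-<-trans (length-smallSets M s) l)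
  ... | hs , lens , vals , ok = (λ t → get (hs t)) , vals , good
    where
    good : ∀ K → cnt K M ≤ s → ∃ λ t → t < T × (∀ b → b < q → suc j ^ cnt (λ x → K x ∧ (get (hs t) x ≡ᵇ b)) M ≤ 4 * q)
    good K le with smallSets-complete M s K le
    ... | K' , m , agree with ok K' m
    ...   | t , t< , p = t , t< , λ b b< → ≤-trans (≤-reflexive (cong (suc j ^_) (trans (cnt-cong _ _ M (λ y l → cong (_∧ (get (hs t) y ≡ᵇ b)) (sym (agree y l))))
              (trans (cong (cnt _) (sym (lens t))) (sym (load≡cnt K' b (hs t))))))) (≤-trans (term≤sumF (λ b → suc j ^ load K' b (hs t)) b<) p)

-- Retrieval

-- A fully indexable dictionary. The cardinality is passed to the queries rather than stored, and it
-- determines the length together with the universe.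
record FID (W : ℕ) : Set₁ where
  field
    Fits : ℕ → Set
    len : ℕ → ℕ → ℕ
    enc : ℕ → (ℕ → Bool) → List Bool
    length-enc : ∀ U p → Fits U → length (enc U p) ≡ len U (cnt p U)
    rankCost selCost : ℕ
    rankQ : ℕ → ℕ → ℕ → ℕ → Prog W ℕ rankCost
    selQ : ℕ → ℕ → ℕ → ℕ → Prog W ℕ selCost
    exec-rankQ : ∀ {mem} U p o x → Fits U → x ≤ U → At mem o (enc U p) → exec mem (rankQ U (cnt p U) o x) ≡ cnt p x
    exec-selQ : ∀ {mem} U p o i → Fits U → i < cnt p U → At mem o (enc U p) → exec mem (selQ U (cnt p U) o i) ≡ sel p U i

-- Nothing is promised for `x` outside the key set. This freedom lets the size avoid the
-- `lg C(M, k)` bits that membership would require.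
record Retrieval (W M k v cost len : ℕ) : Set where
  field
    enc : (p : ℕ → Bool) (g : ℕ → ℕ) → cnt p M ≡ k → List Bool
    length-enc : ∀ p g h → length (enc p g h) ≡ len
    query : ℕ → ℕ → Prog W ℕ cost
    exec-query : ∀ {mem} p g h o x → (∀ x → g x < 2 ^ v) → p x ≡ true → x < M → At mem o (enc p g h) → exec mem (query o x) ≡ g x

cnt≤1⇒unique : ∀ p M {x y} → cnt p M ≤ 1 → p x ≡ true → x < M → p y ≡ true → y < M → x ≡ y
cnt≤1⇒unique p M {x} {y} h ex lx ey ly = cnt-injective p ex ey (trans (n<1⇒n≡0 (<-≤-trans (cnt-< p ex lx) h)) (sym (n<1⇒n≡0 (<-≤-trans (cnt-< p ey ly) h))))

cnt-insert : ∀ z K U → z < U → K z ≡ false → cnt (setAt z true K) U ≡ suc (cnt K U)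
cnt-insert z K (suc U) (s≤s l) e with m≤n⇒m<n∨m≡n l
... | inj₁ q rewrite ≡ᵇ-false (>⇒≢ q) | cnt-insert z K U q e = +-suc (b2n (K U)) (cnt K U)
... | inj₂ refl = trans (cnt-setAt z true K) (cong suc (sym (cnt-suc-false K {z} e)))

module _ (p : ℕ → Bool) (slot : ℕ → ℕ) where

  fibre : ℕ → ℕ → Bool
  fibre z x = p x ∧ (slot x ≡ᵇ z)

  image : ℕ → ℕ → Bool
  image M z = 0 <ᵇ cnt (fibre z) M

  fibre-∈ : ∀ x → p x ≡ true → fibre (slot x) x ≡ true
  fibre-∈ x e rewrite e = ≡ᵇ-true {slot x} refl

  image-∈ : ∀ M x → p x ≡ true → x < M → image M (slot x) ≡ true
  image-∈ M x e l = <ᵇ-true (≤-<-trans z≤n (cnt-< (fibre (slot x)) (fibre-∈ x e) l))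

  cnt-image : ∀ M U → (∀ x y → p x ≡ true → x < M → p y ≡ true → y < M → slot x ≡ slot y → x ≡ y) → (∀ x → slot x < U) → cnt (image M) U ≡ cnt p M
  cnt-image zero U inj lt = trans (cnt-cong (image 0) (λ _ → false) U (λ _ _ → refl)) (cnt-false U)
    where
    cnt-false : ∀ U → cnt (λ _ → false) U ≡ 0
    cnt-false zero = refl
    cnt-false (suc U) = cnt-false U
  cnt-image (suc M) U inj lt = byCase (p M) refl
    where
    ih = cnt-image M U (λ x y a b c d → inj x y a (m≤n⇒m≤1+n b) c (m≤n⇒m≤1+n d)) lt
    module _ (eq : p M ≡ true) where
      agree : ∀ z → image (suc M) z ≡ setAt (slot M) true (image M) z
      agree z rewrite eq with slot M ≟ z
      ... | yes refl rewrite ≡ᵇ-true {slot M} refl = refl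
      ... | no q rewrite ≡ᵇ-false q | ≡ᵇ-false (q ∘ sym) = refl
      fresh : image M (slot M) ≡ false
      fresh with 0 <? cnt (fibre (slot M)) M
      ... | no q = <ᵇ-false (≮⇒≥ q)
      ... | yes q = let (a , b , _) = sel-spec (fibre (slot M)) M 0 q
                        (c , d) = ∧-true⁻¹ b
                    in contradiction (inj _ M c (m≤n⇒m≤1+n a) eq ≤-refl (≡ᵇ-true⁻¹ d)) (<⇒≢ a)
    byCase : ∀ b → p M ≡ b → cnt (image (suc M)) U ≡ b2n b + cnt p M
    byCase false eq = trans (cnt-cong (image (suc M)) (image M) U (λ z _ → cong (λ b → 0 <ᵇ (b2n (b ∧ (slot M ≡ᵇ z)) + cnt (fibre z) M)) eq)) ih
    byCase true eq = trans (cnt-cong (image (suc M)) (setAt (slot M) true (image M)) U (λ z _ → agree eq z))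
      (trans (cnt-insert (slot M) (image M) U (lt M) (fresh eq)) (cong suc ih))

module _ {W : ℕ} (F : FID W) (M k v B τ₁ R τ₂ lm : ℕ) where
  open FID F

  -- Keys are split over B buckets of at most lm keys by one function of the first family; each bucket
  -- then picks a function of the second family that is injective on it, so that (bucket, hash) is a
  -- set of k slots in [0, B R) whose ranks index the table of values.
  retrieval :
    (H₁ : ℕ → ℕ → ℕ) → (∀ t x → H₁ t x < B) → (∀ K → cnt K M ≤ k → ∃ λ t → t < 2 ^ τ₁ × (∀ b → b < B → cnt (λ x → K x ∧ (H₁ t x ≡ᵇ b)) M ≤ lm)) →
    (H₂ : ℕ → ℕ → ℕ) → (∀ t x → H₂ t x < R) → (∀ K → cnt K M ≤ lm → ∃ λ t → t < 2 ^ τ₂ × (∀ b → b < R → cnt (λ x → K x ∧ (H₂ t x ≡ᵇ b)) M ≤ 1)) →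
    Fits (B * R) → τ₁ ≤ W → τ₂ ≤ W → v ≤ W →
    Retrieval W M k v (1 + (1 + (rankCost + 1))) (τ₁ + (B * τ₂ + (k * v + len (B * R) k)))
  retrieval H₁ H₁< good₁ H₂ H₂< good₂ fitsU τ₁≤W τ₂≤W v≤W = record { enc = enc' ; length-enc = length-enc' ; query = query' ; exec-query = exec-query' }
    where
    U = B * R
    instance
      R-nonZero : NonZero R
      R-nonZero = >-nonZero (≤-<-trans z≤n (H₂< 0 0))

    module Enc (p : ℕ → Bool) (g : ℕ → ℕ) (h : cnt p M ≡ k) where
      t₁ : ℕ
      t₁ = proj₁ (good₁ p (≤-reflexive h))
      bucket : ℕ → ℕ → Bool
      bucket b x = p x ∧ (H₁ t₁ x ≡ᵇ b)
      choice : ∀ b → ∃ λ t → t < 2 ^ τ₂ × (b < B → ∀ c → c < R → cnt (λ x → bucket b x ∧ (H₂ t x ≡ᵇ c)) M ≤ 1)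
      choice b with b <? B
      ... | no q = 0 , 2^-pos τ₂ , λ l → contradiction l q
      ... | yes q = let (t , t< , ok) = good₂ (bucket b) (proj₂ (proj₂ (good₁ p (≤-reflexive h))) b q) in t , t< , λ _ → ok
      idx : ℕ → ℕ
      idx b = proj₁ (choice b)
      slot : ℕ → ℕ
      slot x = H₁ t₁ x * R + H₂ (idx (H₁ t₁ x)) x
      slot< : ∀ x → slot x < U
      slot< x = <-≤-trans (+-monoʳ-< (H₁ t₁ x * R) (H₂< _ x)) (≤-trans (≤-reflexive (+-comm (H₁ t₁ x * R) R)) (*-monoˡ-≤ R (H₁< t₁ x)))
      slot/R : ∀ x → slot x / R ≡ H₁ t₁ x
      slot/R x = trans (cong (_/ R) (+-comm (H₁ t₁ x * R) _)) (trans (+-distrib-/-∣ʳ (H₂ (idx (H₁ t₁ x)) x) (divides (H₁ t₁ x) refl))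
        (cong₂ _+_ (m<n⇒m/n≡0 (H₂< _ x)) (m*n/n≡m (H₁ t₁ x) R)))
      slot-inj : ∀ x y → p x ≡ true → x < M → p y ≡ true → y < M → slot x ≡ slot y → x ≡ y
      slot-inj x y px lx py ly e = cnt≤1⇒unique _ M (proj₂ (proj₂ (choice b)) (H₁< t₁ x) (H₂ (idx b) x) (H₂< _ x)) (mem x px refl refl) lx (mem y py (sym same) same₂) ly
        where
        b = H₁ t₁ x
        same : H₁ t₁ x ≡ H₁ t₁ y
        same = trans (sym (slot/R x)) (trans (cong (_/ R) e) (slot/R y))
        same₂ : H₂ (idx b) y ≡ H₂ (idx b) x
        same₂ = sym (+-cancelˡ-≡ (b * R) _ _ (trans e (cong (λ c → c * R + H₂ (idx c) y) (sym same))))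
        mem : ∀ z → p z ≡ true → H₁ t₁ z ≡ b → H₂ (idx b) z ≡ H₂ (idx b) x → (bucket b z ∧ (H₂ (idx b) z ≡ᵇ H₂ (idx b) x)) ≡ true
        mem z pz e₁ e₂ rewrite pz | ≡ᵇ-true e₁ | ≡ᵇ-true e₂ = refl
      Y : ℕ → Bool
      Y = image p slot M
      cntY : cnt Y U ≡ k
      cntY = trans (cnt-image p slot M U slot-inj slot<) h
      -- The table is ordered by slot: entry `r` belongs to the only key in the slot of rank `r`,
      -- recovered as the first element of its fibre.
      value : ℕ → ℕ
      value r = g (sel (fibre p slot (sel Y U r)) M 0)
      value-correct : ∀ x → p x ≡ true → x < M → value (cnt Y (slot x)) ≡ g x
      value-correct x px lx = trans (cong (λ z → g (sel (fibre p slot z) M 0)) (sel-cnt Y U (slot x) (image-∈ p slot M x px lx) (slot< x)))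
        (cong g (slot-inj _ x (proj₁ both) (sel-< (fibre p slot (slot x)) M 0 pos) px lx (≡ᵇ-true⁻¹ (proj₂ both))))
        where
        pos : 0 < cnt (fibre p slot (slot x)) M
        pos = ≤-<-trans z≤n (cnt-< (fibre p slot (slot x)) (fibre-∈ p slot x px) lx)
        both = ∧-true⁻¹ (sel-∈ (fibre p slot (slot x)) M 0 pos)
      A₁ = bits τ₁ t₁
      A₂ = arr τ₂ idx B
      A₃ = arr v value k
      A₄ = enc U Y

    enc' : (p : ℕ → Bool) (g : ℕ → ℕ) → cnt p M ≡ k → List Bool
    enc' p g h = let open Enc p g h in A₁ ++ A₂ ++ A₃ ++ A₄

    length-enc' : ∀ p g h → length (enc' p g h) ≡ τ₁ + (B * τ₂ + (k * v + len U k))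
    length-enc' p g h = trans (length-++ A₁) (cong₂ _+_ (length-bits τ₁ t₁) (trans (length-++ A₂) (cong₂ _+_ (length-arr τ₂ idx B)
      (trans (length-++ A₃) (cong₂ _+_ (length-arr v value k) (trans (length-enc U Y fitsU) (cong (len U) cntY)))))))
      where open Enc p g h

    query' : ℕ → ℕ → Prog W ℕ (1 + (1 + (rankCost + 1)))
    query' o x =
      rdN o τ₁ >>= λ t →
      rdN (o + τ₁ + H₁ t x * τ₂) τ₂ >>= λ i →
      rankQ U k (o + τ₁ + B * τ₂ + k * v) (H₁ t x * R + H₂ i x) >>= λ r →
      rdN (o + τ₁ + B * τ₂ + r * v) v

    exec-query' : ∀ {mem} p g h o x → (∀ x → g x < 2 ^ v) → p x ≡ true → x < M → At mem o (enc' p g h) → exec mem (query' o x) ≡ g x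
    exec-query' {mem} p g h o x g< px lx at =
      exec-bind mem (rdN o τ₁) k₁ (exec-rdN o τ₁ t₁ (At-++ˡ A₁ at) (proj₁ (proj₂ (good₁ p (≤-reflexive h)))) τ₁≤W)
      (exec-bind mem (rdN (o + τ₁ + b * τ₂) τ₂) (k₂ t₁) (exec-rdN _ τ₂ (idx b) (At-arr τ₂ idx B b (At-++ˡ A₂ at₂) (H₁< t₁ x)) (proj₁ (proj₂ (choice b))) τ₂≤W)
      (exec-bind mem (rankQ U k (o + τ₁ + B * τ₂ + k * v) (slot x)) k₃ rankOk
      (trans (exec-rdN _ v (value (cnt Y (slot x))) (At-arr v value k (cnt Y (slot x)) (At-++ˡ A₃ at₃) r<k) (g< _) v≤W) (value-correct x px lx))))
      where
      open Enc p g h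
      b = H₁ t₁ x
      k₃ : ℕ → Prog W ℕ 1
      k₃ r = rdN (o + τ₁ + B * τ₂ + r * v) v
      k₂ : ℕ → ℕ → Prog W ℕ (rankCost + 1)
      k₂ t i = rankQ U k (o + τ₁ + B * τ₂ + k * v) (H₁ t x * R + H₂ i x) >>= k₃
      k₁ : ℕ → Prog W ℕ (1 + (rankCost + 1))
      k₁ t = rdN (o + τ₁ + H₁ t x * τ₂) τ₂ >>= k₂ t
      at₂ : At mem (o + τ₁) (A₂ ++ A₃ ++ A₄)
      at₂ = subst (λ z → At mem (o + z) (A₂ ++ A₃ ++ A₄)) (length-bits τ₁ t₁) (At-++ʳ A₁ at)
      at₃ : At mem (o + τ₁ + B * τ₂) (A₃ ++ A₄)
      at₃ = subst (λ z → At mem (o + τ₁ + z) (A₃ ++ A₄)) (length-arr τ₂ idx B) (At-++ʳ A₂ at₂)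
      at₄ : At mem (o + τ₁ + B * τ₂ + k * v) A₄
      at₄ = subst (λ z → At mem (o + τ₁ + B * τ₂ + z) A₄) (length-arr v value k) (At-++ʳ A₃ at₃)
      r<k : cnt Y (slot x) < k
      r<k = subst (cnt Y (slot x) <_) cntY (cnt-< Y (image-∈ p slot M x px lx) (slot< x))
      rankOk : exec mem (rankQ U k (o + τ₁ + B * τ₂ + k * v) (slot x)) ≡ cnt Y (slot x)
      rankOk = trans (cong (λ z → exec mem (rankQ U z (o + τ₁ + B * τ₂ + k * v) (slot x))) (sym cntY)) (exec-rankQ U Y _ (slot x) fitsU (<⇒≤ (slot< x)) at₄)

-- Splitting off low-order bits

quotient-unique : ∀ d x q q' → q * d ≤ x → x < suc q * d → q' * d ≤ x → x < suc q' * d → q ≡ q'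
quotient-unique d x q q' a b a' b' = ≤-antisym (s≤s⁻¹ (*-cancelʳ-< d q (suc q') (≤-<-trans a b'))) (s≤s⁻¹ (*-cancelʳ-< d q' (suc q) (≤-<-trans a' b)))

mixed-radix-injective : ∀ d q r q' r' → r < d → r' < d → q * d + r ≡ q' * d + r' → q ≡ q' × r ≡ r'
mixed-radix-injective d q r q' r' l l' e = q≡q' , +-cancelˡ-≡ (q * d) r r' (trans e (cong (λ z → z * d + r') (sym q≡q')))
  where
  upper : ∀ q r → r < d → q * d + r < suc q * d
  upper q r l = subst (q * d + r <_) (+-comm (q * d) d) (+-monoʳ-< (q * d) l)
  q≡q' : q ≡ q'
  q≡q' = quotient-unique d (q * d + r) q q' (m≤m+n _ r) (upper q r l) (subst (q' * d ≤_) (sym e) (m≤m+n _ r')) (subst (_< suc q' * d) (sym e) (upper q' r' l'))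

-- Iterated halving instead of division by `2 ^ t`, so that the dyadic intervals of heights `t` and
-- `suc t` are related by computation.
shr : ℕ → ℕ → ℕ
shr x zero = x
shr x (suc t) = shr x t / 2

shr-lower : ∀ x t → shr x t * 2 ^ t ≤ x
shr-lower x zero = ≤-reflexive (*-identityʳ x)
shr-lower x (suc t) = ≤-trans (≤-trans (≤-reflexive (sym (*-assoc (shr x t / 2) 2 (2 ^ t)))) (*-monoˡ-≤ (2 ^ t) (m/n*n≤m (shr x t) 2))) (shr-lower x t)

shr-upper : ∀ x t → x < suc (shr x t) * 2 ^ t
shr-upper x zero = ≤-reflexive (sym (*-identityʳ (suc x)))
shr-upper x (suc t) = <-≤-trans (shr-upper x t) (≤-trans (*-monoˡ-≤ (2 ^ t) lt) (≤-reflexive (*-assoc (suc (shr x t / 2)) 2 (2 ^ t))))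
  where
  lt : suc (shr x t) ≤ suc (shr x t / 2) * 2
  lt = subst (λ z → suc z ≤ suc (shr x t / 2) * 2) (sym (m≡m%n+[m/n]*n (shr x t) 2)) (+-monoˡ-≤ (shr x t / 2 * 2) (m%n<n (shr x t) 2))

shr-mono : ∀ {x y} t → x ≤ y → shr x t ≤ shr y t
shr-mono zero l = l
shr-mono (suc t) l = /-monoˡ-≤ 2 (shr-mono t l)

shr≤ : ∀ x t → shr x t ≤ x
shr≤ x t = ≤-trans (m≤m*n (shr x t) (2 ^ t) {{m^n≢0 2 t}}) (shr-lower x t)

shr≡0 : ∀ x t → x < 2 ^ t → shr x t ≡ 0
shr≡0 x t l = n<1⇒n≡0 (*-cancelʳ-< (2 ^ t) (shr x t) 1 (≤-<-trans (shr-lower x t) (subst (x <_) (sym (+-identityʳ (2 ^ t))) l)))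

low : ℕ → ℕ → ℕ
low x t = x ∸ shr x t * 2 ^ t

low< : ∀ x t → low x t < 2 ^ t
low< x t = +-cancelˡ-< (shr x t * 2 ^ t) _ _ (subst₂ _<_ (sym (m+[n∸m]≡n (shr-lower x t))) (+-comm (2 ^ t) _) (shr-upper x t))

-- Monotone perfect hashing: x is located by its group of b consecutive elements, and the group by
-- the smallest dyadic interval containing it.

least : (ℕ → Bool) → ℕ → ℕ
least P zero = 0
least P (suc l) = if P 0 then 0 else suc (least (P ∘ suc) l)

-- Failure is recorded just one step below the least solution; the midpoint argument for dyadic
-- intervals looks no further down.
least-spec : ∀ P l → P l ≡ true → P (least P l) ≡ true × least P l ≤ l × (∀ t → suc t ≡ least P l → P t ≡ false)
least-spec P zero e = e , z≤n , λ _ ()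
least-spec P (suc l) e with P 0 in eq
... | true = eq , z≤n , λ _ ()
... | false with least-spec (P ∘ suc) l e
...   | a , b , c = a , s≤s b , minimal
  where
  minimal : ∀ t → suc t ≡ suc (least (P ∘ suc) l) → P t ≡ false
  minimal zero _ = eq
  minimal (suc t) q = c t (suc-injective q)

sel-mono : ∀ p u {i i'} → i ≤ i' → i' < cnt p u → sel p u i ≤ sel p u i'
sel-mono p u {i} {i'} l l' with sel p u i ≤? sel p u i'
... | yes q = q
... | no q = contradiction (subst₂ _<_ (cnt-sel p u i' l') (cnt-sel p u i (≤-<-trans l l')) (cnt-< p (sel-∈ p u i' l') (≰⇒> q))) (≤⇒≯ l)

sel≤ : ∀ p u i → sel p u i ≤ u
sel≤ p zero i = z≤n
sel≤ p (suc u) i with i <ᵇ cnt p u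
... | true = m≤n⇒m≤1+n (sel≤ p u i)
... | false = n≤1+n u

module Groups (m l b : ℕ) (m≤2^l : m ≤ 2 ^ l) (1≤b : 1 ≤ b) (p : ℕ → Bool) where

  instance
    b-nonZero : NonZero b
    b-nonZero = >-nonZero 1≤b

  n : ℕ
  n = cnt p m

  first last : ℕ → ℕ
  first j = sel p m (j * b)
  last j = sel p m ((suc j * b ⊓ n) ∸ 1)

  height : ℕ → ℕ
  height j = least (λ t → shr (first j) t ≡ᵇ shr (last j) t) l

  last-index : ∀ j → j * b < n → suc ((suc j * b ⊓ n) ∸ 1) ≡ suc j * b ⊓ n
  last-index j h = m+[n∸m]≡n (⊓-glb (≤-trans 1≤b (m≤m+n b (j * b))) (≤-<-trans z≤n h))

  last-index< : ∀ j → j * b < n → (suc j * b ⊓ n) ∸ 1 < n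
  last-index< j h = ≤-trans (≤-reflexive (last-index j h)) (m⊓n≤n _ n)

  index≤last : ∀ j i → i < suc j * b → i < n → i ≤ (suc j * b ⊓ n) ∸ 1
  index≤last j i h h' = s≤s⁻¹ (≤-trans (⊓-glb h h') (m≤n+m∸n _ 1))

  height-spec : ∀ j → j * b < n → shr (first j) (height j) ≡ shr (last j) (height j) × height j ≤ l ×
    (∀ t → suc t ≡ height j → shr (first j) t ≢ shr (last j) t)
  height-spec j h with least-spec (λ t → shr (first j) t ≡ᵇ shr (last j) t) l (≡ᵇ-true (trans (zero-at-l (sel-< p m _ h)) (sym (zero-at-l (sel-< p m _ (last-index< j h))))))
    where
    zero-at-l : ∀ {x} → x < m → shr x l ≡ 0
    zero-at-l x< = shr≡0 _ l (<-≤-trans x< m≤2^l)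
  ... | a , b , c = ≡ᵇ-true⁻¹ a , b , λ t e q → contradiction (trans (sym (≡ᵇ-true q)) (c t e)) λ ()

  first≤last : ∀ j → j * b < n → first j ≤ last j
  first≤last j h = sel-mono p m (index≤last j (j * b) (m<n+m (j * b) 1≤b) h) (last-index< j h)

  last<first : ∀ j j' → j < j' → j' * b < n → last j < first j'
  last<first j j' l h' with first j' ≤? last j
  ... | no q = ≰⇒> q
  ... | yes q = contradiction idx (<⇒≱ (≤-trans (≤-reflexive (last-index j h)) (≤-trans (m⊓n≤m _ n) (*-monoˡ-≤ b l))))
    where
    h : j * b < n
    h = ≤-<-trans (*-monoˡ-≤ b (<⇒≤ l)) h'
    idx : j' * b ≤ (suc j * b ⊓ n) ∸ 1
    idx = subst₂ _≤_ (cnt-sel p m _ h') (cnt-sel p m _ (last-index< j h)) (cnt-mono p q)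

  -- `x` lies between the first and the last element of its group, and shifting is monotone. Hence
  -- the prefix that identifies the group can be computed from `x` and the height alone.
  shr-in-group : ∀ x → p x ≡ true → x < m → shr x (height (cnt p x / b)) ≡ shr (first (cnt p x / b)) (height (cnt p x / b))
  shr-in-group x px lx = ≤-antisym (≤-trans (shr-mono t x≤) (≤-reflexive (sym (proj₁ (height-spec j jb<n))))) (shr-mono t ≤x)
    where
    i = cnt p x
    j = i / b
    t = height j
    i<n : i < n
    i<n = cnt-< p px lx
    jb≤i : j * b ≤ i
    jb≤i = m/n*n≤m i b
    jb<n : j * b < n
    jb<n = ≤-<-trans jb≤i i<n
    i<[j+1]b : i < suc j * b
    i<[j+1]b = subst (_< suc j * b) (sym (m≡m%n+[m/n]*n i b)) (+-monoˡ-< (j * b) (m%n<n i b))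
    ≤x : first j ≤ x
    ≤x = subst (first j ≤_) (sel-cnt p m x px lx) (sel-mono p m jb≤i i<n)
    x≤ : x ≤ last j
    x≤ = subst (_≤ last j) (sel-cnt p m x px lx) (sel-mono p m (index≤last j i i<[j+1]b i<n) (last-index< j jb<n))

  -- Two groups sharing their dyadic interval would both straddle its midpoint.
  height-injective : ∀ j j' → j < j' → j' * b < n → height j ≡ height j' → shr (first j) (height j) ≢ shr (first j') (height j')
  height-injective j j' l h' e q with height j in eq
  ... | zero = contradiction (subst (λ z → first j ≡ shr (first j') z) (sym e) q) (<⇒≢ (≤-<-trans (first≤last j h) (last<first j j' l h')))
    where
    h : j * b < n
    h = ≤-<-trans (*-monoˡ-≤ b (<⇒≤ l)) h'
  ... | suc t = contradiction (≤-trans lastodd (≤-trans (shr-mono t (<⇒≤ (last<first j j' l h'))) firsteven)) (<⇒≱ ≤-refl)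
    where
    h : j * b < n
    h = ≤-<-trans (*-monoˡ-≤ b (<⇒≤ l)) h'
    -- One level below the common interval the first element falls into its even half and the last
    -- into its odd half.
    straddle : ∀ x y → x ≤ y → x ≢ y → x / 2 ≡ y / 2 → x ≡ x / 2 * 2 × y ≡ suc (x / 2 * 2)
    straddle x y x≤y x≢y e = even , odd
      where
      lx = m≡m%n+[m/n]*n x 2
      ly = trans (m≡m%n+[m/n]*n y 2) (cong (λ z → y % 2 + z * 2) (sym e))
      rem< : x % 2 < y % 2
      rem< = +-cancelʳ-< (x / 2 * 2) _ _ (subst₂ _<_ lx ly (≤∧≢⇒< x≤y x≢y))
      y%2≡1 : y % 2 ≡ 1
      y%2≡1 = ≤-antisym (s≤s⁻¹ (m%n<n y 2)) (≤-<-trans z≤n rem<)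
      x%2≡0 : x % 2 ≡ 0
      x%2≡0 = n<1⇒n≡0 (subst (x % 2 <_) y%2≡1 rem<)
      even : x ≡ x / 2 * 2
      even = trans lx (cong (_+ x / 2 * 2) x%2≡0)
      odd : y ≡ suc (x / 2 * 2)
      odd = trans ly (cong (_+ x / 2 * 2) y%2≡1)
    spec : ∀ j → j * b < n → height j ≡ suc t → shr (first j) t ≡ shr (first j) t / 2 * 2 × shr (last j) t ≡ suc (shr (first j) t / 2 * 2)
    spec j h e = let (x , _ , z) = height-spec j h in
      straddle (shr (first j) t) (shr (last j) t) (shr-mono t (first≤last j h)) (z t (sym e)) (subst (λ u → shr (first j) u ≡ shr (last j) u) e x)
    c = shr (first j) t / 2 * 2
    lastodd : suc c ≤ shr (last j) t
    lastodd = ≤-reflexive (sym (proj₂ (spec j h eq)))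
    firsteven : shr (first j') t ≤ c
    firsteven = ≤-reflexive (trans (proj₁ (spec j' h' (sym e))) (cong (_* 2) (sym (subst (λ u → shr (first j) (suc t) ≡ shr (first j') u) (sym e) q))))

-- The height is supplied by the caller, as part of the hint of `x`. Heights cost O(lg l) bits per
-- hinted element, whereas a group number of up to `l` bits is stored once per group.
record Locator (m l b : ℕ) (m≤2^l : m ≤ 2 ^ l) (1≤b : 1 ≤ b) (W n cost len : ℕ) : Set where
  field
    enc : (p : ℕ → Bool) → cnt p m ≡ n → List Bool
    length-enc : ∀ p h → length (enc p h) ≡ len
    query : ℕ → ℕ → ℕ → Prog W ℕ cost
    exec-query : ∀ {mem} p h o x → p x ≡ true → x < m → At mem o (enc p h) →
      exec mem (query o (Groups.height m l b m≤2^l 1≤b p (_/_ (cnt p x) b {{>-nonZero 1≤b}})) x) ≡ _/_ (cnt p x) b {{>-nonZero 1≤b}}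

module _ (m l b : ℕ) (m≤2^l : m ≤ 2 ^ l) (1≤b : 1 ≤ b) (W n cost : ℕ) where

  private instance
    b-nonZero : NonZero b
    b-nonZero = >-nonZero 1≤b

  trivialLocator : n ≤ b → Locator m l b m≤2^l 1≤b W n cost 0
  trivialLocator n≤b = record
    { enc = λ _ _ → [] ; length-enc = λ _ _ → refl ; query = λ _ _ _ → ret 0
    ; exec-query = λ p h o x px lx _ → sym (m<n⇒m/n≡0 (<-≤-trans (cnt-< p px lx) (≤-trans (≤-reflexive h) n≤b))) }

  -- The number of groups, `n / b` rounded up, for `n ≥ 1`.
  ng : ℕ
  ng = suc ((n ∸ 1) / b)

  -- Height and prefix together identify a group by `height-injective`. The pair is numbered
  -- `t * m + shr x t`, and the group number is retrieved under this key.
  retrievalLocator : ∀ {v len} → 1 ≤ n → ng < 2 ^ v → Retrieval W (suc l * m) ng v cost len → Locator m l b m≤2^l 1≤b W n cost len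
  retrievalLocator {v} 1≤n ng< R = record
    { enc = λ p h → RR.enc (keys p) (group p) (cntKeys p h)
    ; length-enc = λ p h → RR.length-enc _ _ _
    ; query = λ o t x → RR.query o (t * m + shr x t)
    ; exec-query = λ p h o x px lx at → exec-query' p h o x px lx at }
    where
    module RR = Retrieval R
    module G = Groups m l b m≤2^l 1≤b
    key : (ℕ → Bool) → ℕ → ℕ
    key p j = G.height p j * m + shr (G.first p j) (G.height p j)
    everything : ℕ → Bool
    everything _ = true
    keys : (ℕ → Bool) → ℕ → Bool
    keys p = image everything (λ j → if j <ᵇ ng then key p j else 0) ng
    slot : (ℕ → Bool) → ℕ → ℕ
    -- Beyond `ng` the value 0 keeps every slot inside the universe of keys, as `cnt-image` demands.
    slot p j = if j <ᵇ ng then key p j else 0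
    slot≡ : ∀ p j → j < ng → slot p j ≡ key p j
    slot≡ p j l rewrite <ᵇ-true l = refl
    group : (ℕ → Bool) → ℕ → ℕ
    group p z = sel (fibre everything (slot p) z) ng 0
    jb<n : ∀ p → cnt p m ≡ n → ∀ j → j < ng → j * b < cnt p m
    jb<n p h j (s≤s l) = subst (j * b <_) (trans (m+[n∸m]≡n 1≤n) (sym h)) (s≤s (≤-trans (*-monoˡ-≤ b l) (m/n*n≤m (n ∸ 1) b)))
    shr< : ∀ p → cnt p m ≡ n → ∀ j → j < ng → shr (G.first p j) (G.height p j) < m
    shr< p h j jl = ≤-<-trans (shr≤ _ (G.height p j)) (sel-< p m _ (jb<n p h j jl))
    1≤m : ∀ p → cnt p m ≡ n → 1 ≤ m
    1≤m p h = ≤-trans 1≤n (≤-trans (≤-reflexive (sym h)) (cnt-≤ p m))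
    key< : ∀ p → cnt p m ≡ n → ∀ j → j < ng → key p j < suc l * m
    key< p h j jl = <-≤-trans (+-monoʳ-< (G.height p j * m) (shr< p h j jl)) (≤-trans (≤-reflexive (+-comm (G.height p j * m) m)) (*-monoˡ-≤ m (s≤s (proj₁ (proj₂ (G.height-spec p j (jb<n p h j jl)))))))
    slot< : ∀ p → cnt p m ≡ n → ∀ j → slot p j < suc l * m
    slot< p h j with j <? ng
    ... | yes q rewrite <ᵇ-true q = key< p h j q
    ... | no q rewrite <ᵇ-false (≮⇒≥ q) = ≤-trans (1≤m p h) (m≤m+n m (l * m))
    key-inj : ∀ p → cnt p m ≡ n → ∀ i j → i < ng → j < ng → key p i ≡ key p j → i ≡ j
    key-inj p h i j il jl e with mixed-radix-injective m (G.height p i) _ (G.height p j) _ (shr< p h i il) (shr< p h j jl) e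
    ... | eh , es with <-cmp i j
    ...   | tri< l _ _ = contradiction es (G.height-injective p i j l (jb<n p h j jl) eh)
    ...   | tri≈ _ q _ = q
    ...   | tri> _ _ l = contradiction (sym es) (G.height-injective p j i l (jb<n p h i il) (sym eh))
    slot-inj : ∀ p → cnt p m ≡ n → ∀ i j → everything i ≡ true → i < ng → everything j ≡ true → j < ng → slot p i ≡ slot p j → i ≡ j
    slot-inj p h i j _ il _ jl e = key-inj p h i j il jl (trans (sym (slot≡ p i il)) (trans e (slot≡ p j jl)))
    cnt-everything : ∀ u → cnt everything u ≡ u
    cnt-everything zero = refl
    cnt-everything (suc u) = cong suc (cnt-everything u)
    cntKeys : ∀ p → cnt p m ≡ n → cnt (keys p) (suc l * m) ≡ ng
    cntKeys p h = trans (cnt-image everything (slot p) ng (suc l * m) (slot-inj p h) (slot< p h)) (cnt-everything ng)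
    group-correct : ∀ p → cnt p m ≡ n → ∀ j → j < ng → group p (key p j) ≡ j
    group-correct p h j jl = slot-inj p h _ j refl (sel-< (fibre everything (slot p) (key p j)) ng 0 pos) refl jl
        (trans (≡ᵇ-true⁻¹ (sel-∈ (fibre everything (slot p) (key p j)) ng 0 pos)) (sym (slot≡ p j jl)))
      where
      pos : 0 < cnt (fibre everything (slot p) (key p j)) ng
      pos = ≤-<-trans z≤n (cnt-< (fibre everything (slot p) (key p j)) (≡ᵇ-true (slot≡ p j jl)) jl)
    exec-query' : ∀ {mem} p h o x → p x ≡ true → x < m → At mem o (RR.enc (keys p) (group p) (cntKeys p h)) →
      exec mem (RR.query o (G.height p (cnt p x / b) * m + shr x (G.height p (cnt p x / b)))) ≡ cnt p x / b
    exec-query' {mem} p h o x px lx at = trans (cong (λ z → exec mem (RR.query o (G.height p j * m + z))) (G.shr-in-group p x px lx))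
      (trans (RR.exec-query (keys p) (group p) (cntKeys p h) o (key p j) (λ z → ≤-<-trans (sel≤ _ ng 0) ng<)
        (subst (λ z → keys p z ≡ true) (slot≡ p j j<) (image-∈ everything (slot p) ng j refl j<)) (key< p h j j<) at)
      (group-correct p h j j<))
      where
      j = cnt p x / b
      j< : j < ng
      j< = s≤s (/-monoˡ-≤ b (s≤s⁻¹ (subst (cnt p x <_) (trans h (sym (m+[n∸m]≡n 1≤n))) (cnt-< p px lx))))

-- The sparse case

-- Sending an element to its index is a bijection onto `[0, cnt p u)`. This counts the elements that
-- are not first in their cell.
cnt-index : ∀ p f u → cnt (λ x → p x ∧ f (cnt p x)) u ≡ cnt f (cnt p u)
cnt-index p f zero = refl
cnt-index p f (suc u) with p u
... | true = cong (b2n (f (cnt p u)) +_) (cnt-index p f u)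
... | false = cnt-index p f u

cnt-not : ∀ f u → cnt (not ∘ f) u + cnt f u ≡ u
cnt-not f zero = refl
cnt-not f (suc u) with f u
... | true = trans (+-suc (cnt (not ∘ f) u) (cnt f u)) (cong suc (cnt-not f u))
... | false = cong suc (cnt-not f u)

least≤ : ∀ P l → least P l ≤ l
least≤ P zero = z≤n
least≤ P (suc l) with P 0
... | true = z≤n
... | false = s≤s (least≤ (P ∘ suc) l)

-- Each element is cut into a cell (its high part) and r low bits. The occupied cells and the indices starting a
-- run of elements with a common cell are stored as dictionaries. The index of the first element of a cell is
-- found from the cell alone; the other elements go through a monotone perfect hash function. Whatever index a
-- query proposes is verified by a selection, so the answers for non-elements are harmless.
module Structure {W : ℕ} (F : FID W) (m l b : ℕ) (m≤2^l : m ≤ 2 ^ l) (1≤b : 1 ≤ b) (n r k v₁ c₁ c₂ len₂ : ℕ) (len₁ : ℕ → ℕ)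
  (H : ∀ e → Retrieval W m e v₁ c₁ (len₁ e)) (L : Locator m l b m≤2^l 1≤b W n c₂ len₂)
  (m≤k2^r : m ≤ k * 2 ^ r) (fitsk : FID.Fits F k) (fitsn : FID.Fits F n) (r≤W : r ≤ W) (ω≤W : ⌈log₂ suc n ⌉ ≤ W)
  (v₁-ok : suc l * b ≤ 2 ^ v₁) where

  open FID F
  module H e = Retrieval (H e)
  module L = Locator L

  private instance
    b-nonZero : NonZero b
    b-nonZero = >-nonZero 1≤b

  ω o₁ o₂ : ℕ
  ω = ⌈log₂ suc n ⌉
  o₁ = ω
  o₂ = o₁ + n * r

  o₃ o₄ o₅ : ℕ → ℕ
  o₃ d = o₂ + len k d
  o₄ d = o₃ d + len n d
  o₅ d = o₄ d + len₁ (n ∸ d)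

  selDCost : ℕ
  selDCost = rankCost + (selCost + (1 + 0))

  selD : ℕ → ℕ → Prog W ℕ selDCost
  selD d i =
    rankQ n d (o₃ d) (suc i) >>= λ j →
    selQ k d o₂ (j ∸ 1) >>= λ c →
    rdN (o₁ + i * r) r >>= λ lo →
    ret (c * 2 ^ r + lo)

  selectP : ℕ → Prog W ℕ (1 + selDCost)
  selectP i = rdN 0 ω >>= λ d → selD d i

  accept : ℕ → ℕ → ℕ → Maybe ℕ
  accept x i y = if (i <ᵇ n) ∧ (y ≡ᵇ x) then just i else nothing

  verify : ℕ → ℕ → ℕ → Prog W (Maybe ℕ) (selDCost + 0)
  verify d x i = selD d i >>= λ y → ret (accept x i y)

  rankCost' : ℕ
  rankCost' = 1 + (rankCost + (selCost + ((selDCost + 0) + (c₁ + (c₂ + ((selDCost + 0) + 0))))))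

  rankP : ℕ → Prog W (Maybe ℕ) rankCost'
  rankP x =
    rdN 0 ω >>= λ d →
    rankQ k d o₂ (shr x r) >>= λ c →
    selQ n d (o₃ d) c >>= λ i →
    verify d x i >>= λ a₁ →
    H.query (n ∸ d) (o₄ d) x >>= λ g →
    -- A hint is `height * b + offset`: the quotient is the height of the group of `x`, the
    -- remainder the position inside the group.
    L.query (o₅ d) (g / b) x >>= λ j →
    verify d x (j * b + g % b) >>= λ a₂ →
    ret (a₁ <∣> a₂)

  module Enc (p : ℕ → Bool) (h : cnt p m ≡ n) where
    open Runs (2 ^ r) m k m≤k2^r p
    open Groups m l b m≤2^l 1≤b p using (height)

    nD e : ℕ
    nD = cnt occupied k
    e = n ∸ nD

    cntStarts : cnt starts n ≡ nD
    cntStarts = trans (cong (cnt starts) (sym h)) cnt-starts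

    nD≤n : nD ≤ n
    nD≤n = subst (_≤ n) cntStarts (cnt-≤ starts n)

    Z : ℕ → Bool
    Z x = p x ∧ not (starts (cnt p x))

    cntZ : cnt Z m ≡ e
    cntZ = trans (cnt-index p (not ∘ starts) m) (trans (cong (cnt (not ∘ starts)) h)
      (trans (sym (m+n∸n≡m (cnt (not ∘ starts) n) (cnt starts n))) (cong₂ _∸_ (cnt-not starts n) cntStarts)))

    hint : ℕ → ℕ
    hint x = height (cnt p x / b) * b + cnt p x % b

    hint< : ∀ x → hint x < 2 ^ v₁
    hint< x = <-≤-trans (+-monoʳ-< (height (cnt p x / b) * b) (m%n<n (cnt p x) b))
      (≤-trans (≤-reflexive (+-comm (height (cnt p x / b) * b) b)) (≤-trans (*-monoˡ-≤ b (s≤s (least≤ _ l))) v₁-ok))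

    A₁ A₂ A₃ A₄ A₅ A₆ encoding : List Bool
    A₁ = bits ω nD
    A₂ = arr r (λ i → low (sel p m i) r) n
    A₃ = enc k occupied
    A₄ = enc n starts
    A₅ = H.enc e Z hint cntZ
    A₆ = L.enc p h
    encoding = A₁ ++ A₂ ++ A₃ ++ A₄ ++ A₅ ++ A₆

    length-A₃ : length A₃ ≡ len k nD
    length-A₃ = length-enc k occupied fitsk

    length-A₄ : length A₄ ≡ len n nD
    length-A₄ = trans (length-enc n starts fitsn) (cong (len n) cntStarts)

    length-encoding : length encoding ≡ ω + (n * r + (len k nD + (len n nD + (len₁ e + len₂))))
    length-encoding = trans (length-++ A₁) (cong₂ _+_ (length-bits ω nD) (trans (length-++ A₂) (cong₂ _+_ (length-arr r _ n)
      (trans (length-++ A₃) (cong₂ _+_ length-A₃ (trans (length-++ A₄) (cong₂ _+_ length-A₄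
      (trans (length-++ A₅) (cong₂ _+_ (H.length-enc e Z hint cntZ) (L.length-enc p h))))))))))

    cell≡shr : ∀ x → p x ≡ true → x < m → cellOf (cnt p x) ≡ shr x r
    cell≡shr x px lx = cellOf-≡ (cnt p x) (shr x r) (cnt-mono p (≤-trans (m⊓n≤m _ m) (shr-lower x r))) (cnt-< p px (⊓-glb (shr-upper x r) lx))

    module Exec (mem : Memory) (at : At mem 0 encoding) where

      at₂ : At mem o₁ (A₂ ++ A₃ ++ A₄ ++ A₅ ++ A₆)
      at₂ = subst (λ z → At mem z (A₂ ++ A₃ ++ A₄ ++ A₅ ++ A₆)) (length-bits ω nD) (At-++ʳ A₁ at)
      at₃ : At mem o₂ (A₃ ++ A₄ ++ A₅ ++ A₆)
      at₃ = subst (λ z → At mem (o₁ + z) (A₃ ++ A₄ ++ A₅ ++ A₆)) (length-arr r _ n) (At-++ʳ A₂ at₂)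
      at₄ : At mem (o₃ nD) (A₄ ++ A₅ ++ A₆)
      at₄ = subst (λ z → At mem (o₂ + z) (A₄ ++ A₅ ++ A₆)) length-A₃ (At-++ʳ A₃ at₃)
      at₅ : At mem (o₄ nD) (A₅ ++ A₆)
      at₅ = subst (λ z → At mem (o₃ nD + z) (A₅ ++ A₆)) length-A₄ (At-++ʳ A₄ at₄)
      at₆ : At mem (o₅ nD) A₆
      at₆ = subst (λ z → At mem (o₄ nD + z) A₆) (H.length-enc e Z hint cntZ) (At-++ʳ A₅ at₅)

      read-nD : exec mem (rdN {W} 0 ω) ≡ nD
      read-nD = exec-rdN 0 ω nD (At-++ˡ A₁ at) (≤-trans (s≤s nD≤n) (n≤2^⌈log₂n⌉ (suc n))) ω≤W

      rank-starts : ∀ x → x ≤ n → exec mem (rankQ n nD (o₃ nD) x) ≡ cnt starts x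
      rank-starts x l = trans (cong (λ z → exec mem (rankQ n z (o₃ nD) x)) (sym cntStarts)) (exec-rankQ n starts (o₃ nD) x fitsn l (At-++ˡ A₄ at₄))

      sel-starts' : ∀ i → i < nD → exec mem (selQ n nD (o₃ nD) i) ≡ sel starts n i
      sel-starts' i l = trans (cong (λ z → exec mem (selQ n z (o₃ nD) i)) (sym cntStarts))
        (exec-selQ n starts (o₃ nD) i fitsn (subst (i <_) (sym cntStarts) l) (At-++ˡ A₄ at₄))

      exec-selD : ∀ i → i < n → exec mem (selD nD i) ≡ sel p m i
      exec-selD i il = exec-bind mem (rankQ n nD (o₃ nD) (suc i)) k₁ (rank-starts (suc i) il)
        (exec-bind mem (selQ k nD o₂ (cnt starts (suc i) ∸ 1)) k₂ (trans (exec-selQ k occupied o₂ _ fitsk idx< (At-++ˡ A₃ at₃)) (sel-occupied i il'))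
        (exec-bind mem (rdN (o₁ + i * r) r) (k₃ (cellOf i)) (exec-rdN _ r (low x r) (At-arr r (λ i → low (sel p m i) r) n i (At-++ˡ A₂ at₂) il) (low< x r) r≤W)
        (trans (cong (λ c → c * 2 ^ r + low x r) cell') (m+[n∸m]≡n (shr-lower x r)))))
        where
        x = sel p m i
        il' : i < cnt p m
        il' = subst (i <_) (sym h) il
        cell' : cellOf i ≡ shr x r
        cell' = trans (cong cellOf (sym (cnt-sel p m i il'))) (cell≡shr x (sel-∈ p m i il') (sel-< p m i il'))
        idx< : cnt starts (suc i) ∸ 1 < nD
        idx< = subst (_< nD) (cong (_∸ 1) (sym (cnt-starts-suc i il'))) (cnt-< occupied (cellOf-occupied i il') (proj₁ (cellOf-spec i il')))
        k₃ : ℕ → ℕ → Prog W ℕ 0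
        k₃ c lo = ret (c * 2 ^ r + lo)
        k₂ : ℕ → Prog W ℕ (1 + 0)
        k₂ c = rdN (o₁ + i * r) r >>= k₃ c
        k₁ : ℕ → Prog W ℕ (selCost + (1 + 0))
        k₁ j = selQ k nD o₂ (j ∸ 1) >>= k₂

      exec-selectP : ∀ i → i < n → exec mem (selectP i) ≡ sel p m i
      exec-selectP i il = exec-bind mem (rdN 0 ω) (λ d → selD d i) read-nD (exec-selD i il)

      result : ℕ → Maybe ℕ
      result x = if p x then just (cnt p x) else nothing

      verify-hit : ∀ x → p x ≡ true → x < m → exec mem (verify nD x (cnt p x)) ≡ result x
      verify-hit x px lx = exec-bind mem (selD nD (cnt p x)) (λ y → ret (accept x (cnt p x) y)) (trans (exec-selD _ i<n) (sel-cnt p m x px lx)) good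
        where
        i<n : cnt p x < n
        i<n = subst (cnt p x <_) h (cnt-< p px lx)
        good : accept x (cnt p x) x ≡ result x
        good rewrite <ᵇ-true i<n | ≡ᵇ-true {x} refl | px = refl

      verify-cases : ∀ x i → exec mem (verify nD x i) ≡ nothing ⊎ exec mem (verify nD x i) ≡ result x
      verify-cases x i with i <? n
      -- For `i ≥ n` the selection may return anything; the comparison with `n` in `accept` discards
      -- it.
      ... | no q = inj₁ (exec-bind mem (selD nD i) (λ y → ret (accept x i y)) refl (cong (λ t → if t ∧ (exec mem (selD nD i) ≡ᵇ x) then just i else nothing) (<ᵇ-false (≮⇒≥ q))))
      ... | yes q with sel p m i ≟ x
      ...   | no ne = inj₁ (exec-bind mem (selD nD i) (λ y → ret (accept x i y)) (exec-selD i q) no-match)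
        where
        no-match : accept x i (sel p m i) ≡ nothing
        no-match rewrite ≡ᵇ-false ne | ∧-zeroʳ (i <ᵇ n) = refl
      ...   | yes refl = inj₂ (trans (cong (λ j → exec mem (verify nD x j)) (sym (cnt-sel p m i i<))) (verify-hit x (sel-∈ p m i i<) (sel-< p m i i<)))
        where
        i< : i < cnt p m
        i< = subst (i <_) (sym h) q

      combine : ∀ {u v w : Maybe ℕ} → u ≡ nothing ⊎ u ≡ w → v ≡ nothing ⊎ v ≡ w → (w ≡ nothing ⊎ (u ≡ w ⊎ v ≡ w)) → (u <∣> v) ≡ w
      combine (inj₁ refl) (inj₁ refl) (inj₁ refl) = refl
      combine (inj₁ refl) (inj₁ refl) (inj₂ (inj₁ refl)) = refl
      combine (inj₁ refl) (inj₁ refl) (inj₂ (inj₂ refl)) = refl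
      combine (inj₁ refl) (inj₂ refl) _ = refl
      combine {just _} (inj₂ refl) _ _ = refl
      combine {nothing} (inj₂ refl) (inj₁ refl) _ = refl
      combine {nothing} (inj₂ refl) (inj₂ refl) _ = refl

      module Rank (x : ℕ) (lx : x < m) where
        c i₁ g j : ℕ
        c = exec mem (rankQ k nD o₂ (shr x r))
        i₁ = exec mem (selQ n nD (o₃ nD) c)
        g = exec mem (H.query e (o₄ nD) x)
        j = exec mem (L.query (o₅ nD) (g / b) x)
        a₁ a₂ : Maybe ℕ
        a₁ = exec mem (verify nD x i₁)
        a₂ = exec mem (verify nD x (j * b + g % b))

        k₇ : Maybe ℕ → Maybe ℕ → Prog W (Maybe ℕ) 0
        k₇ a₁ a₂ = ret (a₁ <∣> a₂)
        k₆ : ℕ → ℕ → Maybe ℕ → ℕ → Prog W (Maybe ℕ) ((selDCost + 0) + 0)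
        k₆ d g a₁ j = verify d x (j * b + g % b) >>= k₇ a₁
        k₅ : ℕ → Maybe ℕ → ℕ → Prog W (Maybe ℕ) (c₂ + ((selDCost + 0) + 0))
        k₅ d a₁ g = L.query (o₅ d) (g / b) x >>= k₆ d g a₁
        k₄ : ℕ → Maybe ℕ → Prog W (Maybe ℕ) (c₁ + (c₂ + ((selDCost + 0) + 0)))
        k₄ d a₁ = H.query (n ∸ d) (o₄ d) x >>= k₅ d a₁
        k₃ : ℕ → ℕ → Prog W (Maybe ℕ) ((selDCost + 0) + (c₁ + (c₂ + ((selDCost + 0) + 0))))
        k₃ d i = verify d x i >>= k₄ d
        k₂ : ℕ → ℕ → Prog W (Maybe ℕ) (selCost + ((selDCost + 0) + (c₁ + (c₂ + ((selDCost + 0) + 0)))))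
        k₂ d c = selQ n d (o₃ d) c >>= k₃ d
        k₁ : ℕ → Prog W (Maybe ℕ) (rankCost + (selCost + ((selDCost + 0) + (c₁ + (c₂ + ((selDCost + 0) + 0))))))
        k₁ d = rankQ k d o₂ (shr x r) >>= k₂ d

        unfold : exec mem (rankP x) ≡ (a₁ <∣> a₂)
        unfold = exec-bind mem (rdN 0 ω) k₁ read-nD (exec-bind mem (rankQ k nD o₂ (shr x r)) (k₂ nD) refl (exec-bind mem (selQ n nD (o₃ nD) c) (k₃ nD) refl
          (exec-bind mem (verify nD x i₁) (k₄ nD) refl (exec-bind mem (H.query e (o₄ nD) x) (k₅ nD a₁) refl
          (exec-bind mem (L.query (o₅ nD) (g / b) x) (k₆ nD g a₁) refl (exec-bind mem (verify nD x (j * b + g % b)) (k₇ a₁) refl refl))))))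

        i₁-correct : p x ≡ true → starts (cnt p x) ≡ true → i₁ ≡ cnt p x
        i₁-correct px st = trans (cong (λ z → exec mem (selQ n nD (o₃ nD) z)) c≡) (trans (sel-starts' (cnt occupied cell') (cnt-< occupied occ cell'<k))
          (trans (cong (λ z → sel starts z (cnt occupied cell')) (sym h)) (trans (sel-starts cell' occ) (≡ᵇ-true⁻¹ st))))
          where
          cell' = cellOf (cnt p x)
          i< : cnt p x < cnt p m
          i< = cnt-< p px lx
          occ = cellOf-occupied (cnt p x) i<
          cell'<k = proj₁ (cellOf-spec (cnt p x) i<)
          c≡ : c ≡ cnt occupied cell'
          c≡ = trans (cong (λ z → exec mem (rankQ k nD o₂ z)) (sym (cell≡shr x px lx))) (exec-rankQ k occupied o₂ cell' fitsk (<⇒≤ cell'<k) (At-++ˡ A₃ at₃))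

        i₂-correct : p x ≡ true → starts (cnt p x) ≡ false → j * b + g % b ≡ cnt p x
        i₂-correct px st = trans (cong₂ (λ u v → u * b + v) j≡ (trans (cong (_% b) g≡) hint%)) (trans (+-comm (cnt p x / b * b) _) (sym (m≡m%n+[m/n]*n (cnt p x) b)))
          where
          t = height (cnt p x / b)
          inZ : Z x ≡ true
          inZ rewrite px | st = refl
          g≡ : g ≡ hint x
          g≡ = H.exec-query e Z hint cntZ (o₄ nD) x hint< inZ lx (At-++ˡ A₅ at₅)
          hint≡ : hint x ≡ cnt p x % b + t * b
          hint≡ = +-comm (t * b) _
          hint% : hint x % b ≡ cnt p x % b
          hint% = trans (cong (_% b) hint≡) (trans ([m+kn]%n≡m%n (cnt p x % b) t b) (m<n⇒m%n≡m (m%n<n (cnt p x) b)))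
          hint/ : hint x / b ≡ t
          hint/ = trans (cong (_/ b) hint≡) (trans (+-distrib-/-∣ʳ (cnt p x % b) (divides t refl)) (cong₂ _+_ (m<n⇒m/n≡0 (m%n<n (cnt p x) b)) (m*n/n≡m t b)))
          j≡ : j ≡ cnt p x / b
          j≡ = trans (cong (λ z → exec mem (L.query (o₅ nD) z x)) (trans (cong (_/ b) g≡) hint/)) (L.exec-query p h (o₅ nD) x px lx at₆)

        found : result x ≡ nothing ⊎ (a₁ ≡ result x ⊎ a₂ ≡ result x)
        found with p x in px
        ... | false = inj₁ refl
        ... | true with starts (cnt p x) in st
        ...   | true = inj₂ (inj₁ (trans (cong (λ z → exec mem (verify nD x z)) (i₁-correct px st)) (trans (verify-hit x px lx) (cong (λ t → if t then just (cnt p x) else nothing) px))))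
        ...   | false = inj₂ (inj₂ (trans (cong (λ z → exec mem (verify nD x z)) (i₂-correct px st)) (trans (verify-hit x px lx) (cong (λ t → if t then just (cnt p x) else nothing) px))))

      exec-rankP : ∀ x → x < m → exec mem (rankP x) ≡ result x
      exec-rankP x lx = trans unfold (combine (verify-cases x i₁) (verify-cases x (j * b + g % b)) found)
        where open Rank x lx

-- Parameters

-- β^D bounds the ratio of universe to set size in the dictionaries, β^Δ is the block size, K a the width of the
-- table entries of a trie, and c₀ bounds all constants to be absorbed by a factor β = 2^a.
abstract
  D Δ K c₀ : ℕ
  D = 59
  Δ = 66
  K = 70
  c₀ = 20000

  Δ≡7+D : Δ ≡ 7 + D
  Δ≡7+D = refl

  K≡4+Δ : K ≡ 4 + Δ
  K≡4+Δ = refl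

  D≡59 : D ≡ 59
  D≡59 = refl

  4ΔK≤c₀ : 4 * (Δ * K) ≤ c₀
  4ΔK≤c₀ = ≤ᵇ⇒≤ (4 * (Δ * K)) c₀ tt

  1000≤c₀ : 1000 ≤ c₀
  1000≤c₀ = ≤ᵇ⇒≤ 1000 c₀ tt

1≤Δ : 1 ≤ Δ
1≤Δ = subst (1 ≤_) (sym Δ≡7+D) (s≤s z≤n)

1≤K : 1 ≤ K
1≤K = subst (1 ≤_) (sym K≡4+Δ) (s≤s z≤n)

-- `β * θ = β ^ 4 ≤ l` lets a leaf of `θ = β ^ 3` elements, at most `a * Δ ≤ β` bits each, be read
-- at once. The upper bound turns a word of order `l` into `β ^ 5`, and `big` lets one factor `β`
-- absorb constants as well as `a`, the logarithm of `β`.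
module Params (a l : ℕ) (big : c₀ * suc a ≤ 2 ^ a) (l-lower : (2 ^ a) ^ 4 ≤ l) (l-upper : l + 3 ≤ (2 ^ a) ^ 5) where

  β : ℕ
  β = 2 ^ a

  1≤β : 1 ≤ β
  1≤β = 2^-pos a

  instance
    β-nonZero : NonZero β
    β-nonZero = >-nonZero 1≤β

  c₀≤β : c₀ ≤ β
  c₀≤β = ≤-trans (m≤m*n c₀ (suc a)) big

  const≤β : ∀ c → {T (c ≤ᵇ 1000)} → c ≤ β
  const≤β c {t} = ≤-trans (≤ᵇ⇒≤ c 1000 t) (≤-trans 1000≤c₀ c₀≤β)

  β^-pos : ∀ i → 1 ≤ β ^ i
  β^-pos i = m^n>0 β i

  β^-mono : ∀ {i j} → i ≤ j → β ^ i ≤ β ^ j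
  β^-mono = ^-monoʳ-≤ β

  const*a≤β : ∀ c → {T (c ≤ᵇ 1000)} → c * suc a ≤ β
  const*a≤β c {t} = ≤-trans (*-monoˡ-≤ (suc a) (≤-trans (≤ᵇ⇒≤ c 1000 t) 1000≤c₀)) big

  4ΔKa≤β : 4 * (Δ * (K * suc a)) ≤ β
  4ΔKa≤β = ≤-trans (≤-reflexive (e Δ K (suc a))) (≤-trans (*-monoˡ-≤ (suc a) 4ΔK≤c₀) big)
    where
    e : ∀ x y z → 4 * (x * (y * z)) ≡ 4 * (x * y) * z
    e = solve-∀

  κ κ' θ λt : ℕ
  κ = K * a
  κ' = suc β * κ + β * κ + β
  θ = β ^ 3
  λt = 4 * l

  1≤θ : 1 ≤ θ
  1≤θ = β^-pos 3

  κ'≤ : κ' ≤ β * (4 * (K * suc a))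
  κ'≤ = begin
    κ + β * κ + β * κ + β                ≤⟨ +-mono-≤ (+-monoˡ-≤ (β * κ) (+-monoˡ-≤ (β * κ) (m≤n*m κ β))) (m≤m*n β K' {{>-nonZero 1≤K'}}) ⟩
    β * κ + β * κ + β * κ + β * K'       ≤⟨ +-monoˡ-≤ (β * K') (+-mono-≤ (+-mono-≤ le le) le) ⟩
    β * K' + β * K' + β * K' + β * K'    ≡⟨ e β K' ⟩
    β * (4 * K')                         ∎
    where
    open ≤-Reasoning
    K' = K * suc a
    1≤K' : 1 ≤ K'
    1≤K' = *-mono-≤ 1≤K (s≤s {0} {a} z≤n)
    le : β * κ ≤ β * K'
    le = *-monoʳ-≤ β (*-monoʳ-≤ K (n≤1+n a))
    e : ∀ x y → x * y + x * y + x * y + x * y ≡ x * (4 * y)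
    e = solve-∀

  -- Tables cost an element its share of `Δ * κ'` bits, divided among more than `θ = β ^ 3`
  -- elements. The quotient `1 / β` is the redundancy per element inside the tries.
  Δκ'≤β² : Δ * κ' ≤ β * β
  Δκ'≤β² = begin
    Δ * κ'                         ≤⟨ *-monoʳ-≤ Δ κ'≤ ⟩
    Δ * (β * (4 * (K * suc a)))    ≡⟨ e Δ β (K * suc a) ⟩
    β * (4 * (Δ * (K * suc a)))    ≤⟨ *-monoʳ-≤ β 4ΔKa≤β ⟩
    β * β                          ∎
    where
    open ≤-Reasoning
    e : ∀ x y z → x * (y * (4 * z)) ≡ y * (4 * (x * z))
    e = solve-∀

  β²≤l : β * β ≤ l
  β²≤l = ≤-trans (≤-reflexive (sym (cong (β *_) (*-identityʳ β)))) (≤-trans (β^-mono {2} {4} (s≤s (s≤s z≤n))) l-lower)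

  l≤4l : l ≤ 4 * l
  l≤4l = m≤m+n l _

  table≤W : suc β * κ ≤ 4 * l
  table≤W = begin
    suc β * κ   ≤⟨ ≤-trans (m≤m+n _ (β * κ)) (m≤m+n _ β) ⟩
    κ'          ≤⟨ m≤n*m κ' Δ {{>-nonZero 1≤Δ}} ⟩
    Δ * κ'      ≤⟨ Δκ'≤β² ⟩
    β * β       ≤⟨ β²≤l ⟩
    l           ≤⟨ l≤4l ⟩
    4 * l       ∎
    where open ≤-Reasoning

  leaf≤W : ∀ u s → u ≤ β ^ Δ → s ≤ θ → ⌈log₂ bin u s ⌉ ≤ 4 * l
  leaf≤W u s ul sl = ≤-trans (⌈log₂⌉-least (a * Δ * θ) (begin
    bin u s              ≤⟨ bin≤n^k u s ⟩
    u ^ s                ≤⟨ ^-monoˡ-≤ s ul ⟩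
    (β ^ Δ) ^ s          ≤⟨ ^-monoʳ-≤ (β ^ Δ) {{m^n≢0 β Δ}} sl ⟩
    (β ^ Δ) ^ θ          ≡⟨ cong (_^ θ) (^-*-assoc 2 a Δ) ⟩
    (2 ^ (a * Δ)) ^ θ    ≡⟨ ^-*-assoc 2 (a * Δ) θ ⟩
    2 ^ (a * Δ * θ)      ∎)) (begin
    a * Δ * θ            ≤⟨ *-monoˡ-≤ θ aΔ≤β ⟩
    β * θ                ≤⟨ l-lower ⟩
    l                    ≤⟨ l≤4l ⟩
    4 * l                ∎)
    where
    open ≤-Reasoning
    aΔ≤β : a * Δ ≤ β
    aΔ≤β = begin
      a * Δ                       ≡⟨ *-comm a Δ ⟩
      Δ * a                       ≤⟨ *-monoʳ-≤ Δ (≤-trans (n≤1+n a) (m≤n*m (suc a) K {{>-nonZero 1≤K}})) ⟩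
      Δ * (K * suc a)             ≤⟨ m≤m+n _ _ ⟩
      4 * (Δ * (K * suc a))       ≤⟨ 4ΔKa≤β ⟩
      β                           ∎

  fits : β ^ Δ + (θ + β ^ Δ * (Δ * κ')) < 2 ^ κ
  fits = begin-strict
    β ^ Δ + (θ + β ^ Δ * (Δ * κ'))                    ≤⟨ +-mono-≤ (m≤m*n (β ^ Δ) θ {{>-nonZero 1≤θ}}) (+-mono-≤ (m≤n*m θ (β ^ Δ) {{m^n≢0 β Δ}}) (*-monoʳ-≤ (β ^ Δ) (≤-trans Δκ'≤β² β²≤θ))) ⟩
    β ^ Δ * θ + (β ^ Δ * θ + β ^ Δ * θ)               ≡⟨ e (β ^ Δ) θ ⟩
    β ^ Δ * (3 * θ)                                   <⟨ *-monoʳ-< (β ^ Δ) {{m^n≢0 β Δ}} (*-monoˡ-< θ {{>-nonZero 1≤θ}} (const≤β 4)) ⟩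
    β ^ Δ * β ^ 4                                     ≡⟨ *-comm (β ^ Δ) (β ^ 4) ⟩
    β ^ 4 * β ^ Δ                                     ≡⟨ sym (^-distribˡ-+-* β 4 Δ) ⟩
    β ^ (4 + Δ)                                       ≡⟨ cong (β ^_) (sym K≡4+Δ) ⟩
    β ^ K                                             ≡⟨ ^-*-assoc 2 a K ⟩
    2 ^ (a * K)                                       ≡⟨ cong (2 ^_) (*-comm a K) ⟩
    2 ^ (K * a)                                       ∎
    where
    open ≤-Reasoning
    e : ∀ x y → x * y + (x * y + x * y) ≡ x * (3 * y)
    e = solve-∀
    β²≤θ : β * β ≤ θ
    β²≤θ = ≤-trans (≤-reflexive (sym (cong (β *_) (*-identityʳ β)))) (β^-mono {2} {3} (s≤s (s≤s z≤n)))

  open Dict (4 * l) β θ κ Δ 1≤β 1≤θ table≤W leaf≤W fits λt ≤-refl public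

  theFID : FID (4 * l)
  theFID = record { Fits = Fits ; len = fidLen ; enc = fid ; length-enc = length-fid
    ; rankCost = rankCostR ; selCost = selCostF ; rankQ = rankF ; selQ = selF ; exec-rankQ = exec-rankF ; exec-selQ = exec-selF }

  1≤l : 1 ≤ l
  1≤l = ≤-trans (β^-pos 4) l-lower

  Fits-2^2l : ∀ U → U ≤ 2 ^ (2 * l) → Fits U
  Fits-2^2l U h = begin-strict
    U + (suc U + U * (Δ * κ'))      ≤⟨ +-mono-≤ h (+-mono-≤ (≤-trans (s≤s h) (≤-reflexive (+-comm 1 P))) (*-mono-≤ h Δκ'≤β²)) ⟩
    P + (P + 1 + P * (β * β))       ≤⟨ +-monoʳ-≤ P (+-monoˡ-≤ (P * (β * β)) (+-monoʳ-≤ P (2^-pos (2 * l)))) ⟩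
    P + (P + P + P * (β * β))       ≡⟨ e P (β * β) ⟩
    P * (3 + β * β)                 ≤⟨ *-monoʳ-≤ P (+-monoˡ-≤ (β * β) (const≤β 3)) ⟩
    P * (β + β * β)                 ≤⟨ *-monoʳ-≤ P (+-monoˡ-≤ (β * β) (m≤m*n β β)) ⟩
    P * (β * β + β * β)             ≤⟨ *-monoʳ-≤ P (+-mono-≤ β²≤l β²≤l) ⟩
    P * (l + l)                     ≡⟨ cong (λ z → P * (l + z)) (sym (+-identityʳ l)) ⟩
    P * (2 * l)                     <⟨ *-monoʳ-< P {{m^n≢0 2 (2 * l)}} (m<2^m (2 * l)) ⟩
    P * P                           ≡⟨ sym (^-distribˡ-+-* 2 (2 * l) (2 * l)) ⟩
    2 ^ (2 * l + 2 * l)             ≡⟨ cong (2 ^_) (e₂ l) ⟩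
    2 ^ (4 * l)                     ∎
    where
    open ≤-Reasoning
    P = 2 ^ (2 * l)
    e : ∀ x y → x + (x + x + x * y) ≡ x * (3 + y)
    e = solve-∀
    e₂ : ∀ x → 2 * x + 2 * x ≡ 4 * x
    e₂ = solve-∀

  β*spread≤ : ∀ s → β * spread s ≤ s
  β*spread≤ s = *-cancelˡ-≤ (β * β) {{m*n≢0 β β}} (begin
    β * β * (β * spread s)   ≡⟨ e β (spread s) ⟩
    spread s * θ             ≤⟨ m/n*n≤m (s * (Δ * κ')) θ ⟩
    s * (Δ * κ')             ≤⟨ *-monoʳ-≤ s Δκ'≤β² ⟩
    s * (β * β)              ≡⟨ *-comm s (β * β) ⟩
    β * β * s                ∎)
    where
    open ≤-Reasoning
    e : ∀ x y → x * x * (x * y) ≡ y * (x * (x * (x * 1)))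
    e = solve-∀

  spread≤ : ∀ s → spread s ≤ s
  spread≤ s = ≤-trans (m≤n*m (spread s) β) (β*spread≤ s)

  -- `N` is kept apart from `s` because occupied cells may be far fewer than elements; the tables
  -- are charged to `N`. For large `U` there are at most `4 * N / β ^ 7` blocks, each with O(l) bits
  -- of tables.
  fidLen-overhead : ∀ U s N → U ≤ 2 * (N * β ^ D) → s ≤ N → ∃ λ ov → fidLen U s ≡ ⌈log₂ bin U s ⌉ + ov × β * ov ≤ β + 2 * N
  fidLen-overhead U s N ul sl with V <? U
  ... | no q = 1 + spread s , trans (if-small q) (cong (⌈log₂ bin U s ⌉ +_) (if-small q)) , (begin
      β * (1 + spread s)       ≡⟨ *-distribˡ-+ β 1 (spread s) ⟩
      β * 1 + β * spread s     ≤⟨ +-mono-≤ (≤-reflexive (*-identityʳ β)) (≤-trans (β*spread≤ s) (≤-trans sl (m≤m+n N _))) ⟩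
      β + 2 * N                ∎)
    where open ≤-Reasoning
  ... | yes q = ov , trans (if-big q) (trans (cong (λ z → λt + (kk * λt + (⌈log₂ bin U s ⌉ + z + auxLen U))) (if-big q)) (e₁ λt (kk * λt) ⌈log₂ bin U s ⌉ (topOv kk s) (auxLen U))) , bound
    where
    open ≤-Reasoning
    kk = blocks U
    ov = λt + (kk * λt + (topOv kk s + auxLen U))
    e₁ : ∀ x y z w v → x + (y + (z + w + v)) ≡ z + (x + (y + (w + v)))
    e₁ = solve-∀
    V≡ : V ≡ β ^ 7 * β ^ D
    V≡ = trans (cong (β ^_) Δ≡7+D) (^-distribˡ-+-* β 7 D)
    e₂ : ∀ x y z → x * y * z ≡ x * (y * z)
    e₂ = solve-∀
    e₃ : ∀ x y → 2 * (2 * (x * y)) ≡ 4 * x * y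
    e₃ = solve-∀
    kk≤ : kk * β ^ 7 ≤ 4 * N
    kk≤ = *-cancelʳ-≤ (kk * β ^ 7) (4 * N) (β ^ D) {{m^n≢0 β D}} (begin
      kk * β ^ 7 * β ^ D        ≡⟨ trans (e₂ kk (β ^ 7) (β ^ D)) (cong (kk *_) (sym V≡)) ⟩
      V + U / V * V             ≤⟨ +-mono-≤ (<⇒≤ q) (≤-trans (m/n*n≤m U V) (m≤m+n U 0)) ⟩
      2 * U                     ≤⟨ *-monoʳ-≤ 2 ul ⟩
      2 * (2 * (N * β ^ D))     ≡⟨ e₃ N (β ^ D) ⟩
      4 * N * β ^ D             ∎)
    e₄ : ∀ L k s₁ s₂ → L + (k * L + ((1 + k) * L + k * L + (k + s₁) + (k * L + ((1 + k) * L + k * L + (k + s₂))))) ≡ 6 * (k * L) + 3 * (1 * L) + 2 * (k * 1) + s₂ + s₁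
    e₄ = solve-∀
    e₅ : ∀ x s → 6 * x + 3 * x + 2 * x + x + s ≡ 12 * x + s
    e₅ = solve-∀
    1≤λt : 1 ≤ λt
    1≤λt = ≤-trans 1≤l l≤4l
    ov≤ : ov ≤ 12 * (kk * λt) + spread s
    ov≤ = begin
      ov                                ≡⟨ e₄ λt kk (spread s) (spread kk) ⟩
      6 * (kk * λt) + 3 * (1 * λt) + 2 * (kk * 1) + spread kk + spread s
        ≤⟨ +-monoˡ-≤ (spread s) (+-mono-≤ (+-mono-≤ (+-monoʳ-≤ (6 * (kk * λt)) (*-monoʳ-≤ 3 (*-monoˡ-≤ λt {1} {kk} (s≤s z≤n)))) (*-monoʳ-≤ 2 (*-monoʳ-≤ kk 1≤λt)))
              (≤-trans (spread≤ kk) (m≤m*n kk λt {{>-nonZero 1≤λt}}))) ⟩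
      6 * (kk * λt) + 3 * (kk * λt) + 2 * (kk * λt) + kk * λt + spread s   ≡⟨ e₅ (kk * λt) (spread s) ⟩
      12 * (kk * λt) + spread s         ∎
    e₆ : ∀ b k L → b * (12 * (k * (4 * L))) ≡ 48 * (k * (b * L))
    e₆ = solve-∀
    e₇ : ∀ b k z → b * (48 * (k * (b * z))) ≡ 48 * (k * (b * (b * z)))
    e₇ = solve-∀
    table : β * (12 * (kk * λt)) ≤ N
    table = *-cancelˡ-≤ β (begin
      β * (β * (12 * (kk * λt)))          ≡⟨ cong (β *_) (e₆ β kk l) ⟩
      β * (48 * (kk * (β * l)))           ≤⟨ *-monoʳ-≤ β (*-monoʳ-≤ 48 (*-monoʳ-≤ kk (*-monoʳ-≤ β (≤-trans (m≤m+n l 3) l-upper)))) ⟩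
      β * (48 * (kk * (β * β ^ 5)))       ≡⟨ e₇ β kk (β ^ 5) ⟩
      48 * (kk * β ^ 7)                   ≤⟨ *-monoʳ-≤ 48 kk≤ ⟩
      48 * (4 * N)                        ≡⟨ sym (*-assoc 48 4 N) ⟩
      192 * N                             ≤⟨ *-monoˡ-≤ N (const≤β 192) ⟩
      β * N                               ∎)
    bound : β * ov ≤ β + 2 * N
    bound = begin
      β * ov                                         ≤⟨ *-monoʳ-≤ β ov≤ ⟩
      β * (12 * (kk * λt) + spread s)                ≡⟨ *-distribˡ-+ β (12 * (kk * λt)) (spread s) ⟩
      β * (12 * (kk * λt)) + β * spread s            ≤⟨ +-mono-≤ table (≤-trans (β*spread≤ s) sl) ⟩
      N + N                                          ≡⟨ cong (N +_) (sym (+-identityʳ N)) ⟩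
      2 * N                                          ≤⟨ m≤n+m (2 * N) β ⟩
      β + 2 * N                                      ∎

-- Sizes of the retrieval structures

hashFamily' : ∀ q M s j → 1 ≤ q → 2 * (s * j) ≤ q → ∀ N → suc M ^ s < 2 ^ N →
  Σ (ℕ → ℕ → ℕ) λ H → (∀ t x → H t x < q) ×
    (∀ K → cnt K M ≤ s → ∃ λ t → t < N × (∀ b → b < q → suc j ^ cnt (λ x → K x ∧ (H t x ≡ᵇ b)) M ≤ 4 * q))
hashFamily' (suc q') M s j _ small N l = hashFamily q' M s j small N l

trivialRetrieval : ∀ {W M k v cost} → (∀ p → cnt p M ≡ k → ∀ x → p x ≡ true → x < M → ⊥) → Retrieval W M k v cost 0
trivialRetrieval empty = record { enc = λ _ _ _ → [] ; length-enc = λ _ _ _ → refl ; query = λ _ _ → ret 0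
  ; exec-query = λ p _ h _ x _ px lx _ → ⊥-elim (empty p h x px lx) }

-- An analogue of `C(U, e) ≤ (2.72 U / e)^e`. With `x = 2 * R`, every `R` factors `1 + 1/x` amount
-- to at most 2, hence to `4 ^ e` in all, and `x ^ e` supplies the rest.
bin-slots : ∀ R e → 1 ≤ R → bin (2 * e * R) e ≤ (8 * R) ^ e
bin-slots R e 1≤R = *-cancelʳ-≤ (bin (2 * e * R) e) ((8 * R) ^ e) (x ^ (2 * e * R)) {{m^n≢0 x (2 * e * R) {{>-nonZero 1≤x}}}} (begin
  bin (2 * e * R) e * x ^ (2 * e * R)     ≤⟨ bin*x^n≤[1+x]^n*x^e (2 * e * R) e x ⟩
  (1 + x) ^ (2 * e * R) * x ^ e           ≡⟨ cong (_* x ^ e) (trans (cong ((1 + x) ^_) (*-comm (2 * e) R)) (sym (^-*-assoc (1 + x) R (2 * e)))) ⟩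
  ((1 + x) ^ R) ^ (2 * e) * x ^ e         ≤⟨ *-monoˡ-≤ (x ^ e) (^-monoˡ-≤ (2 * e) (subst (λ z → z ^ R ≤ 2 * x ^ R) (+-comm x 1) ([q+j]^s≤2q^s x 1 R 1≤x (≤-reflexive (cong (2 *_) (*-identityʳ R)))))) ⟩
  (2 * x ^ R) ^ (2 * e) * x ^ e           ≡⟨ cong (_* x ^ e) (^-distribʳ-* (2 * e) 2 (x ^ R)) ⟩
  2 ^ (2 * e) * (x ^ R) ^ (2 * e) * x ^ e ≡⟨ cong₂ (λ u v → u * v * x ^ e) (sym (^-*-assoc 2 2 e)) (trans (^-*-assoc x R (2 * e)) (cong (x ^_) (*-comm R (2 * e)))) ⟩
  4 ^ e * x ^ (2 * e * R) * x ^ e         ≡⟨ e₁ (4 ^ e) (x ^ (2 * e * R)) (x ^ e) ⟩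
  4 ^ e * x ^ e * x ^ (2 * e * R)         ≡⟨ cong (_* x ^ (2 * e * R)) (trans (sym (^-distribʳ-* e 4 x)) (cong (_^ e) (sym (*-assoc 4 2 R)))) ⟩
  (8 * R) ^ e * x ^ (2 * e * R)           ∎)
  where
  open ≤-Reasoning
  x = 2 * R
  1≤x : 1 ≤ x
  1≤x = ≤-trans 1≤R (m≤m+n R _)
  e₁ : ∀ a b c → a * b * c ≡ a * c * b
  e₁ = solve-∀

2≤2^a⇒1≤a : ∀ a → 2 ≤ 2 ^ a → 1 ≤ a
2≤2^a⇒1≤a zero (s≤s ())
2≤2^a⇒1≤a (suc a) _ = s≤s z≤n

module Sizes (a l : ℕ) (big : c₀ * suc a ≤ 2 ^ a) (l-lower : (2 ^ a) ^ 4 ≤ l) (l-upper : l + 3 ≤ (2 ^ a) ^ 5) where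

  open Params a l big l-lower l-upper

  β≤l : β ≤ l
  β≤l = ≤-trans (m≤m*n β β) β²≤l

  1≤a : 1 ≤ a
  1≤a = 2≤2^a⇒1≤a a (const≤β 2)

  a*c≤β : ∀ c → {T (c ≤ᵇ 1000)} → a * c ≤ β
  a*c≤β c {t} = ≤-trans (≤-reflexive (*-comm a c)) (≤-trans (*-monoʳ-≤ c (n≤1+n a)) (const*a≤β c {t}))

  β^≡ : ∀ i → β ^ i ≡ 2 ^ (a * i)
  β^≡ i = ^-*-assoc 2 a i

  -- The two hash families use R = β^13 and weights 2 and β^7: a load of 2 in the second would give β^14 ≤ 4 β^13.
  τ₁ : ℕ → ℕ
  τ₁ k = ⌈log₂ suc (2 * l * k) ⌉

  τ₂ lm R : ℕ
  τ₂ = a * 11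
  lm = l + 3
  R = β ^ 13

  retCost : ℕ
  retCost = 1 + (1 + (rankCostR + 1))

  retLen : ℕ → ℕ → ℕ
  retLen k v = τ₁ k + (2 * k * τ₂ + (k * v + fidLen (2 * k * R) k))

  [1+M]^k< : ∀ M k → suc M ≤ 2 ^ (2 * l) → suc M ^ k < 2 ^ suc (2 * l * k)
  [1+M]^k< M k h = ≤-<-trans (≤-trans (^-monoˡ-≤ k h) (≤-reflexive (^-*-assoc 2 (2 * l) k))) (^-monoʳ-< 2 (s≤s (s≤s z≤n)) (n<1+n (2 * l * k)))

  τ₁≤W : ∀ k → 1 ≤ k → k ≤ 2 ^ l → τ₁ k ≤ 4 * l
  τ₁≤W k 1≤k k≤ = ⌈log₂⌉-least (4 * l) (begin
    suc (2 * l * k)           ≤⟨ +-monoˡ-≤ (2 * l * k) 1≤k ⟩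
    suc (2 * l) * k           ≤⟨ *-mono-≤ (m<2^m (2 * l)) (≤-trans k≤ (^-monoʳ-≤ 2 (m≤m+n l (1 * l)))) ⟩
    2 ^ (2 * l) * 2 ^ (2 * l) ≡⟨ sym (^-distribˡ-+-* 2 (2 * l) (2 * l)) ⟩
    2 ^ (2 * l + 2 * l)       ≡⟨ cong (2 ^_) (e l) ⟩
    2 ^ (4 * l)               ∎)
    where
    open ≤-Reasoning
    e : ∀ x → 2 * x + 2 * x ≡ 4 * x
    e = solve-∀

  slots-fit : ∀ k → k ≤ 2 ^ l → Fits (2 * k * R)
  slots-fit k h = Fits-2^2l (2 * k * R) (begin
    2 * k * R               ≡⟨ e k R ⟩
    k * (2 * R)             ≤⟨ *-mono-≤ h le ⟩
    2 ^ l * 2 ^ l           ≡⟨ sym (^-distribˡ-+-* 2 l l) ⟩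
    2 ^ (l + l)             ≡⟨ cong (λ z → 2 ^ (l + z)) (sym (+-identityʳ l)) ⟩
    2 ^ (2 * l)             ∎)
    where
    open ≤-Reasoning
    e : ∀ k R → 2 * k * R ≡ k * (2 * R)
    e = solve-∀
    le : 2 * R ≤ 2 ^ l
    le = begin
      2 * R             ≤⟨ *-monoˡ-≤ R (const≤β 2) ⟩
      β ^ 14            ≡⟨ β^≡ 14 ⟩
      2 ^ (a * 14)      ≤⟨ ^-monoʳ-≤ 2 (≤-trans (a*c≤β 14) β≤l) ⟩
      2 ^ l             ∎

  mkRetrieval : ∀ M k v → suc M ≤ 2 ^ (2 * l) → 1 ≤ k → k ≤ 2 ^ l → v ≤ 4 * l → Retrieval (4 * l) M k v retCost (retLen k v)
  mkRetrieval M k v M< 1≤k k≤ v≤ = retrieval theFID M k v (2 * k) (τ₁ k) R τ₂ lm H₁ H₁< good₁ H₂ H₂< good₂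
      (slots-fit k k≤) (τ₁≤W k 1≤k k≤) (≤-trans (a*c≤β 11) (≤-trans β≤l l≤4l)) v≤
    where
    open ≤-Reasoning
    fam₁ = hashFamily' (2 * k) M k 1 (≤-trans 1≤k (m≤m+n k _)) (≤-reflexive (cong (2 *_) (*-identityʳ k))) (suc (2 * l * k)) ([1+M]^k< M k M<)
    H₁ = proj₁ fam₁
    H₁< = proj₁ (proj₂ fam₁)
    good₁ : ∀ K → cnt K M ≤ k → ∃ λ t → t < 2 ^ τ₁ k × (∀ b → b < 2 * k → cnt (λ x → K x ∧ (H₁ t x ≡ᵇ b)) M ≤ lm)
    good₁ K h with proj₂ (proj₂ fam₁) K h
    ... | t , t< , ok = t , <-≤-trans t< (n≤2^⌈log₂n⌉ _) , λ b b< → 2^-cancel-≤ (begin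
      2 ^ cnt (λ x → K x ∧ (H₁ t x ≡ᵇ b)) M   ≤⟨ ok b b< ⟩
      4 * (2 * k)                             ≡⟨ e k ⟩
      k * 8                                   ≤⟨ *-monoˡ-≤ 8 k≤ ⟩
      2 ^ l * 2 ^ 3                           ≡⟨ sym (^-distribˡ-+-* 2 l 3) ⟩
      2 ^ (l + 3)                             ∎)
      where
      e : ∀ k → 4 * (2 * k) ≡ k * 8
      e = solve-∀
    j = pred (β ^ 7)
    suc-j : suc j ≡ β ^ 7
    suc-j = suc-pred (β ^ 7) {{m^n≢0 β 7}}
    small : 2 * (lm * j) ≤ R
    small = begin
      2 * (lm * j)             ≤⟨ *-mono-≤ (const≤β 2) (*-mono-≤ l-upper (≤-trans (n≤1+n j) (≤-reflexive suc-j))) ⟩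
      β * (β ^ 5 * β ^ 7)      ≡⟨ cong (β *_) (sym (^-distribˡ-+-* β 5 7)) ⟩
      R                        ∎
    fam₂ = hashFamily' R M lm j (β^-pos 13) small (suc (2 * l * lm)) ([1+M]^k< M lm M<)
    H₂ = proj₁ fam₂
    H₂< = proj₁ (proj₂ fam₂)
    T₂≤ : suc (2 * l * lm) ≤ 2 ^ τ₂
    T₂≤ = begin
      suc (2 * l * lm)                   ≤⟨ +-mono-≤ (β^-pos 10) (≤-reflexive (*-assoc 2 l lm)) ⟩
      β ^ 10 + 2 * (l * lm)              ≤⟨ +-monoʳ-≤ (β ^ 10) (*-monoʳ-≤ 2 (*-mono-≤ (≤-trans (m≤m+n l 3) l-upper) l-upper)) ⟩
      β ^ 10 + 2 * (β ^ 5 * β ^ 5)       ≡⟨ cong (λ z → β ^ 10 + 2 * z) (sym (^-distribˡ-+-* β 5 5)) ⟩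
      3 * β ^ 10                         ≤⟨ *-monoˡ-≤ (β ^ 10) (const≤β 3) ⟩
      β ^ 11                             ≡⟨ β^≡ 11 ⟩
      2 ^ (a * 11)                       ∎
    good₂ : ∀ K → cnt K M ≤ lm → ∃ λ t → t < 2 ^ τ₂ × (∀ b → b < R → cnt (λ x → K x ∧ (H₂ t x ≡ᵇ b)) M ≤ 1)
    good₂ K h with proj₂ (proj₂ fam₂) K h
    ... | t , t< , ok = t , <-≤-trans t< T₂≤ , λ b b< → s≤s⁻¹ (≰⇒> (λ two → <⇒≱ (*-monoˡ-< (β ^ 13) {{m^n≢0 β 13}} (const≤β 5)) (begin
      β ^ 14                                        ≡⟨ sym (^-*-assoc β 7 2) ⟩
      (β ^ 7) ^ 2                                   ≤⟨ ^-monoʳ-≤ (β ^ 7) {{m^n≢0 β 7}} two ⟩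
      (β ^ 7) ^ cnt (λ x → K x ∧ (H₂ t x ≡ᵇ b)) M   ≡⟨ cong (_^ cnt (λ x → K x ∧ (H₂ t x ≡ᵇ b)) M) (sym suc-j) ⟩
      suc j ^ cnt (λ x → K x ∧ (H₂ t x ≡ᵇ b)) M     ≤⟨ ok b b< ⟩
      4 * β ^ 13                                    ∎)))

  τ₁≤ : ∀ k → 1 ≤ k → τ₁ k ≤ k * (a * 7)
  τ₁≤ k 1≤k = ≤-trans (⌈log₂⌉-least (a * 6 + k) (begin
    suc (2 * l * k)             ≤⟨ +-monoˡ-≤ (2 * l * k) 1≤k ⟩
    suc (2 * l) * k             ≤⟨ *-mono-≤ 2l+1≤ (<⇒≤ (m<2^m k)) ⟩
    β ^ 6 * 2 ^ k               ≡⟨ cong (_* 2 ^ k) (β^≡ 6) ⟩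
    2 ^ (a * 6) * 2 ^ k         ≡⟨ sym (^-distribˡ-+-* 2 (a * 6) k) ⟩
    2 ^ (a * 6 + k)             ∎)) (begin
    a * 6 + k                   ≤⟨ +-mono-≤ (m≤n*m (a * 6) k {{>-nonZero 1≤k}}) (m≤m*n k a {{>-nonZero 1≤a}}) ⟩
    k * (a * 6) + k * a         ≡⟨ e k a ⟩
    k * (a * 7)                 ∎)
    where
    open ≤-Reasoning
    e : ∀ k a → k * (a * 6) + k * a ≡ k * (a * 7)
    e = solve-∀
    2l+1≤ : suc (2 * l) ≤ β ^ 6
    2l+1≤ = begin
      suc (2 * l)         ≤⟨ +-monoˡ-≤ (2 * l) 1≤l ⟩
      3 * l               ≤⟨ *-mono-≤ (const≤β 3) (≤-trans (m≤m+n l 3) l-upper) ⟩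
      β ^ 6               ∎

  13≤D : 13 ≤ D
  13≤D = subst (13 ≤_) (sym D≡59) (≤ᵇ⇒≤ 13 59 tt)

  -- The slots have ratio `2 * β ^ 13`, within the `2 * β ^ D` allowed by `fidLen-overhead`. `14 a`
  -- bits per key come from the coefficient, since `8 * R ≤ β ^ 14`, and `2 a` cover the redundancy.
  fidLen-slots : ∀ k → 1 ≤ k → fidLen (2 * k * R) k ≤ k * (a * 16)
  fidLen-slots k 1≤k with fidLen-overhead (2 * k * R) k k (≤-trans (≤-reflexive (*-assoc 2 k R)) (*-monoʳ-≤ 2 (*-monoʳ-≤ k (β^-mono 13≤D)))) ≤-refl
  ... | ov , len≡ , ov≤ = begin
    fidLen (2 * k * R) k                    ≡⟨ len≡ ⟩
    ⌈log₂ bin (2 * k * R) k ⌉ + ov          ≤⟨ +-mono-≤ (⌈log₂⌉-least (k * (a * 14)) logs) small ⟩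
    k * (a * 14) + k * (a * 2)              ≡⟨ e k a ⟩
    k * (a * 16)                            ∎
    where
    open ≤-Reasoning
    e : ∀ k a → k * (a * 14) + k * (a * 2) ≡ k * (a * 16)
    e = solve-∀
    logs : bin (2 * k * R) k ≤ 2 ^ (k * (a * 14))
    logs = begin
      bin (2 * k * R) k         ≤⟨ bin-slots R k (β^-pos 13) ⟩
      (8 * R) ^ k               ≤⟨ ^-monoˡ-≤ k (*-monoˡ-≤ R (const≤β 8)) ⟩
      (β ^ 14) ^ k              ≡⟨ cong (_^ k) (β^≡ 14) ⟩
      (2 ^ (a * 14)) ^ k        ≡⟨ ^-*-assoc 2 (a * 14) k ⟩
      2 ^ (a * 14 * k)          ≡⟨ cong (2 ^_) (*-comm (a * 14) k) ⟩
      2 ^ (k * (a * 14))        ∎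
    small : ov ≤ k * (a * 2)
    small = ≤-trans (*-cancelˡ-≤ β (begin
      β * ov               ≤⟨ ov≤ ⟩
      β + 2 * k            ≤⟨ +-mono-≤ (m≤m*n β k {{>-nonZero 1≤k}}) (*-monoˡ-≤ k (const≤β 2)) ⟩
      β * k + β * k        ≡⟨ sym (*-distribˡ-+ β k k) ⟩
      β * (k + k)          ∎)) (begin
      k + k                ≡⟨ e₁ k ⟩
      k * (1 * 2)          ≤⟨ *-monoʳ-≤ k (*-monoˡ-≤ 2 1≤a) ⟩
      k * (a * 2)          ∎)
      where
      e₁ : ∀ k → k + k ≡ k * (1 * 2)
      e₁ = solve-∀

  -- Per key: `7 a` bits towards the index of the bucket function, `22 a` for two buckets with an
  -- index of `11 a` bits each, `16 a` for the slot dictionary, and the value. These add up to 45.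
  retLen≤ : ∀ k v → 1 ≤ k → retLen k v ≤ k * (a * 45 + v)
  retLen≤ k v 1≤k = begin
    τ₁ k + (2 * k * (a * 11) + (k * v + fidLen (2 * k * R) k))       ≤⟨ +-mono-≤ (τ₁≤ k 1≤k) (+-monoʳ-≤ (2 * k * (a * 11)) (+-monoʳ-≤ (k * v) (fidLen-slots k 1≤k))) ⟩
    k * (a * 7) + (2 * k * (a * 11) + (k * v + k * (a * 16)))        ≡⟨ e k a v ⟩
    k * (a * 45 + v)                                                 ∎
    where
    open ≤-Reasoning
    e : ∀ k a v → k * (a * 7) + (2 * k * (a * 11) + (k * v + k * (a * 16))) ≡ k * (a * 45 + v)
    e = solve-∀

  -- Hints are below `(l + 1) * β ^ 7 ≤ β ^ 12`. The total `45 + 12 = 57` is the exponent that `Y`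
  -- has to exceed.
  retLen-hints : ∀ k → 1 ≤ k → retLen k (a * 12) ≤ k * (a * 57)
  retLen-hints k 1≤k = begin
    retLen k (a * 12)         ≤⟨ retLen≤ k (a * 12) 1≤k ⟩
    k * (a * 45 + a * 12)     ≡⟨ e k a ⟩
    k * (a * 57)              ∎
    where
    open ≤-Reasoning
    e : ∀ k a → k * (a * 45 + a * 12) ≡ k * (a * 57)
    e = solve-∀

  b : ℕ
  b = β ^ 7

  1≤b : 1 ≤ b
  1≤b = β^-pos 7

  -- Each of the `g` groups is charged O(`β ^ 5`) bits but has about `b = β ^ 7` elements. Of the
  -- two spare factors `β` one appears in the conclusion and the other absorbs the constants.
  retLen-groups : ∀ g n → 1 ≤ g → g * b ≤ n + n → β * retLen g l ≤ n
  retLen-groups g n 1≤g gb≤ = *-cancelˡ-≤ β (begin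
    β * (β * retLen g l)              ≤⟨ *-monoʳ-≤ β (*-monoʳ-≤ β (retLen≤ g l 1≤g)) ⟩
    β * (β * (g * (a * 45 + l)))      ≤⟨ *-monoʳ-≤ β (*-monoʳ-≤ β (*-monoʳ-≤ g (+-mono-≤ (≤-trans (a*c≤β 45) (≤-trans β≤l l≤β^5)) l≤β^5))) ⟩
    β * (β * (g * (β ^ 5 + β ^ 5)))   ≡⟨ e₁ β g (β ^ 5) ⟩
    2 * (g * b)                       ≤⟨ *-monoʳ-≤ 2 gb≤ ⟩
    2 * (n + n)                       ≡⟨ e₂ n ⟩
    4 * n                             ≤⟨ *-monoˡ-≤ n (const≤β 4) ⟩
    β * n                             ∎)
    where
    open ≤-Reasoning
    l≤β^5 : l ≤ β ^ 5
    l≤β^5 = ≤-trans (m≤m+n l 3) l-upper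
    e₁ : ∀ x g y → x * (x * (g * (y + y))) ≡ 2 * (g * (x * (x * y)))
    e₁ = solve-∀
    e₂ : ∀ n → 2 * (n + n) ≡ 4 * n
    e₂ = solve-∀

  module Parts (m : ℕ) (m<2^l : suc m ≤ 2 ^ l) where

    m≤2^l : m ≤ 2 ^ l
    m≤2^l = ≤-trans (n≤1+n m) m<2^l

    hintsAt : ∀ k → 1 ≤ k → k ≤ m → Retrieval (4 * l) m k (a * 12) retCost (retLen k (a * 12))
    hintsAt k 1≤k k≤m = mkRetrieval m k (a * 12) (≤-trans m<2^l (^-monoʳ-≤ 2 (m≤m+n l (1 * l)))) 1≤k (≤-trans k≤m m≤2^l) (≤-trans (a*c≤β 12) (≤-trans β≤l l≤4l))

    Hints : ℕ → Set
    Hints e = Σ ℕ λ len → Retrieval (4 * l) m e (a * 12) retCost len × len ≤ e * (a * 57)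

    -- The query learns the number of hints by reading, so `Structure` wants a retrieval structure
    -- for every `e`. With `e = 0` no element is a key, with `e > m` no key set exists; the empty
    -- structure serves both.
    hintsBy : ∀ e → Dec (1 ≤ e) → Dec (e ≤ m) → Hints e
    hintsBy e (no q) _ = 0 , trivialRetrieval (λ p h x px lx → q (≤-trans (s≤s z≤n) (subst (cnt p x <_) h (cnt-< p px lx)))) , z≤n
    hintsBy e (yes _) (no q) = 0 , trivialRetrieval (λ p h _ _ _ → q (≤-trans (≤-reflexive (sym h)) (cnt-≤ p m))) , z≤n
    hintsBy e (yes 1≤e) (yes e≤m) = retLen e (a * 12) , hintsAt e 1≤e e≤m , retLen-hints e 1≤e

    hints : ∀ e → Hints e
    hints e = hintsBy e (1 ≤? e) (e ≤? m)

    keys< : suc (suc l * m) ≤ 2 ^ (2 * l)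
    keys< = begin
      suc (suc l * m)          ≤⟨ +-monoˡ-≤ (suc l * m) (s≤s {0} {l} z≤n) ⟩
      suc l + suc l * m        ≡⟨ sym (*-suc (suc l) m) ⟩
      suc l * suc m            ≤⟨ *-mono-≤ (m<2^m l) m<2^l ⟩
      2 ^ l * 2 ^ l            ≡⟨ sym (^-distribˡ-+-* 2 l l) ⟩
      2 ^ (l + l)              ≡⟨ cong (λ z → 2 ^ (l + z)) (sym (+-identityʳ l)) ⟩
      2 ^ (2 * l)              ∎
      where open ≤-Reasoning

    groupsAt : ∀ g → 1 ≤ g → g ≤ m → Retrieval (4 * l) (suc l * m) g l retCost (retLen g l)
    groupsAt g 1≤g g≤m = mkRetrieval (suc l * m) g l keys< 1≤g (≤-trans g≤m m≤2^l) l≤4l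

    groups : ℕ → ℕ
    groups n = ng m l b m≤2^l 1≤b (4 * l) n retCost

    groups≤n : ∀ n → 1 ≤ n → groups n ≤ n
    groups≤n n 1≤n = ≤-trans (s≤s (m/n≤m (n ∸ 1) b {{>-nonZero 1≤b}})) (≤-reflexive (m+[n∸m]≡n 1≤n))

    groups*b≤ : ∀ n → b < n → groups n * b ≤ n + n
    groups*b≤ n b<n = +-mono-≤ (<⇒≤ b<n) (≤-trans (m/n*n≤m (n ∸ 1) b {{>-nonZero 1≤b}}) (m∸n≤m n 1))

    Groups-located : ℕ → Set
    Groups-located n = Σ ℕ λ len → Locator m l b m≤2^l 1≤b (4 * l) n retCost len × β * len ≤ n

    locatorBy : ∀ n → n ≤ m → Dec (n ≤ b) → Groups-located n
    locatorBy n n≤m (yes q) = 0 , trivialLocator m l b m≤2^l 1≤b (4 * l) n retCost q , ≤-trans (≤-reflexive (*-zeroʳ β)) z≤n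
    locatorBy n n≤m (no q) = retLen (groups n) l
      , retrievalLocator m l b m≤2^l 1≤b (4 * l) n retCost {l} {retLen (groups n) l} 1≤n (≤-<-trans g≤n (≤-<-trans n≤m m<2^l)) (groupsAt (groups n) 1≤g (≤-trans g≤n n≤m))
      , retLen-groups (groups n) n 1≤g (groups*b≤ n (≰⇒> q))
      where
      1≤n : 1 ≤ n
      1≤n = ≤-trans 1≤b (<⇒≤ (≰⇒> q))
      g≤n : groups n ≤ n
      g≤n = groups≤n n 1≤n
      1≤g : 1 ≤ groups n
      1≤g = s≤s z≤n

    locator : ∀ n → n ≤ m → Groups-located n
    locator n n≤m = locatorBy n n≤m (n ≤? b)

-- Representations

record Scheme (W m n t L : ℕ) : Set where
  field
    encode : (p : ℕ → Bool) → cnt p m ≡ n → List Bool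
    length-encode : ∀ p h → length (encode p h) ≤ L
    rankP : ℕ → Prog W (Maybe ℕ) t
    selectP : ℕ → Prog W ℕ t
    exec-rankP : ∀ {mem} p h x → x < m → At mem 0 (encode p h) → exec mem (rankP x) ≡ (if p x then just (cnt p x) else nothing)
    exec-selectP : ∀ {mem} p h i → i < n → At mem 0 (encode p h) → exec mem (selectP i) ≡ sel p m i

-- The code of the whole set fits in one window and is decoded at once. This covers bounded
-- universes, where the asymptotic inequalities between parameters fail.
tinyScheme : ∀ W m n t → m ≤ W → Scheme W m n (suc t) ⌈log₂ bin m n ⌉
tinyScheme W m n t m≤W = record
  { encode = λ p _ → leaf m p
  ; length-encode = λ p h → ≤-reflexive (trans (length-bits ⌈log₂ bin m (cnt p m) ⌉ (code p m)) (cong (λ s → ⌈log₂ bin m s ⌉) h))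
  ; rankP = λ x → leafQ m n 0 (λ q → if q x then just (cnt q x) else nothing)
  ; selectP = λ i → leafQ m n 0 (λ q → sel q m i)
  ; exec-rankP = λ { p refl x lx at → exec-leafQ {t = t} m p 0 (λ q → if q x then just (cnt q x) else nothing) (short (cnt p m)) at
      (λ q h → cong₂ (λ u v → if u then just v else nothing) (h x lx) (cnt-cong q p x (λ y l → h y (<-trans l lx)))) }
  ; exec-selectP = λ { p refl i _ at → exec-leafQ {t = t} m p 0 (λ q → sel q m i) (short (cnt p m)) at (λ q h → sel-cong q p m i h) } }
  where
  short : ∀ s → ⌈log₂ bin m s ⌉ ≤ W
  short s = ≤-trans (⌈log₂⌉-least m (bin≤2^n m s)) m≤W

module _ {W : ℕ} (F : FID W) where
  open FID F

  -- Membership is recovered from two ranks: `x` is an element exactly when the rank increases from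
  -- `x` to `suc x`.
  denseScheme : ∀ m n t → Fits m → rankCost + (rankCost + 0) ≤ t → selCost ≤ t → Scheme W m n t (len m n)
  denseScheme m n t fits rt st = record
    { encode = λ p _ → enc m p
    ; length-encode = λ { p refl → ≤-reflexive (length-enc m p fits) }
    ; rankP = λ x → weaken rt (member x)
    ; selectP = λ i → weaken st (selQ m n 0 i)
    ; exec-rankP = λ {mem} p h x lx at → trans (exec-weaken mem rt (member x)) (rank-correct mem p h x lx at)
    ; exec-selectP = λ { {mem} p refl i il at → trans (exec-weaken mem st (selQ m n 0 i)) (exec-selQ m p 0 i fits il at) } }
    where
    answerOf : ℕ → ℕ → Maybe ℕ
    answerOf r r' = if r <ᵇ r' then just r else nothing
    member : ℕ → Prog W (Maybe ℕ) (rankCost + (rankCost + 0))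
    member x = rankQ m n 0 x >>= λ r → rankQ m n 0 (suc x) >>= λ r' → ret (answerOf r r')
    rank-correct : ∀ mem p → cnt p m ≡ n → ∀ x → x < m → At mem 0 (enc m p) → exec mem (member x) ≡ (if p x then just (cnt p x) else nothing)
    rank-correct mem p refl x lx at = exec-bind mem (rankQ m n 0 x) (λ r → rankQ m n 0 (suc x) >>= λ r' → ret {t = 0} (answerOf r r')) (exec-rankQ m p 0 x fits (<⇒≤ lx) at)
      (exec-bind mem (rankQ m n 0 (suc x)) (λ r' → ret {t = 0} (answerOf (cnt p x) r')) (exec-rankQ m p 0 (suc x) fits lx at) decide)
      where
      decide : answerOf (cnt p x) (cnt p (suc x)) ≡ (if p x then just (cnt p x) else nothing)
      decide with p x
      ... | true rewrite <ᵇ-true (n<1+n (cnt p x)) = refl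
      ... | false rewrite <ᵇ-false (≤-refl {cnt p x}) = refl

-- The term bound with `x = 2 * h`: every `h` factors `1 + 1/x` amount to at most 2. With
-- `2 * h = β`, the set of starts costs `a` bits per index that is not a start, plus about `2 n / β`
-- bits of redundancy.
bin-near : ∀ h n e .{{_ : NonZero h}} → bin n e ≤ 2 ^ suc (n / h) * (2 * h) ^ e
bin-near h n e = *-cancelʳ-≤ _ _ (x ^ n) {{m^n≢0 x n {{>-nonZero 1≤x}}}} (begin
  bin n e * x ^ n                               ≤⟨ bin*x^n≤[1+x]^n*x^e n e x ⟩
  (1 + x) ^ n * x ^ e                           ≤⟨ *-monoˡ-≤ (x ^ e) power ⟩
  2 ^ suc (n / h) * x ^ n * x ^ e               ≡⟨ e₁ (2 ^ suc (n / h)) (x ^ n) (x ^ e) ⟩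
  2 ^ suc (n / h) * x ^ e * x ^ n               ∎)
  where
  open ≤-Reasoning
  x = 2 * h
  1≤x : 1 ≤ x
  1≤x = ≤-trans (>-nonZero⁻¹ h) (m≤m+n h _)
  e₁ : ∀ a b c → a * b * c ≡ a * c * b
  e₁ = solve-∀
  e₂ : ∀ a b c d → 2 * a * (b * c) ≡ 2 * b * (a * c)
  e₂ = solve-∀
  chunk : ∀ s → s ≤ h → (1 + x) ^ s ≤ 2 * x ^ s
  chunk s l = subst (λ z → z ^ s ≤ 2 * x ^ s) (+-comm x 1) ([q+j]^s≤2q^s x 1 s 1≤x (*-monoʳ-≤ 2 (≤-trans (≤-reflexive (*-identityʳ s)) l)))
  q = n / h
  ρ = n % h
  n≡ : n ≡ ρ + h * q
  n≡ = trans (m≡m%n+[m/n]*n n h) (cong (n % h +_) (*-comm (n / h) h))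
  power : (1 + x) ^ n ≤ 2 ^ suc q * x ^ n
  power = begin
    (1 + x) ^ n                             ≡⟨ trans (cong ((1 + x) ^_) n≡) (^-distribˡ-+-* (1 + x) ρ (h * q)) ⟩
    (1 + x) ^ ρ * (1 + x) ^ (h * q)         ≡⟨ cong ((1 + x) ^ ρ *_) (sym (^-*-assoc (1 + x) h q)) ⟩
    (1 + x) ^ ρ * ((1 + x) ^ h) ^ q         ≤⟨ *-mono-≤ (chunk ρ (<⇒≤ (m%n<n n h))) (^-monoˡ-≤ q (chunk h ≤-refl)) ⟩
    2 * x ^ ρ * (2 * x ^ h) ^ q             ≡⟨ cong (2 * x ^ ρ *_) (trans (^-distribʳ-* q 2 (x ^ h)) (cong (2 ^ q *_) (^-*-assoc x h q))) ⟩
    2 * x ^ ρ * (2 ^ q * x ^ (h * q))       ≡⟨ e₂ (x ^ ρ) (2 ^ q) (x ^ (h * q)) 0 ⟩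
    2 ^ suc q * (x ^ ρ * x ^ (h * q))       ≡⟨ cong (2 ^ suc q *_) (trans (sym (^-distribˡ-+-* x ρ (h * q))) (cong (x ^_) (sym n≡))) ⟩
    2 ^ suc q * x ^ n                       ∎

rankProbes selProbes retProbes selDProbes cost : ℕ
rankProbes = 3 + (trieRankCost Δ + 0)
selProbes = 1 + (rankProbes + (1 + (3 + (trieSelCost Δ + 0))))
retProbes = 1 + (1 + (rankProbes + 1))
selDProbes = rankProbes + (selProbes + (1 + 0))
cost = 1 + (rankProbes + (selProbes + ((selDProbes + 0) + (retProbes + (retProbes + ((selDProbes + 0) + 0))))))

-- An element that is not the first of its cell costs O(a) bits for its hint and its position among
-- the starts, but reduces the binomial coefficient of the occupied cells by a factor β^58.
module Sparse (a l : ℕ) (big : c₀ * suc a ≤ 2 ^ a) (l-lower : (2 ^ a) ^ 4 ≤ l) (l-upper : l + 3 ≤ (2 ^ a) ^ 5)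
  (m n r : ℕ) (m<2^l : suc m ≤ 2 ^ l) (n≤m : n ≤ m)
  (r-lower : suc n * (2 ^ a) ^ D * 2 ^ r ≤ m) (r-upper : m < suc n * (2 ^ a) ^ D * 2 ^ suc r) where

  open Params a l big l-lower l-upper
  open Sizes a l big l-lower l-upper
  open Parts m m<2^l

  -- `M` cells of `2 ^ r` positions lie entirely below `m`; one further cell, possibly incomplete,
  -- makes `k`. `A` is the number of cells aimed at, reached within a factor 2 by the choice of `r`.
  A M k : ℕ
  A = suc n * β ^ D
  M = shr m r
  k = suc M

  A≤M : A ≤ M
  A≤M = s≤s⁻¹ (*-cancelʳ-< (2 ^ r) A k (≤-<-trans r-lower (shr-upper m r)))

  k≤2A : k ≤ 2 * A
  k≤2A = *-cancelʳ-< (2 ^ r) M (2 * A) (≤-<-trans (shr-lower m r) (<-≤-trans r-upper (≤-reflexive (e A (2 ^ r)))))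
    where
    e : ∀ x y → x * (2 * y) ≡ 2 * x * y
    e = solve-∀

  2^l≤2^2l : 2 ^ l ≤ 2 ^ (2 * l)
  2^l≤2^2l = ^-monoʳ-≤ 2 (m≤m+n l (1 * l))

  fitsk : Fits k
  fitsk = Fits-2^2l k (≤-trans (s≤s (shr≤ m r)) (≤-trans m<2^l 2^l≤2^2l))

  fitsn : Fits n
  fitsn = Fits-2^2l n (≤-trans n≤m (≤-trans m≤2^l 2^l≤2^2l))

  r≤W : r ≤ 4 * l
  r≤W = ≤-trans (2^-cancel-≤ (begin
    2 ^ r           ≤⟨ m≤n*m (2 ^ r) A {{>-nonZero (*-mono-≤ (s≤s (z≤n {n})) (β^-pos D))}} ⟩
    A * 2 ^ r       ≤⟨ r-lower ⟩
    m               ≤⟨ m≤2^l ⟩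
    2 ^ l           ∎)) l≤4l
    where open ≤-Reasoning

  ω≤W : ⌈log₂ suc n ⌉ ≤ 4 * l
  ω≤W = ≤-trans (⌈log₂⌉-least l (≤-trans (s≤s n≤m) m<2^l)) l≤4l

  v₁-ok : suc l * b ≤ 2 ^ (a * 12)
  v₁-ok = begin
    suc l * b              ≤⟨ *-monoˡ-≤ b (≤-trans (≤-trans (s≤s (m≤m+n l 2)) (≤-reflexive (sym (+-suc l 2)))) l-upper) ⟩
    β ^ 5 * β ^ 7          ≡⟨ sym (^-distribˡ-+-* β 5 7) ⟩
    β ^ 12                 ≡⟨ β^≡ 12 ⟩
    2 ^ (a * 12)           ∎
    where open ≤-Reasoning

  len₁ : ℕ → ℕ
  len₁ e = proj₁ (hints e)

  len₂ : ℕ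
  len₂ = proj₁ (locator n n≤m)

  module S = Structure theFID m l b m≤2^l 1≤b n r k (a * 12) retCost retCost len₂ len₁
    (λ e → proj₁ (proj₂ (hints e))) (proj₁ (proj₂ (locator n n≤m))) (<⇒≤ (shr-upper m r)) fitsk fitsn r≤W ω≤W v₁-ok

  h : ℕ
  h = 2 ^ pred a

  β≡2h : β ≡ 2 * h
  β≡2h = cong (2 ^_) (sym (suc-pred a {{>-nonZero 1≤a}}))

  instance
    h-nonZero : NonZero h
    h-nonZero = m^n≢0 2 (pred a)

  -- Exponent 57 for a hint with its retrieval, and one more for the position of the element among
  -- the starts.
  Y : ℕ
  Y = β ^ 58

  -- With `e = n - d`, hints cost `(β ^ 57) ^ e` and the starts, through `bin n d = bin n e`,
  -- another `β ^ e`. By `bin-grow` their product with `bin k d` is at most `bin k n`, as if all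
  -- elements lay in different cells; the low bits then complete it to `bin m n`.
  savings : ∀ d → d ≤ n → 2 ^ (n * r) * (bin k d * (bin n d * 2 ^ len₁ (n ∸ d))) ≤ bin m n * 2 ^ (2 + n / h)
  savings d d≤n = begin
    2 ^ (n * r) * (bin k d * (bin n d * 2 ^ len₁ e))
      ≤⟨ *-monoʳ-≤ (2 ^ (n * r)) (*-monoʳ-≤ (bin k d) (*-mono-≤ bin-n (^-monoʳ-≤ 2 (proj₂ (proj₂ (hints e)))))) ⟩
    2 ^ (n * r) * (bin k d * (2 ^ suc (n / h) * β ^ e * 2 ^ (e * (a * 57))))
      ≡⟨ cong (λ z → 2 ^ (n * r) * (bin k d * (2 ^ suc (n / h) * β ^ e * z))) hint≡ ⟩
    2 ^ (n * r) * (bin k d * (2 ^ suc (n / h) * β ^ e * (β ^ 57) ^ e))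
      ≡⟨ cong (λ z → 2 ^ (n * r) * (bin k d * z)) (trans (*-assoc (2 ^ suc (n / h)) (β ^ e) ((β ^ 57) ^ e)) (cong (2 ^ suc (n / h) *_) (sym (^-distribʳ-* e β (β ^ 57))))) ⟩
    2 ^ (n * r) * (bin k d * (2 ^ suc (n / h) * Y ^ e))
      ≡⟨ e₁ (2 ^ (n * r)) (bin k d) (2 ^ suc (n / h)) (Y ^ e) ⟩
    2 ^ suc (n / h) * (2 ^ (n * r) * (bin k d * Y ^ e))
      ≤⟨ *-monoʳ-≤ (2 ^ suc (n / h)) (*-monoʳ-≤ (2 ^ (n * r)) (≤-trans (bin-grow k Y d e grow-ok) (≤-reflexive (cong (bin k) (m+[n∸m]≡n d≤n))))) ⟩
    2 ^ suc (n / h) * (2 ^ (n * r) * bin k n)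
      ≤⟨ *-monoʳ-≤ (2 ^ suc (n / h)) (*-monoʳ-≤ (2 ^ (n * r)) (bin-suc≤ M n 2n≤)) ⟩
    2 ^ suc (n / h) * (2 ^ (n * r) * (2 * bin M n))
      ≡⟨ e₂ (2 ^ suc (n / h)) (2 ^ (n * r)) (bin M n) ⟩
    bin M n * 2 ^ (n * r) * 2 ^ (2 + n / h)
      ≤⟨ *-monoˡ-≤ (2 ^ (2 + n / h)) cells ⟩
    bin m n * 2 ^ (2 + n / h) ∎
    where
    open ≤-Reasoning
    e = n ∸ d
    e₁ : ∀ x y z w → x * (y * (z * w)) ≡ z * (x * (y * w))
    e₁ = solve-∀
    e₂ : ∀ x y z → x * (y * (2 * z)) ≡ z * y * (2 * x)
    e₂ = solve-∀
    bin-n : bin n d ≤ 2 ^ suc (n / h) * β ^ e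
    bin-n = begin
      bin n d                               ≡⟨ subst (λ z → bin z d ≡ bin z e) (m+[n∸m]≡n d≤n) (bin-sym d e) ⟩
      bin n e                               ≤⟨ bin-near h n e ⟩
      2 ^ suc (n / h) * (2 * h) ^ e         ≡⟨ cong (λ z → 2 ^ suc (n / h) * z ^ e) (sym β≡2h) ⟩
      2 ^ suc (n / h) * β ^ e               ∎
    hint≡ : 2 ^ (e * (a * 57)) ≡ (β ^ 57) ^ e
    hint≡ = trans (cong (2 ^_) (*-comm e (a * 57))) (trans (sym (^-*-assoc 2 (a * 57) e)) (cong (_^ e) (sym (β^≡ 57))))
    β^D≡ : β ^ D ≡ β * Y
    β^D≡ = trans (cong (λ z → β ^ z) D≡59) refl
    YY : suc Y * n ≤ A
    YY = begin
      suc Y * n            ≤⟨ *-mono-≤ (+-monoˡ-≤ Y (β^-pos 58)) (n≤1+n n) ⟩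
      (Y + Y) * suc n      ≡⟨ cong (λ z → (Y + z) * suc n) (sym (+-identityʳ Y)) ⟩
      2 * Y * suc n        ≤⟨ *-monoˡ-≤ (suc n) (*-monoˡ-≤ Y (const≤β 2)) ⟩
      β * Y * suc n        ≡⟨ *-comm (β * Y) (suc n) ⟩
      suc n * (β * Y)      ≡⟨ cong (suc n *_) (sym β^D≡) ⟩
      A                    ∎
    grow-ok : suc Y * (d + e) ≤ k
    grow-ok = ≤-trans (≤-reflexive (cong (suc Y *_) (m+[n∸m]≡n d≤n))) (≤-trans YY (m≤n⇒m≤1+n A≤M))
    2n≤ : 2 * n ≤ suc M
    2n≤ = ≤-trans (*-monoˡ-≤ n (s≤s (β^-pos 58))) (≤-trans YY (m≤n⇒m≤1+n A≤M))
    cells : bin M n * 2 ^ (n * r) ≤ bin m n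
    cells = begin
      bin M n * 2 ^ (n * r)      ≡⟨ cong (bin M n *_) (trans (cong (2 ^_) (*-comm n r)) (sym (^-*-assoc 2 r n))) ⟩
      bin M n * (2 ^ r) ^ n      ≤⟨ bin-blocks M (2 ^ r) n ⟩
      bin (M * 2 ^ r) n          ≤⟨ bin-monoˡ n (shr-lower m r) ⟩
      bin m n                    ∎

  ov₁ ov₂ : ∀ d → d ≤ n → ℕ
  ov₁ d l = proj₁ (fidLen-overhead k d (suc n) k≤2A (m≤n⇒m≤1+n l))
  ov₂ d l = proj₁ (fidLen-overhead n d (suc n) n≤2A (m≤n⇒m≤1+n l))
    where
    n≤2A : n ≤ 2 * A
    n≤2A = ≤-trans (n≤1+n n) (≤-trans (m≤m*n (suc n) (β ^ D) {{m^n≢0 β D}}) (m≤m+n A _))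

  excess : ∀ d → d ≤ n → ℕ
  excess d l = (4 + n / h) + (ov₁ d l + ov₂ d l + len₂)

  excess≤ : ∀ d l → β * excess d l ≤ 6 * β + 7 * suc n
  excess≤ d l = begin
    β * ((4 + n / h) + (ov₁ d l + ov₂ d l + len₂))             ≡⟨ e₁ β (n / h) (ov₁ d l) (ov₂ d l) len₂ ⟩
    4 * β + β * (n / h) + (β * ov₁ d l + β * ov₂ d l + β * len₂)
      ≤⟨ +-mono-≤ (+-monoʳ-≤ (4 * β) half) (+-mono-≤ (+-mono-≤ (proj₂ (proj₂ (fidLen-overhead k d (suc n) k≤2A (m≤n⇒m≤1+n l)))) (proj₂ (proj₂ (fidLen-overhead n d (suc n) _ (m≤n⇒m≤1+n l)))))
           (≤-trans (proj₂ (proj₂ (locator n n≤m))) (n≤1+n n))) ⟩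
    4 * β + 2 * suc n + ((β + 2 * suc n) + (β + 2 * suc n) + suc n)   ≡⟨ e₂ β (suc n) ⟩
    6 * β + 7 * suc n                                          ∎
    where
    open ≤-Reasoning
    e₁ : ∀ b x y z w → b * ((4 + x) + (y + z + w)) ≡ 4 * b + b * x + (b * y + b * z + b * w)
    e₁ = solve-∀
    e₂ : ∀ b x → 4 * b + 2 * x + ((b + 2 * x) + (b + 2 * x) + x) ≡ 6 * b + 7 * x
    e₂ = solve-∀
    half : β * (n / h) ≤ 2 * suc n
    half = begin
      β * (n / h)            ≡⟨ trans (cong (_* (n / h)) β≡2h) (*-assoc 2 h (n / h)) ⟩
      2 * (h * (n / h))      ≡⟨ cong (2 *_) (*-comm h (n / h)) ⟩
      2 * (n / h * h)        ≤⟨ *-monoʳ-≤ 2 (≤-trans (m/n*n≤m n h) (n≤1+n n)) ⟩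
      2 * suc n              ∎

  length≤ : ∀ d (l : d ≤ n) → ⌈log₂ suc n ⌉ + (n * r + (fidLen k d + (fidLen n d + (len₁ (n ∸ d) + len₂)))) ≤ ⌈log₂ bin m n ⌉ + (⌈log₂ suc n ⌉ + excess d l)
  length≤ d l = begin
    ω + (n * r + (fidLen k d + (fidLen n d + (len₁ (n ∸ d) + len₂))))
      ≡⟨ cong₂ (λ u v → ω + (n * r + (u + (v + (len₁ (n ∸ d) + len₂))))) (proj₁ (proj₂ (fidLen-overhead k d (suc n) k≤2A (m≤n⇒m≤1+n l)))) (proj₁ (proj₂ (fidLen-overhead n d (suc n) _ (m≤n⇒m≤1+n l)))) ⟩
    ω + (n * r + (x + ov₁ d l + (y + ov₂ d l + (len₁ (n ∸ d) + len₂))))  ≡⟨ e₁ ω (n * r) x (ov₁ d l) y (ov₂ d l) (len₁ (n ∸ d)) len₂ ⟩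
    n * r + (x + (y + len₁ (n ∸ d))) + (ω + (ov₁ d l + ov₂ d l + len₂))  ≤⟨ +-monoˡ-≤ (ω + (ov₁ d l + ov₂ d l + len₂)) core ⟩
    ⌈log₂ bin m n ⌉ + (4 + n / h) + (ω + (ov₁ d l + ov₂ d l + len₂))     ≡⟨ e₂ ⌈log₂ bin m n ⌉ (n / h) ω (ov₁ d l + ov₂ d l + len₂) ⟩
    ⌈log₂ bin m n ⌉ + (ω + excess d l)                                   ∎
    where
    open ≤-Reasoning
    ω = ⌈log₂ suc n ⌉
    x = ⌈log₂ bin k d ⌉
    y = ⌈log₂ bin n d ⌉
    e₁ : ∀ w z x u y v p q → w + (z + (x + u + (y + v + (p + q)))) ≡ z + (x + (y + p)) + (w + (u + v + q))
    e₁ = solve-∀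
    e₂ : ∀ b x w o → b + (4 + x) + (w + o) ≡ b + (w + ((4 + x) + o))
    e₂ = solve-∀
    e₃ : ∀ z x y p → z * (2 * x * (2 * y * p)) ≡ 4 * (z * (x * (y * p)))
    e₃ = solve-∀
    d≤k : d ≤ k
    d≤k = ≤-trans l (≤-trans (n≤1+n n) (≤-trans (m≤m*n (suc n) (β ^ D) {{m^n≢0 β D}}) (m≤n⇒m≤1+n A≤M)))
    core : n * r + (x + (y + len₁ (n ∸ d))) ≤ ⌈log₂ bin m n ⌉ + (4 + n / h)
    core = ≤⌈log₂⌉+ (bin m n) (4 + n / h) (begin
      2 ^ (n * r + (x + (y + len₁ (n ∸ d))))
        ≡⟨ trans (^-distribˡ-+-* 2 (n * r) (x + (y + len₁ (n ∸ d)))) (cong (2 ^ (n * r) *_) (trans (^-distribˡ-+-* 2 x (y + len₁ (n ∸ d))) (cong (2 ^ x *_) (^-distribˡ-+-* 2 y (len₁ (n ∸ d)))))) ⟩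
      2 ^ (n * r) * (2 ^ x * (2 ^ y * 2 ^ len₁ (n ∸ d)))
        ≤⟨ *-monoʳ-≤ (2 ^ (n * r)) (*-mono-≤ (2^⌈log₂n⌉≤2n (bin k d) (bin-pos d≤k)) (*-monoˡ-≤ (2 ^ len₁ (n ∸ d)) (2^⌈log₂n⌉≤2n (bin n d) (bin-pos l)))) ⟩
      2 ^ (n * r) * (2 * bin k d * (2 * bin n d * 2 ^ len₁ (n ∸ d)))   ≡⟨ e₃ (2 ^ (n * r)) (bin k d) (bin n d) (2 ^ len₁ (n ∸ d)) ⟩
      4 * (2 ^ (n * r) * (bin k d * (bin n d * 2 ^ len₁ (n ∸ d))))     ≤⟨ *-monoʳ-≤ 4 (savings d l) ⟩
      4 * (bin m n * 2 ^ (2 + n / h))                                  ≡⟨ e₄ (bin m n) (2 ^ (2 + n / h)) ⟩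
      bin m n * 2 ^ (4 + n / h)                                        ∎)
      where
      e₄ : ∀ x y → 4 * (x * y) ≡ x * (2 * (2 * y))
      e₄ = solve-∀

  scheme : ∀ X → (∀ ov → β * ov ≤ 6 * β + 7 * suc n → ov ≤ X) → Scheme (4 * l) m n cost (⌈log₂ bin m n ⌉ + (⌈log₂ suc n ⌉ + X))
  scheme X bound = record
    { encode = S.Enc.encoding
    ; length-encode = λ p h → ≤-trans (≤-reflexive (S.Enc.length-encoding p h)) (≤-trans (length≤ _ (S.Enc.nD≤n p h))
        (+-monoʳ-≤ ⌈log₂ bin m n ⌉ (+-monoʳ-≤ ⌈log₂ suc n ⌉ (bound _ (excess≤ _ (S.Enc.nD≤n p h))))))
    ; rankP = S.rankP
    ; selectP = λ i → weaken select≤ (S.selectP i)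
    ; exec-rankP = λ {mem} p h x lx at → S.Enc.Exec.exec-rankP p h mem at x lx
    ; exec-selectP = λ {mem} p h i il at → trans (exec-weaken mem select≤ (S.selectP i)) (S.Enc.Exec.exec-selectP p h mem at i il) }
    where
    select≤ : 1 + selDProbes ≤ cost
    select≤ = s≤s (≤-trans (≤-trans (m≤m+n selDProbes 0) (m≤m+n (selDProbes + 0) (retProbes + (retProbes + ((selDProbes + 0) + 0))))) (≤-trans (m≤n+m _ selProbes) (m≤n+m _ rankProbes)))

-- Subsets as predicates

charS : ∀ {m} → Subset m → ℕ → Bool
charS [] _ = false
charS (b ∷ S) zero = b
charS (b ∷ S) (suc i) = charS S i

cnt-suc : ∀ p x → cnt p (suc x) ≡ b2n (p 0) + cnt (p ∘ suc) x
cnt-suc p x = trans (cnt-+ p 1 x) (cong (_+ cnt (p ∘ suc) x) (+-identityʳ (b2n (p 0))))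

cnt-charS : ∀ {m} (S : Subset m) → cnt (charS S) m ≡ ∣ S ∣
cnt-charS [] = refl
cnt-charS {suc m} (true ∷ S) = trans (cnt-suc (charS (true ∷ S)) m) (cong suc (cnt-charS S))
cnt-charS {suc m} (false ∷ S) = trans (cnt-suc (charS (false ∷ S)) m) (cnt-charS S)

charS-lookup : ∀ {m} (S : Subset m) x → charS S (toℕ x) ≡ lookup S x
charS-lookup (b ∷ S) Fin.zero = refl
charS-lookup (b ∷ S) (Fin.suc x) = charS-lookup S x

module _ {N : ℕ} (g : Fin N → Bool) where

  -- Generalised over an offset `o` and an embedding `f`, because the recursion of `tabulate` shifts
  -- the function it tabulates.
  count-below : ∀ {m} (S : Subset m) o (f : Fin m → Fin N) → (∀ i → toℕ (f i) ≡ o + toℕ i) → (∀ i → g (f i) ≡ lookup S i) → ∀ Y →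
    length (filterᵇ (λ y → toℕ y <ᵇ Y) (filterᵇ g (tabulate f))) ≡ cnt (charS S) (Y ∸ o)
  count-below [] o f fo gf Y = sym (cnt-[] (Y ∸ o))
    where
    cnt-[] : ∀ z → cnt (charS []) z ≡ 0
    cnt-[] zero = refl
    cnt-[] (suc z) = cnt-[] z
  count-below (b ∷ S) o f fo gf Y with o <? Y | count-below S (suc o) (f ∘ Fin.suc) (λ i → trans (fo (Fin.suc i)) (+-suc o (toℕ i))) (λ i → gf (Fin.suc i)) Y
  ... | no q | ih rewrite m≤n⇒m∸n≡0 (≮⇒≥ q) | m≤n⇒m∸n≡0 (m≤n⇒m≤1+n (≮⇒≥ q)) with g (f Fin.zero)
  ...   | false = ih
  ...   | true rewrite fo Fin.zero | +-identityʳ o | <ᵇ-false (≮⇒≥ q) = ih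
  count-below (b ∷ S) o f fo gf Y | yes q | ih = trans (step b (gf Fin.zero)) (trans (sym (cnt-suc (charS (b ∷ S)) (Y ∸ suc o))) (cong (cnt (charS (b ∷ S))) (suc[m]∸ q)))
    where
    suc[m]∸ : ∀ {o Y} → o < Y → suc (Y ∸ suc o) ≡ Y ∸ o
    suc[m]∸ {o} {suc Y} (s≤s l) = sym (+-∸-assoc 1 l)
    step : ∀ c → g (f Fin.zero) ≡ c → length (filterᵇ (λ y → toℕ y <ᵇ Y) (filterᵇ g (tabulate f))) ≡ b2n c + cnt (charS S) (Y ∸ suc o)
    step false e rewrite e = ih
    step true e rewrite e | fo Fin.zero | +-identityʳ o | <ᵇ-true q = cong suc ih

  nth-selected : ∀ {m} (S : Subset m) o (f : Fin m → Fin N) → (∀ i → toℕ (f i) ≡ o + toℕ i) → (∀ i → g (f i) ≡ lookup S i) → ∀ i → i < cnt (charS S) m →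
    ∃ λ y → ∃ λ x → nth i (filterᵇ g (tabulate f)) ≡ just y × toℕ y ≡ o + x × x < m × charS S x ≡ true × cnt (charS S) x ≡ i
  nth-selected {suc m} (b ∷ S) o f fo gf i l = go b refl i (subst (i <_) (cnt-suc (charS (b ∷ S)) m) l)
    where
    tail : ∀ i → i < cnt (charS S) m → _
    tail = nth-selected S (suc o) (f ∘ Fin.suc) (λ i → trans (fo (Fin.suc i)) (+-suc o (toℕ i))) (λ i → gf (Fin.suc i))
    Goal : ℕ → Set
    Goal i = ∃ λ y → ∃ λ x → nth i (filterᵇ g (tabulate f)) ≡ just y × toℕ y ≡ o + x × x < suc m × charS (b ∷ S) x ≡ true × cnt (charS (b ∷ S)) x ≡ i
    head : ∀ c → g (f Fin.zero) ≡ c → filterᵇ g (tabulate f) ≡ (if c then f Fin.zero ∷ filterᵇ g (tabulate (f ∘ Fin.suc)) else filterᵇ g (tabulate (f ∘ Fin.suc)))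
    head true e rewrite e = refl
    head false e rewrite e = refl
    go : ∀ c → b ≡ c → ∀ i → i < b2n b + cnt (charS S) m → Goal i
    go true e zero _ = f Fin.zero , 0 , cong (nth 0) (head true (trans (gf Fin.zero) e)) , fo Fin.zero , s≤s z≤n , e , refl
    go true refl (suc i) (s≤s l) with tail i l
    ... | y , x , a , b' , c , d , e = y , suc x , trans (cong (nth (suc i)) (head true (gf Fin.zero))) a , trans b' (sym (+-suc o x)) , s≤s c , d , trans (cnt-suc (charS (true ∷ S)) x) (cong suc e)
    go false refl i l with tail i l
    ... | y , x , a , b' , c , d , e = y , suc x , trans (cong (nth i) (head false (gf Fin.zero))) a , trans b' (sym (+-suc o x)) , s≤s c , d , trans (cnt-suc (charS (false ∷ S)) x) e

rank-charS : ∀ {m} (S : Subset m) x → rank x S ≡ (if charS S (toℕ x) then ℤ.+ cnt (charS S) (toℕ x) else ℤ.-[1+ 0 ])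
rank-charS {m} S x = cong₂ (λ b z → if b then ℤ.+ z else ℤ.-[1+ 0 ]) (sym (charS-lookup S x)) (count-below (lookup S) S 0 (λ i → i) (λ _ → refl) (λ _ → refl) (toℕ x))

select-charS : ∀ {m} (S : Subset m) i → i < cnt (charS S) m → ∃ λ y → nth i (elemsAsc S) ≡ just y × toℕ y ≡ sel (charS S) m i
select-charS {m} S i l with nth-selected (lookup S) S 0 (λ i → i) (λ _ → refl) (λ _ → refl) i l
... | y , x , a , b , c , d , e = y , a , trans b (trans (sym (sel-cnt (charS S) m x d c)) (cong (sel (charS S) m) e))

toℤ : Maybe ℕ → ℤ.ℤ
toℤ (just i) = ℤ.+ i
toℤ nothing = ℤ.-[1+ 0 ]

toFin : ∀ {m} → 1 ≤ m → ℕ → Fin m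
toFin {m} 1≤m v with v <? m
... | yes l = fromℕ< l
... | no _ = fromℕ< 1≤m

toFin-toℕ : ∀ {m} (1≤m : 1 ≤ m) (y : Fin m) → toFin 1≤m (toℕ y) ≡ y
toFin-toℕ {m} 1≤m y with toℕ y <? m
... | yes l = toℕ-injective (toℕ-fromℕ< l)
... | no q = contradiction (toℕ<n y) q

-- Realization in the cell probe model

CellProbe : ℕ → ℕ → ℕ → ℕ → ℕ → Set
CellProbe m n w t L =
  Σ ((S : Subset m) → ∣ S ∣ ≡ n → Memory) λ enc →
  Σ (Fin m → Probe w ℤ.ℤ) λ rankQ →
  Σ (ℕ → Probe w (Fin m)) λ selectQ →
    (∀ (S : Subset m) (hS : ∣ S ∣ ≡ n) → UsesAtMostBits L (enc S hS))
    × (∀ (x : Fin m) → ProbesAtMost t (rankQ x))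
    × (∀ (i : ℕ) → 1 ≤ i → i ≤ n → ProbesAtMost t (selectQ i))
    × (∀ (S : Subset m) (hS : ∣ S ∣ ≡ n) (x : Fin m) → run (enc S hS) (rankQ x) ≡ rank x S)
    × (∀ (S : Subset m) (hS : ∣ S ∣ ≡ n) (i : ℕ) → 1 ≤ i → i ≤ n → select i S ≡ just (run (enc S hS) (selectQ i)))

realize : ∀ {W m n t L L'} Q w → 1 ≤ m → 1 ≤ w → W ≤ Q * w → L ≤ L' → Scheme W m n t L → CellProbe m n w ((t + 0) * (2 + Q)) L'
realize {W} {m} {n} {t} {L} {L'} Q w 1≤m 1≤w W≤ L≤ sch =
  memory , rankQ , selectQ ,
  (λ S hS i l → look-≥ (encode (charS S) (card S hS)) i (≤-trans (length-encode (charS S) (card S hS)) (≤-trans L≤ l))) ,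
  (λ x → compile-cost Q (rankProg x)) ,
  (λ i _ _ → compile-cost Q (selectProg i)) ,
  (λ S hS x → trans (run-compile Q (memory S hS) (rankProg x) W≤) (rank-ok S hS x)) ,
  (λ S hS i 1≤i i≤n → trans (select-ok S hS i 1≤i i≤n) (cong just (sym (run-compile Q (memory S hS) (selectProg i) W≤))))
  where
  open Scheme sch
  instance
    w-nonZero : NonZero w
    w-nonZero = >-nonZero 1≤w
  card : (S : Subset m) → ∣ S ∣ ≡ n → cnt (charS S) m ≡ n
  card S hS = trans (cnt-charS S) hS
  memory : (S : Subset m) → ∣ S ∣ ≡ n → Memory
  memory S hS = look (encode (charS S) (card S hS))
  rankProg : Fin m → Prog W ℤ.ℤ (t + 0)
  rankProg x = rankP (toℕ x) >>= λ r → ret (toℤ r)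
  selectProg : ℕ → Prog W (Fin m) (t + 0)
  selectProg i = selectP (i ∸ 1) >>= λ v → ret (toFin 1≤m v)
  rankQ : Fin m → Probe w ℤ.ℤ
  rankQ x = compile Q (rankProg x)
  selectQ : ℕ → Probe w (Fin m)
  selectQ i = compile Q (selectProg i)
  toℤ-if : ∀ b z → toℤ (if b then just z else nothing) ≡ (if b then ℤ.+ z else ℤ.-[1+ 0 ])
  toℤ-if true z = refl
  toℤ-if false z = refl
  rank-ok : ∀ S hS x → exec (memory S hS) (rankProg x) ≡ rank x S
  rank-ok S hS x = exec-bind (memory S hS) (rankP (toℕ x)) (λ r → ret (toℤ r)) (exec-rankP (charS S) (card S hS) (toℕ x) (toℕ<n x) (At-look _))
    (trans (toℤ-if (charS S (toℕ x)) (cnt (charS S) (toℕ x))) (sym (rank-charS S x)))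
  select-ok : ∀ S hS i → 1 ≤ i → i ≤ n → select i S ≡ just (exec (memory S hS) (selectProg i))
  select-ok S hS (suc i) _ l with select-charS S i (subst (suc i ≤_) (sym (card S hS)) l)
  ... | y , e , v = trans e (cong just (sym (exec-bind (memory S hS) (selectP i) (λ v → ret (toFin 1≤m v)) (exec-selectP (charS S) (card S hS) i l (At-look _))
    (trans (cong (toFin 1≤m) (sym v)) (toFin-toℕ 1≤m y)))))

-- Choice of the scale and redundancy in terms of n

c[1+a]≤2^a : ∀ c a → 3 * c ≤ a → c * suc a ≤ 2 ^ a
c[1+a]≤2^a c a l = subst (λ z → c * suc z ≤ 2 ^ z) (m+[n∸m]≡n l) (go (a ∸ 3 * c))
  where
  open ≤-Reasoning
  e : ∀ c → c * (1 + 3 * c) + (1 + 2 * c + c * (c * c)) ≡ (1 + c) * ((1 + c) * ((1 + c) * 1))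
  e = solve-∀
  e₂ : ∀ c x → c * (2 + x) + c * x ≡ 2 * (c * (1 + x))
  e₂ = solve-∀
  go : ∀ d → c * suc (3 * c + d) ≤ 2 ^ (3 * c + d)
  go zero rewrite +-identityʳ (3 * c) = begin
    c * suc (3 * c)                                     ≤⟨ m≤m+n _ (1 + 2 * c + c * (c * c)) ⟩
    c * suc (3 * c) + (1 + 2 * c + c * (c * c))         ≡⟨ e c ⟩
    suc c ^ 3                                           ≤⟨ ^-monoˡ-≤ 3 (m<2^m c) ⟩
    (2 ^ c) ^ 3                                         ≡⟨ ^-*-assoc 2 c 3 ⟩
    2 ^ (c * 3)                                         ≡⟨ cong (2 ^_) (*-comm c 3) ⟩
    2 ^ (3 * c)                                         ∎
  go (suc d) rewrite +-suc (3 * c) d = begin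
    c * suc (suc (3 * c + d))                           ≤⟨ m≤m+n _ (c * (3 * c + d)) ⟩
    c * suc (suc (3 * c + d)) + c * (3 * c + d)         ≡⟨ e₂ c (3 * c + d) ⟩
    2 * (c * suc (3 * c + d))                           ≤⟨ *-monoʳ-≤ 2 (go d) ⟩
    2 ^ suc (3 * c + d)                                 ∎

loosen : ∀ {W m n t L L'} → L ≤ L' → Scheme W m n t L → Scheme W m n t L'
loosen l s = record { encode = encode ; length-encode = λ p h → ≤-trans (length-encode p h) l ; rankP = rankP ; selectP = selectP
  ; exec-rankP = exec-rankP ; exec-selectP = exec-selectP }
  where open Scheme s

fourth : ℕ → ℕ
fourth a = (2 ^ a) ^ 4

-- For `x ≥ 1` the largest `a` with `(2 ^ a) ^ 4 ≤ x`. Searching below `x` suffices, because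
-- `fourth x` exceeds `x`.
scaleOf : ℕ → ℕ
scaleOf x = blk fourth x x

scaleOf-spec : ∀ x → 1 ≤ x → fourth (scaleOf x) ≤ x × x < fourth (suc (scaleOf x))
scaleOf-spec x 1≤x = proj₂ (blk-spec fourth x x 1≤x (<-≤-trans (m<2^m x) (m≤m*n (2 ^ x) ((2 ^ x) ^ 3) {{m^n≢0 (2 ^ x) 3 {{m^n≢0 2 x}}}})))

fourth-mono : ∀ {a b} → a ≤ b → fourth a ≤ fourth b
fourth-mono l = ^-monoˡ-≤ 4 (^-monoʳ-≤ 2 l)

scaleOf-mono : ∀ x y → 1 ≤ x → x ≤ y → scaleOf x ≤ scaleOf y
scaleOf-mono x y 1≤x x≤y with scaleOf x ≤? scaleOf y
... | yes q = q
... | no q = contradiction (≤-trans (fourth-mono (≰⇒> q)) (≤-trans (proj₁ (scaleOf-spec x 1≤x)) x≤y)) (<⇒≱ (proj₂ (scaleOf-spec y (≤-trans 1≤x x≤y))))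

module Choice (a l : ℕ) (big : c₀ * suc a ≤ 2 ^ a) (l-lower : fourth a ≤ l) (l< : l < fourth (suc a)) (m n : ℕ) (m<2^l : suc m ≤ 2 ^ l) (n≤m : n ≤ m)
  (X : ℕ) (bound : ∀ ov → 2 ^ a * ov ≤ 6 * 2 ^ a + 7 * suc n → ov ≤ X) where

  l-upper : l + 3 ≤ (2 ^ a) ^ 5
  l-upper = begin
    l + 3                                 ≤⟨ +-mono-≤ (<⇒≤ l<) (*-monoʳ-≤ 3 (m^n>0 (2 ^ a) {{m^n≢0 2 a}} 4)) ⟩
    (2 * 2 ^ a) ^ 4 + 3 * fourth a        ≡⟨ cong (_+ 3 * fourth a) (^-distribʳ-* 4 2 (2 ^ a)) ⟩
    16 * fourth a + 3 * fourth a          ≡⟨ sym (*-distribʳ-+ (fourth a) 16 3) ⟩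
    19 * fourth a                         ≤⟨ *-monoˡ-≤ (fourth a) (≤-trans (≤ᵇ⇒≤ 19 1000 tt) (≤-trans 1000≤c₀ (≤-trans (m≤m*n c₀ (suc a)) big))) ⟩
    (2 ^ a) ^ 5                           ∎
    where open ≤-Reasoning

  open Params a l big l-lower l-upper using (β; theFID; Fits-2^2l; fidLen-overhead; fidLen; β^-pos)

  Result : Set
  Result = Scheme (4 * l) m n cost (⌈log₂ bin m n ⌉ + (⌈log₂ suc n ⌉ + X))

  A : ℕ
  A = suc n * (2 ^ a) ^ D

  dense : m < A → Result
  dense m<A = loosen len≤ (denseScheme theFID m n cost fitsm rank≤ sel≤cost)
    where
    fitsm = Fits-2^2l m (≤-trans (n≤1+n m) (≤-trans m<2^l (^-monoʳ-≤ 2 (m≤m+n l (1 * l)))))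
    ovh = fidLen-overhead m n (suc n) (≤-trans (<⇒≤ m<A) (m≤m+n A _)) (n≤1+n n)
    ov≤ : proj₁ ovh ≤ X
    ov≤ = bound (proj₁ ovh) (≤-trans (proj₂ (proj₂ ovh)) (+-mono-≤ (m≤m+n β (5 * β)) (*-monoˡ-≤ (suc n) {2} {7} (s≤s (s≤s z≤n)))))
    len≤ : fidLen m n ≤ ⌈log₂ bin m n ⌉ + (⌈log₂ suc n ⌉ + X)
    len≤ = ≤-trans (≤-reflexive (proj₁ (proj₂ ovh))) (+-monoʳ-≤ ⌈log₂ bin m n ⌉ (≤-trans ov≤ (m≤n+m X ⌈log₂ suc n ⌉)))
    sel≤cost : selProbes ≤ cost
    sel≤cost = ≤-trans (m≤m+n selProbes _) (≤-trans (m≤n+m _ rankProbes) (n≤1+n _))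
    rank≤ : rankProbes + (rankProbes + 0) ≤ cost
    rank≤ = ≤-trans (+-monoʳ-≤ rankProbes (≤-trans (≤-reflexive (+-identityʳ rankProbes)) (≤-trans (≤-trans (m≤m+n rankProbes _) (n≤1+n _)) (m≤m+n selProbes _)))) (n≤1+n _)

  sparse : A ≤ m → Result
  sparse A≤m = Sparse.scheme a l big l-lower l-upper m n r m<2^l n≤m (proj₁ spec) (proj₂ spec) X bound
    where
    1≤A : 1 ≤ A
    1≤A = *-mono-≤ (s≤s (z≤n {n})) (β^-pos D)
    -- The largest `r` with `A * 2 ^ r ≤ m`, which leaves between `A` and `2 * A` cells.
    r = blk (λ r → A * 2 ^ r) m m
    spec = proj₂ (blk-spec (λ r → A * 2 ^ r) m m (≤-trans (≤-reflexive (*-identityʳ A)) A≤m) (<-≤-trans (m<2^m m) (m≤n*m (2 ^ m) A {{>-nonZero 1≤A}})))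

  choose : Dec (A ≤ m) → Result
  choose (yes q) = sparse q
  choose (no q) = dense (≰⇒> q)

-- At least 1, so that `scaleOf-spec` applies to `n = 0` as well.
lgs : ℕ → ℕ
lgs n = 1 ⊔ ⌈log₂ suc n ⌉

-- The logarithm stores the number of occupied cells; 6 and 7 are the coefficients in `excess≤`.
-- There the divisor `β` stems from `m`. Since `n ≤ m` and the scale is monotone, the power of two
-- obtained from `n` is no larger and may replace it.
redundancy : ℕ → ℕ
redundancy n = ⌈log₂ suc n ⌉ + (6 + _/_ (7 * suc n) (2 ^ scaleOf (lgs n)) {{m^n≢0 2 (scaleOf (lgs n))}})

redundancy-littleO : LittleO redundancy
redundancy-littleO k = N , small
  where
  N : ℕ
  -- Each summand brings one term of `k * redundancy n` below `n / 3`: the logarithm, the quotient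
  -- (through a divisor of at least `42 * k`) and the constant 6. The final 1 ensures `n ≥ 1`.
  N = 2 ^ (36 * k) + 2 ^ fourth (42 * k) + (18 * k + 1)
  y≤log : ∀ n y → 2 ^ y ≤ n → y ≤ ⌈log₂ suc n ⌉
  y≤log n y l = 2^-cancel-≤ (≤-trans l (≤-trans (n≤1+n n) (n≤2^⌈log₂n⌉ (suc n))))
  small : ∀ n → N ≤ n → k * redundancy n ≤ n
  small n N≤n = *-cancelˡ-≤ 3 (begin
    3 * (k * (L + (6 + x)))                     ≡⟨ e₀ k L x ⟩
    3 * k * L + 18 * k + 3 * (k * x)            ≤⟨ +-mono-≤ (+-mono-≤ partL part6) partX ⟩
    n + n + n                                   ≡⟨ e₁ n ⟩
    3 * n                                       ∎)
    where
    open ≤-Reasoning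
    L = ⌈log₂ suc n ⌉
    B = 2 ^ scaleOf (lgs n)
    instance
      B-nonZero : NonZero B
      B-nonZero = m^n≢0 2 (scaleOf (lgs n))
    x = 7 * suc n / B
    e₀ : ∀ k L x → 3 * (k * (L + (6 + x))) ≡ 3 * k * L + 18 * k + 3 * (k * x)
    e₀ = solve-∀
    e₁ : ∀ n → n + n + n ≡ 3 * n
    e₁ = solve-∀
    e₂ : ∀ k L → 4 * (3 * k * L) ≡ 12 * k * L
    e₂ = solve-∀
    e₃ : ∀ k x → 14 * (3 * (k * x)) ≡ x * (42 * k)
    e₃ = solve-∀
    e₄ : ∀ k → 3 * (12 * k) ≡ 36 * k
    e₄ = solve-∀
    1≤n : 1 ≤ n
    1≤n = ≤-trans (≤-trans (m≤n+m 1 (18 * k)) (m≤n+m _ (2 ^ (36 * k) + 2 ^ fourth (42 * k)))) N≤n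
    sucn≤2n : suc n ≤ 2 * n
    sucn≤2n = ≤-trans (+-monoˡ-≤ n 1≤n) (≤-reflexive (cong (n +_) (sym (+-identityʳ n))))
    part6 : 18 * k ≤ n
    part6 = ≤-trans (≤-trans (m≤m+n (18 * k) 1) (m≤n+m _ (2 ^ (36 * k) + 2 ^ fourth (42 * k)))) N≤n
    L-large : 3 * (12 * k) ≤ L
    L-large = ≤-trans (≤-reflexive (e₄ k)) (y≤log n (36 * k) (≤-trans (≤-trans (m≤m+n _ _) (m≤m+n _ _)) N≤n))
    partL : 3 * k * L ≤ n
    partL = *-cancelˡ-≤ 4 (begin
      4 * (3 * k * L)           ≡⟨ e₂ k L ⟩
      12 * k * L                ≤⟨ *-monoʳ-≤ (12 * k) (n≤1+n L) ⟩
      12 * k * suc L            ≤⟨ c[1+a]≤2^a (12 * k) L L-large ⟩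
      2 ^ L                     ≤⟨ 2^⌈log₂n⌉≤2n (suc n) (s≤s z≤n) ⟩
      2 * suc n                 ≤⟨ *-monoʳ-≤ 2 sucn≤2n ⟩
      2 * (2 * n)               ≡⟨ sym (*-assoc 2 2 n) ⟩
      4 * n                     ∎)
    42k≤B : 42 * k ≤ B
    42k≤B = ≤-trans (s≤s⁻¹ reach) (<⇒≤ (m<2^m (scaleOf (lgs n))))
      where
      lgs-large : fourth (42 * k) ≤ lgs n
      lgs-large = ≤-trans (y≤log n (fourth (42 * k)) (≤-trans (≤-trans (m≤n+m (2 ^ fourth (42 * k)) (2 ^ (36 * k))) (m≤m+n _ (18 * k + 1))) N≤n)) (m≤n⊔m 1 L)
      reach : 42 * k < suc (scaleOf (lgs n))
      reach with 42 * k <? suc (scaleOf (lgs n))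
      ... | yes q = q
      ... | no q = contradiction (≤-trans (fourth-mono (≮⇒≥ q)) lgs-large) (<⇒≱ (proj₂ (scaleOf-spec (lgs n) (m≤m⊔n 1 L))))
    partX : 3 * (k * x) ≤ n
    partX = *-cancelˡ-≤ 14 (begin
      14 * (3 * (k * x))        ≡⟨ e₃ k x ⟩
      x * (42 * k)              ≤⟨ *-monoʳ-≤ x 42k≤B ⟩
      x * B                     ≤⟨ m/n*n≤m (7 * suc n) B ⟩
      7 * suc n                 ≤⟨ *-monoʳ-≤ 7 sucn≤2n ⟩
      7 * (2 * n)               ≡⟨ sym (*-assoc 7 2 n) ⟩
      14 * n                    ∎)

-- From scale `3 * c₀` on, `c[1+a]≤2^a` yields the hypothesis `big`. Below it `m ≤ M₀`, a constant.
a₀ M₀ : ℕ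
a₀ = 3 * c₀
M₀ = 2 ^ fourth a₀

module Main (m n : ℕ) (1≤m : 1 ≤ m) (n≤m : n ≤ m) where

  l a X : ℕ
  l = ⌈log₂ suc m ⌉
  a = scaleOf l
  X = 6 + _/_ (7 * suc n) (2 ^ scaleOf (lgs n)) {{m^n≢0 2 (scaleOf (lgs n))}}

  m<2^l : suc m ≤ 2 ^ l
  m<2^l = n≤2^⌈log₂n⌉ (suc m)

  1≤l : 1 ≤ l
  1≤l = ⌈log₂⌉-mono-≤ {2} {suc m} (s≤s 1≤m)

  lgs≤l : lgs n ≤ l
  lgs≤l = ⊔-lub 1≤l (⌈log₂⌉-mono-≤ (s≤s n≤m))

  bound : ∀ ov → 2 ^ a * ov ≤ 6 * 2 ^ a + 7 * suc n → ov ≤ X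
  bound ov h = ≤-trans (x≤j+y/θ (2 ^ a) ov 6 (7 * suc n) {{m^n≢0 2 a}} h)
    (+-monoʳ-≤ 6 (/-monoʳ-≤ (7 * suc n) {2 ^ a} {2 ^ scaleOf (lgs n)} {{m^n≢0 2 a}} {{m^n≢0 2 (scaleOf (lgs n))}} (^-monoʳ-≤ 2 (scaleOf-mono (lgs n) l (m≤m⊔n 1 ⌈log₂ suc n ⌉) lgs≤l))))

  -- The bound on `W` turns windows of `W` bits into boundedly many cells of `w` bits: in the large
  -- case `W = 4 * l`, in the small case `W` is constant.
  Result : Set
  Result = ∃ λ W → (∀ c w → 1 ≤ w → l ≤ c * w → W ≤ (4 * c + M₀) * w) × Scheme W m n cost (⌈log₂ bin m n ⌉ + (⌈log₂ suc n ⌉ + X))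

  large : a₀ ≤ a → Result
  large h = 4 * l , window , Choice.choose a l (c[1+a]≤2^a c₀ a h) (proj₁ (scaleOf-spec l 1≤l)) (proj₂ (scaleOf-spec l 1≤l)) m n m<2^l n≤m X bound (_ ≤? m)
    where
    open ≤-Reasoning
    window : ∀ c w → 1 ≤ w → l ≤ c * w → 4 * l ≤ (4 * c + M₀) * w
    window c w _ le = begin
      4 * l                 ≤⟨ *-monoʳ-≤ 4 le ⟩
      4 * (c * w)           ≡⟨ sym (*-assoc 4 c w) ⟩
      4 * c * w             ≤⟨ *-monoˡ-≤ w (m≤m+n (4 * c) M₀) ⟩
      (4 * c + M₀) * w      ∎

  small : a < a₀ → Result
  small h = M₀ , (λ c w 1≤w _ → ≤-trans (m≤n+m M₀ (4 * c)) (m≤m*n (4 * c + M₀) w {{>-nonZero 1≤w}})) , loosen (m≤m+n _ _) (tinyScheme M₀ m n (pred cost) m≤M₀)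
    where
    m≤M₀ : m ≤ M₀
    m≤M₀ = ≤-trans (n≤1+n m) (≤-trans m<2^l (^-monoʳ-≤ 2 (≤-trans (<⇒≤ (proj₂ (scaleOf-spec l 1≤l))) (fourth-mono h))))

  choose : Dec (a₀ ≤ a) → Result
  choose (yes q) = large q
  choose (no q) = small (≰⇒> q)

theorem5p1 : ∀ (c : ℕ) → 1 ≤ c →
    Σ (ℕ → ℕ) λ f → LittleO f ×
    Σ ℕ λ t →
    ∀ (m n w : ℕ) → 1 ≤ m → n ≤ m →
    ⌈log₂ (suc m) ⌉ ≤ c * w → w ≤ c * ⌈log₂ (suc m) ⌉ →
    Σ ((S : Subset m) → ∣ S ∣ ≡ n → Memory) λ enc →
    Σ (Fin m → Probe w ℤ) λ rankQ →
    Σ (ℕ → Probe w (Fin m)) λ selectQ →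
    (∀ (S : Subset m) (hS : ∣ S ∣ ≡ n) →
    UsesAtMostBits (𝓑 n m + f n) (enc S hS))
    × (∀ (x : Fin m) → ProbesAtMost t (rankQ x))
    × (∀ (i : ℕ) → 1 ≤ i → i ≤ n → ProbesAtMost t (selectQ i))
    × (∀ (S : Subset m) (hS : ∣ S ∣ ≡ n) (x : Fin m) →
    run (enc S hS) (rankQ x) ≡ rank x S)
    × (∀ (S : Subset m) (hS : ∣ S ∣ ≡ n) (i : ℕ) → 1 ≤ i → i ≤ n →
    select i S ≡ just (run (enc S hS) (selectQ i)))
theorem5p1 c _ = redundancy , redundancy-littleO , (cost + 0) * (2 + (4 * c + M₀)) , λ m n w 1≤m n≤m l≤cw _ →
  let (W , window , sch) = Main.choose m n 1≤m n≤m (a₀ ≤? Main.a m n 1≤m n≤m)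
      1≤w = positive c w (≤-trans (Main.1≤l m n 1≤m n≤m) l≤cw)
  in realize (4 * c + M₀) w 1≤m 1≤w (window c w 1≤w l≤cw) (≤-reflexive (cong (λ z → ⌈log₂ z ⌉ + redundancy n) (bin≡C m n))) sch
  where
  positive : ∀ c w → 1 ≤ c * w → 1 ≤ w
  positive c zero h = contradiction (subst (1 ≤_) (*-zeroʳ c) h) λ ()
  positive c (suc w) _ = s≤s z≤n
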